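{- Let $q>5$ be a prime power. In $\mathrm{PG}(2,q^2)$ let $\mathcal B$ be a Baer subplane tangent to $\ell_\infty$, with $\mathcal B\cap\ell_\infty=\{\bar T\}$, and let $\mathcal C$ be an $\mathbb F_q$-conic contained in $\mathcal B$ with $\bar T\in\mathcal C$. Then in the Bruck–Bose representation in $\mathrm{PG}(4,q)$, $[\mathcal C]$ is a $g$-special twisted cubic.
   Context: Bruck–Bose setting: $q$ is a prime power; $\tau$ is a primitive element of $\mathbb F_{q^2}$ with minimal polynomial $x^2-t_1x-t_0$ over $\mathbb F_q$. In $\mathrm{PG}(2,q^2)$, $\ell_\infty$ is the line $z=0$; in $\mathrm{PG}(4,q)$ with coordinates $(x_0,x_1,y_0,y_1,z)$, $\Sigma_\infty$ is the hyperplane $z=0$. The affine point $A=(x_0+x_1\tau,y_0+y_1\tau,1)$ ($x_i,y_i\in\mathbb F_q$) of $\mathrm{PG}(2,q^2)$ corresponds to the affine point $[A]=(x_0,x_1,y_0,y_1,1)$ of $\mathrm{PG}(4,q)$; a point $\bar T=(d_0+d_1\tau,1,0)$ of $\ell_\infty$ corresponds to the line $[T]=\langle(d_0,d_1,1,0,0),(t_0d_1,d_0+t_1d_1,0,1,0)\rangle$ of $\Sigma_\infty$, and $(1,0,0)$ to $\langle(1,0,0,0,0),(0,1,0,0,0)\rangle$. These lines form a regular spread $\mathcal S$ of $\Sigma_\infty$. For a point $X$ of $\mathrm{PG}(4,q^2)$, $X^q$ denotes the point with all coordinates raised to the $q$-th power. The transversals of $\mathcal S$ are the lines $g=\langle A_0,A_1\rangle$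 and $g^q=\langle A_0^q,A_1^q\rangle$ of $\mathrm{PG}(4,q^2)$, where $A_0=(\tau^q,-1,0,0,0)$, $A_1=(0,0,\tau^q,-1,0)$; the point $\bar T=(\delta,1,0)$ of $\ell_\infty$ corresponds to $T=\delta A_0+A_1\in g$ (and $(1,0,0)$ to $A_0$), and the extension of $[T]$ is the line $TT^q$. For a point set $\mathcal V$ of $\mathrm{PG}(4,q)$ defined by homogeneous equations over $\mathbb F_q$ (e.g. a twisted cubic), $\mathcal V^\star$ denotes the set of points of $\mathrm{PG}(4,q^2)$ satisfying the same equations. An $\mathbb F_q$-conic of $\mathrm{PG}(2,q^2)$ is a non-degenerate conic of some Baer subplane. If $\mathcal C$ is an $\mathbb F_q$-conic in a Baer subplane $\mathcal B$ tangent to $\ell_\infty$ at $\bar T$ with $\bar T\in\mathcal C$, then (for $q\ge3$) the images $[A]$ of the affine points $A$ of $\mathcal C$ together with one point of $[T]$ form a twisted cubic of $\mathrm{PG}(4,q)$, denoted $[\mathcal C]$. A twisted cubic $\mathcal N$ of $\mathrm{PG}(4,q)$ is $g$-special if $\mathcal N^\star$ contains one point of $g$ and one point of $g^q$. -}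

module Defs where

open import Level using (0ℓ)
open import Data.Nat as ℕ using (ℕ; zero; suc; _≤_; _<_; _∸_)
open import Data.Nat.Primality using (Prime)
open import Data.Fin using (Fin; zero; suc)
open import Data.Product using (Σ; ∃; _×_; _,_)
open import Data.Sum using (_⊎_)
open import Relation.Nullary using (¬_)
open import Relation.Binary.PropositionalEquality using (_≡_; _≢_)
open import Relation.Binary.Definitions using (DecidableEquality)
open import Algebra.Structures using (IsCommutativeRing)
open import Function.Bundles using (_⇔_)

IsPrimePower : ℕ → Set
IsPrimePower q = Σ ℕ λ p → Σ ℕ λ k → Prime p × 1 ≤ k × q ≡ p ℕ.^ k

-- Fields (with propositional equality); finiteness of order q is imposed
-- separately in the statement by a bijection Carrier ↔ Fin q.

record Field : Set₁ where
  infixl 6 _+_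
  infixl 7 _*_
  infix 8 -_
  field
    Carrier : Set
    _+_ _*_ : Carrier → Carrier → Carrier
    -_      : Carrier → Carrier
    0# 1#   : Carrier
    isCommutativeRing : IsCommutativeRing _≡_ _+_ _*_ -_ 0# 1#
    0≢1     : 0# ≢ 1#
    inverse : ∀ x → x ≢ 0# → Σ Carrier λ y → x * y ≡ 1#
    _≟_     : DecidableEquality Carrier

-- The Bruck–Bose geometry over a field F = F_q, with F_{q^2} = F(τ),
-- τ² = t₁ τ + t₀.  Vectors are functions Fin n → K.

module Geometry (F : Field) (q : ℕ) (t₀ t₁ : Field.Carrier F) where
  open Field F

  -- Irreducibility of x² - t₁x - t₀ over F (so it is the minimal
  -- polynomial of τ and F[τ] ≅ F_{q²}).
  Irreducible : Set
  Irreducible = ∀ a → a * a ≢ t₁ * a + t₀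

  -- F_{q²} = { a + b τ }, represented by pairs (a , b).
  E : Set
  E = Carrier × Carrier

  0E 1E τ : E
  0E = 0# , 0#
  1E = 1# , 0#
  τ  = 0# , 1#

  ι : Carrier → E
  ι a = a , 0#

  infixl 6 _+E_
  infixl 7 _*E_
  _+E_ _*E_ : E → E → E
  (a , b) +E (c , d) = a + c , b + d
  -- (a + bτ)(c + dτ) = ac + bd t₀ + (ad + bc + bd t₁) τ
  (a , b) *E (c , d) = a * c + b * d * t₀ , a * d + b * c + b * d * t₁

  -E_ : E → E
  -E (a , b) = - a , - b

  _^E_ : E → ℕ → E
  x ^E zero  = 1E
  x ^E suc n = x *E (x ^E n)

  Primitive : Set
  Primitive = ∀ k → 1 ≤ k → k < q ℕ.* q ∸ 1 → τ ^E k ≢ 1E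

  V : Set → ℕ → Set
  V A n = Fin n → A

  NonZero : V Carrier 5 → Set
  NonZero x = ¬ (∀ i → x i ≡ 0#)

  NonZeroE : ∀ {n} → V E n → Set
  NonZeroE x = ¬ (∀ i → x i ≡ 0E)

  -- equality of projective points (proportional vectors)
  _∝_ : V Carrier 5 → V Carrier 5 → Set
  x ∝ y = Σ Carrier λ λ' → λ' ≢ 0# × (∀ i → x i ≡ λ' * y i)

  _∝E_ : ∀ {n} → V E n → V E n → Set
  x ∝E y = Σ E λ λ' → λ' ≢ 0E × (∀ i → x i ≡ λ' *E y i)

  vec3 : ∀ {A : Set} → A → A → A → V A 3
  vec3 a b c zero = a
  vec3 a b c (suc zero) = b
  vec3 a b c (suc (suc zero)) = c

  vec4 : ∀ {A : Set} → A → A → A → A → V A 4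
  vec4 a b c d zero = a
  vec4 a b c d (suc zero) = b
  vec4 a b c d (suc (suc zero)) = c
  vec4 a b c d (suc (suc (suc zero))) = d

  vec5 : ∀ {A : Set} → A → A → A → A → A → V A 5
  vec5 a b c d e zero = a
  vec5 a b c d e (suc zero) = b
  vec5 a b c d e (suc (suc zero)) = c
  vec5 a b c d e (suc (suc (suc zero))) = d
  vec5 a b c d e (suc (suc (suc (suc zero)))) = e

  sum3E : (Fin 3 → E) → E
  sum3E f = f zero +E (f (suc zero) +E f (suc (suc zero)))

  sum4 : (Fin 4 → Carrier) → Carrier
  sum4 f = f zero + (f (suc zero) + (f (suc (suc zero)) + f (suc (suc (suc zero)))))

  sum4E : (Fin 4 → E) → E
  sum4E f = f zero +E (f (suc zero) +E (f (suc (suc zero)) +E f (suc (suc (suc zero)))))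

  Mat3 : Set
  Mat3 = Fin 3 → Fin 3 → E

  _·3_ : Mat3 → V E 3 → V E 3
  (M ·3 v) i = sum3E λ j → M i j *E v j

  Nonsingular : Mat3 → Set
  Nonsingular M = ∀ v → (∀ i → (M ·3 v) i ≡ 0E) → ∀ i → v i ≡ 0E

  Mat54 : Set
  Mat54 = Fin 5 → Fin 4 → Carrier

  _·4_ : Mat54 → V Carrier 4 → V Carrier 5
  (K ·4 v) i = sum4 λ j → K i j * v j

  _·4E_ : Mat54 → V E 4 → V E 5
  (K ·4E v) i = sum4E λ j → ι (K i j) *E v j

  -- rank 4 (injective), i.e. its columns span a solid of PG(4,q)
  Rank4 : Mat54 → Set
  Rank4 K = ∀ v → (∀ i → (K ·4 v) i ≡ 0#) → ∀ j → v j ≡ 0#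

  OnLinf : V E 3 → Set
  OnLinf X = X (suc (suc zero)) ≡ 0E

  -- Baer subplane B = image of PG(2,q) under the collineation induced by
  -- a nonsingular matrix M over F_{q²}.
  BaerPoint : Mat3 → V E 3 → Set
  BaerPoint M X = NonZeroE X ×
    (Σ (V Carrier 3) λ v → (¬ (∀ i → v i ≡ 0#)) × X ∝E (M ·3 (λ i → ι (v i))))

  TangentAt : Mat3 → V E 3 → Set
  TangentAt M T = NonZeroE T × OnLinf T × BaerPoint M T ×
    (∀ X → BaerPoint M X → OnLinf X → X ∝E T)

  record QuadForm : Set where
    constructor quad
    field a b c f g h : Carrier

  evalQ : QuadForm → V Carrier 3 → Carrier
  evalQ (quad a b c f g h) v =
    let x = v zero ; y = v (suc zero) ; z = v (suc (suc zero)) in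
    a * x * x + b * y * y + c * z * z + f * y * z + g * x * z + h * x * y

  -- non-degeneracy (characteristic-free): 4abc + fgh - af² - bg² - ch² ≠ 0
  NonDegenerate : QuadForm → Set
  NonDegenerate (quad a b c f g h) =
    (1# + 1# + 1# + 1#) * a * b * c + f * g * h
      + - (a * f * f) + - (b * g * g) + - (c * h * h) ≢ 0#

  ConicPoint : Mat3 → QuadForm → V E 3 → Set
  ConicPoint M Q X = NonZeroE X ×
    (Σ (V Carrier 3) λ v → (¬ (∀ i → v i ≡ 0#)) × evalQ Q v ≡ 0#
       × X ∝E (M ·3 (λ i → ι (v i))))

  -- x is [A] for an affine point A = (x₀+x₁τ, y₀+y₁τ, 1) of C
  AffineImage : Mat3 → QuadForm → V Carrier 5 → Set
  AffineImage M Q x = Σ Carrier λ x₀ → Σ Carrier λ x₁ → Σ Carrier λ y₀ → Σ Carrier λ y₁ →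
    x ∝ vec5 x₀ x₁ y₀ y₁ 1# × ConicPoint M Q (vec3 (x₀ , x₁) (y₀ , y₁) 1E)

  OnSpreadLine : V E 3 → V Carrier 5 → Set
  OnSpreadLine T P = NonZero P ×
    ((Σ Carrier λ d₀ → Σ Carrier λ d₁ →
        T ∝E vec3 (d₀ , d₁) 1E 0E ×
        (Σ Carrier λ α → Σ Carrier λ β → ∀ i →
           P i ≡ α * vec5 d₀ d₁ 1# 0# 0# i
                 + β * vec5 (t₀ * d₁) (d₀ + t₁ * d₁) 0# 1# 0# i))
     ⊎ (T ∝E vec3 1E 0E 0E ×
        (Σ Carrier λ α → Σ Carrier λ β → ∀ i →
           P i ≡ α * vec5 1# 0# 0# 0# 0# i + β * vec5 0# 1# 0# 0# 0# i)))

  CurveWith : Mat3 → QuadForm → V Carrier 5 → V Carrier 5 → Set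
  CurveWith M Q P x = NonZero x × (AffineImage M Q x ⊎ x ∝ P)

  Parametrizes : Mat54 → (V Carrier 5 → Set) → Set
  Parametrizes K N = ∀ x → NonZero x →
    N x ⇔ ((Σ Carrier λ t → x ∝ (K ·4 vec4 1# t (t * t) (t * t * t)))
           ⊎ x ∝ (K ·4 vec4 0# 0# 0# 1#))

  TwistedCubic : (V Carrier 5 → Set) → Set
  TwistedCubic N = Σ Mat54 λ K → Rank4 K × Parametrizes K N

  -- N*: the same curve over F_{q²} (points of PG(4,q²) satisfying the
  -- same equations)
  Star : Mat54 → V E 5 → Set
  Star K Y = NonZeroE Y ×
    ((Σ E λ t → Y ∝E (K ·4E vec4 1E t (t *E t) (t *E t *E t)))
     ⊎ Y ∝E (K ·4E vec4 0E 0E 0E 1E))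

  -- transversals g = ⟨A₀,A₁⟩ and g^q = ⟨A₀^q,A₁^q⟩
  τq : E
  τq = τ ^E q

  A₀ A₁ : V E 5
  A₀ = vec5 τq (-E 1E) 0E 0E 0E
  A₁ = vec5 0E 0E τq (-E 1E) 0E

  frob : V E 5 → V E 5
  frob X i = X i ^E q

  OnLineE : V E 5 → V E 5 → V E 5 → Set
  OnLineE U W Y = NonZeroE Y ×
    (Σ E λ α → Σ E λ β → ∀ i → Y i ≡ (α *E U i) +E (β *E W i))

  On-g On-gq : V E 5 → Set
  On-g  = OnLineE A₀ A₁
  On-gq = OnLineE (frob A₀) (frob A₁)

  ExactlyOnePoint : (V E 5 → Set) → (V E 5 → Set) → Set
  ExactlyOnePoint S L = Σ (V E 5) λ X → S X × L X ×
    (∀ Y → S Y → L Y → Y ∝E X)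

  -- g-special: N* contains exactly one point of g and one of g^q
  -- (N* is independent of the parametrization; we require it for all).
  GSpecial : (V Carrier 5 → Set) → Set
  GSpecial N = ∀ K → Rank4 K → Parametrizes K N →
    ExactlyOnePoint (Star K) On-g × ExactlyOnePoint (Star K) On-gq

{-# OPTIONS --safe #-}
module Submission where

-- Parametrise the conic so that T̄ has parameter ∞: its point of parameter t is
-- (X(t), Y(t), w(t)) with X, Y quadratic and w linear over F_{q²}.  Let w̄ be the
-- conjugate of w.  Multiplying by w̄ makes the last coordinate lie in F_q[t], so
-- that [C] is the cubic curve given by the F_q-components of Xw̄, Yw̄ and ww̄.
-- Tangency says that the coefficients of w are independent over F_q; this makes
-- the cubic a normal rational curve.  On its extension, membership in g means
-- X̄w = Ȳw = w̄w = 0, which happens exactly at the root of w (and for g^q at the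
-- root of w̄), since X̄, Ȳ, w̄ have no common zero.  That N* does not depend on the
-- parametrisation follows from the quadrics through a twisted cubic: restricted to
-- another parametrisation with the same F_q-points they are polynomials of degree
-- at most 6 with at least 7 zeros.

open import Defs
open import Level using (0ℓ)
open import Data.Nat as ℕ using (ℕ; zero; suc; _≤_; _<_; z≤n; s≤s; _!)
import Data.Nat.Properties as ℕₚ
open import Data.Nat.Combinatorics using (_C_; nCk≡n!/k![n-k]!; k![n∸k]!∣n!; nCn≡1)
open import Data.Nat.Divisibility using (_∣_; divides; ∣⇒≤; ∣1⇒≡1; m∣m*n)
open import Data.Nat.DivMod using (m/n*n≡m)
open import Data.Nat.Primality using (Prime; euclidsLemma; prime?; prime⇒irreducible; ¬prime[0]; ¬prime[1])
open import Data.Integer as ℤ using (ℤ)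
import Data.Integer.Properties as ℤₚ
open import Data.Fin using (Fin; zero; suc; toℕ; inject₁; inject≤; fromℕ)
open import Data.Fin.Patterns using (0F; 1F; 2F; 3F; 4F)
open import Data.Fin.Permutation using (Permutation′; permutation)
import Data.Fin.Properties as Finₚ
open import Data.Vec.Functional using (removeAt)
open import Data.Maybe using (Maybe; just; nothing)
open import Data.Product using (Σ; _×_; _,_; proj₁; proj₂)
open import Data.Product.Properties using (≡-dec)
open import Data.Sum using (_⊎_; inj₁; inj₂)
open import Relation.Nullary using (¬_; Dec; yes; no; contradiction)
open import Relation.Nullary.Decidable using (decidable-stable; ¬?; from-yes)
open import Relation.Binary.PropositionalEquality
  using (_≡_; _≢_; refl; sym; trans; cong; cong₂; subst; module ≡-Reasoning)
open import Relation.Binary.PropositionalEquality.Properties using (isEquivalence)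
open import Algebra.Bundles using (CommutativeRing; CommutativeMonoid)
import Algebra.Properties.AbelianGroup
import Algebra.Properties.CommutativeMonoid.Sum
import Algebra.Properties.CommutativeSemiring.Binomial
import Algebra.Properties.CommutativeSemiring.Exp
import Algebra.Properties.Group
import Algebra.Properties.Ring
import Algebra.Properties.Semiring.Exp
import Algebra.Properties.Semiring.Mult
import Algebra.Properties.Semiring.Mult.TCOptimised
import Algebra.Solver.Ring
open import Algebra.Solver.Ring.AlmostCommutativeRing
  using (_-Raw-AlmostCommutative⟶_; fromCommutativeRing)
open import Function.Bundles using (_↔_; Inverse; mk⇔; Equivalence)

-- The delicate point is that `GSpecial` ranges over every parametrisation of the cubic, and two of
-- them are only known to share their points over F. Coordinates with respect to the columns of one
-- matrix are read off by a dual basis; on the other curve they are cubic polynomials in t, and a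
-- product of two of them has degree at most 6. Since 6 is not a prime power, q > 5 means q ≥ 7,
-- which supplies the zeros. The dual basis gives only a left inverse of the matrix; that the other
-- curve stays in the span of these columns outside F is one more polynomial identity. Conjugation
-- is the explicit map τ ↦ t₁ - τ, so that its algebra consists of ring identities. It is linked to
-- the q-th power only at τ: τ^q is again a root of x² - t₁x - t₀, and it differs from τ by
-- primitivity. The point A₀ contains τ^q and not τ; that is why conjugated coefficients appear in
-- the equations of g. The conic is parametrised without any division by 2, so that even q needs no
-- separate treatment.

module IntegerCoefficients (R : CommutativeRing 0ℓ 0ℓ) where
  open import Data.Integer using (+_; -[1+_])
  open CommutativeRing R renaming (sym to ≈-sym; trans to ≈-trans; refl to ≈-refl)
  open Algebra.Properties.Semiring.Mult.TCOptimised semiring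
    renaming (_×_ to _·_)
  open Algebra.Properties.Ring ring
  open Algebra.Properties.AbelianGroup +-abelianGroup
  open import Relation.Binary.Reasoning.Setoid setoid

  -- The ring solver normalises coefficients by computation. Integers serve every ring, whatever its
  -- characteristic, through their canonical map.
  fromℤ : ℤ → Carrier
  fromℤ (+ n)    = n · 1#
  fromℤ -[1+ n ] = - (suc n · 1#)

  fromℤ-⊖ : ∀ m n → fromℤ (m ℤ.⊖ n) ≈ m · 1# + - (n · 1#)
  fromℤ-⊖ zero    zero    = ≈-trans (≈-sym -0#≈0#) (≈-sym (+-identityˡ _))
  fromℤ-⊖ zero    (suc n) = ≈-sym (+-identityˡ _)
  fromℤ-⊖ (suc m) zero    = ≈-trans (≈-sym (+-identityʳ _)) (+-congˡ (≈-sym -0#≈0#))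
  fromℤ-⊖ (suc m) (suc n) = begin
    fromℤ (suc m ℤ.⊖ suc n)                    ≡⟨ cong fromℤ (ℤₚ.[1+m]⊖[1+n]≡m⊖n m n) ⟩
    fromℤ (m ℤ.⊖ n)                            ≈⟨ fromℤ-⊖ m n ⟩
    -- Expanding 0 as 1 - 1 restores the successors that the recursion cancelled.
    a + - b                                    ≈⟨ +-congˡ (≈-sym (+-identityˡ _)) ⟩
    a + (0# + - b)                             ≈⟨ +-congˡ (+-congʳ (≈-sym (-‿inverseʳ 1#))) ⟩
    a + ((1# + - 1#) + - b)                    ≈⟨ +-congˡ (+-assoc _ _ _) ⟩
    a + (1# + (- 1# + - b))                    ≈⟨ ≈-sym (+-assoc _ _ _) ⟩
    (a + 1#) + (- 1# + - b)                    ≈⟨ +-cong (+-comm _ _) (⁻¹-∙-comm 1# b) ⟩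
    (1# + a) + - (1# + b)                      ≈⟨ +-cong (≈-sym (1+× m 1#)) (-‿cong (≈-sym (1+× n 1#))) ⟩
    suc m · 1# + - (suc n · 1#)                ∎
    where a = m · 1# ; b = n · 1#

  fromℤ-neg : ∀ i → fromℤ (ℤ.- i) ≈ - fromℤ i
  fromℤ-neg (+ zero)  = ≈-sym -0#≈0#
  fromℤ-neg (+ suc n) = ≈-refl
  fromℤ-neg -[1+ n ]  = ≈-sym (⁻¹-involutive _)

  fromℤ-+ : ∀ i j → fromℤ (i ℤ.+ j) ≈ fromℤ i + fromℤ j
  fromℤ-+ (+ m)    (+ n)    = ×-homo-+ 1# m n
  fromℤ-+ (+ m)    -[1+ n ] = fromℤ-⊖ m (suc n)
  fromℤ-+ -[1+ m ] (+ n)    = ≈-trans (fromℤ-⊖ n (suc m)) (+-comm _ _)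
  fromℤ-+ -[1+ m ] -[1+ n ] = begin
    - ((suc (suc (m ℕ.+ n))) · 1#)     ≡⟨ cong (λ k → - (suc k · 1#)) (sym (ℕₚ.+-suc m n)) ⟩
    - ((suc m ℕ.+ suc n) · 1#)         ≈⟨ -‿cong (×-homo-+ 1# (suc m) (suc n)) ⟩
    - (suc m · 1# + suc n · 1#)        ≈⟨ ≈-sym (⁻¹-∙-comm _ _) ⟩
    - (suc m · 1#) + - (suc n · 1#)    ∎

  fromℤ-pos-* : ∀ m j → fromℤ (+ m ℤ.* j) ≈ m · 1# * fromℤ j
  fromℤ-pos-* m (+ n) = begin
    fromℤ (+ m ℤ.* + n)      ≡⟨ cong fromℤ (sym (ℤₚ.pos-* m n)) ⟩
    (m ℕ.* n) · 1#           ≈⟨ ×1-homo-* m n ⟩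
    m · 1# * (n · 1#)        ∎
  fromℤ-pos-* m -[1+ n ] = begin
    fromℤ (+ m ℤ.* ℤ.- + suc n)      ≡⟨ cong fromℤ (sym (ℤₚ.neg-distribʳ-* (+ m) (+ suc n))) ⟩
    fromℤ (ℤ.- (+ m ℤ.* + suc n))    ≈⟨ fromℤ-neg (+ m ℤ.* + suc n) ⟩
    - fromℤ (+ m ℤ.* + suc n)        ≈⟨ -‿cong (fromℤ-pos-* m (+ suc n)) ⟩
    - (m · 1# * (suc n · 1#))        ≈⟨ -‿distribʳ-* _ _ ⟩
    m · 1# * - (suc n · 1#)          ∎

  fromℤ-* : ∀ i j → fromℤ (i ℤ.* j) ≈ fromℤ i * fromℤ j
  fromℤ-* (+ m)    j = fromℤ-pos-* m j
  fromℤ-* -[1+ m ] j = begin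
    fromℤ (ℤ.- (+ suc m) ℤ.* j)      ≡⟨ cong fromℤ (sym (ℤₚ.neg-distribˡ-* (+ suc m) j)) ⟩
    fromℤ (ℤ.- (+ suc m ℤ.* j))      ≈⟨ fromℤ-neg (+ suc m ℤ.* j) ⟩
    - fromℤ (+ suc m ℤ.* j)          ≈⟨ -‿cong (fromℤ-pos-* (suc m) j) ⟩
    - (suc m · 1# * fromℤ j)         ≈⟨ -‿distribˡ-* _ _ ⟩
    - (suc m · 1#) * fromℤ j         ∎

  morphism : CommutativeRing.rawRing ℤₚ.+-*-commutativeRing -Raw-AlmostCommutative⟶ fromCommutativeRing R
  morphism = record
    { ⟦_⟧ = fromℤ ; +-homo = fromℤ-+ ; *-homo = fromℤ-* ; -‿homo = fromℤ-neg
    ; 0-homo = ≈-refl ; 1-homo = ≈-refl }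

  fromℤ-≟ : ∀ i j → Maybe (fromℤ i ≈ fromℤ j)
  fromℤ-≟ i j with i ℤ.≟ j
  ... | yes refl = just ≈-refl
  ... | no _     = nothing

  open Algebra.Solver.Ring _ _ morphism fromℤ-≟ public

-- Field identities and polynomial functions

module FieldTheory (F : Field) where
  open Field F public
  ring : CommutativeRing 0ℓ 0ℓ
  ring = record { isCommutativeRing = isCommutativeRing }

  open CommutativeRing ring public
    using ( +-identityˡ; +-identityʳ; *-identityˡ; *-identityʳ; +-comm; *-comm
          ; *-assoc; zeroˡ; zeroʳ; -‿inverseʳ; commutativeSemiring; semiring)
  open Algebra.Properties.Ring (CommutativeRing.ring ring) public
    using (-0#≈0#)
  open IntegerCoefficients ring public
    using (solve; _:=_; _:+_; _:*_; :-_; con; Polynomial)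
  open ≡-Reasoning

  𝟘 𝟙 : ∀ {n} → Polynomial n
  𝟘 = con (ℤ.+ 0)
  𝟙 = con (ℤ.+ 1)

  infix 9 _⁻¹[_]
  _⁻¹[_] : ∀ x → x ≢ 0# → Carrier
  x ⁻¹[ nz ] = proj₁ (inverse x nz)

  *-inverseʳ : ∀ {x} (nz : x ≢ 0#) → x * x ⁻¹[ nz ] ≡ 1#
  *-inverseʳ {x} nz = proj₂ (inverse x nz)

  1≢0 : 1# ≢ 0#
  1≢0 e = 0≢1 (sym e)

  *-cancelˡ-0 : ∀ {x y} → x ≢ 0# → x * y ≡ 0# → y ≡ 0#
  *-cancelˡ-0 {x} {y} nz e = begin
    y                         ≡⟨ sym (*-identityˡ y) ⟩
    1# * y                    ≡⟨ cong (_* y) (sym (*-inverseʳ nz)) ⟩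
    x * i * y                 ≡⟨ solve 3 (λ x i y → x :* i :* y := i :* (x :* y)) refl x i y ⟩
    i * (x * y)               ≡⟨ cong (i *_) e ⟩
    i * 0#                    ≡⟨ zeroʳ i ⟩
    0#                        ∎
    where i = x ⁻¹[ nz ]

  *-≢0 : ∀ {x y} → x ≢ 0# → y ≢ 0# → x * y ≢ 0#
  *-≢0 nx ny e = ny (*-cancelˡ-0 nx e)

  *-≡0 : ∀ {x y} → x * y ≡ 0# → x ≡ 0# ⊎ y ≡ 0#
  *-≡0 {x} e with x ≟ 0#
  ... | yes x≡0 = inj₁ x≡0
  ... | no nz   = inj₂ (*-cancelˡ-0 nz e)

  x²≡0⇒x≡0 : ∀ {x} → x * x ≡ 0# → x ≡ 0#
  x²≡0⇒x≡0 e with *-≡0 e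
  ... | inj₁ p = p
  ... | inj₂ p = p

  x-y≡0⇒x≡y : ∀ {x y} → x + - y ≡ 0# → x ≡ y
  x-y≡0⇒x≡y {x} {y} = Algebra.Properties.Group.x∙y⁻¹≈ε⇒x≈y
    (CommutativeRing.+-group ring) x y

  x≡y⇒x-y≡0 : ∀ {x y} → x ≡ y → x + - y ≡ 0#
  x≡y⇒x-y≡0 {x} refl = -‿inverseʳ x

  *-cancelˡ : ∀ {x y z} → x ≢ 0# → x * y ≡ x * z → y ≡ z
  *-cancelˡ {x} {y} {z} nz e = x-y≡0⇒x≡y (*-cancelˡ-0 nz (begin
    x * (y + - z)       ≡⟨ solve 3 (λ x y z → x :* (y :+ :- z) := x :* y :+ :- (x :* z)) refl x y z ⟩
    x * y + - (x * z)   ≡⟨ x≡y⇒x-y≡0 e ⟩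
    0#                  ∎))

  ⁻¹-≢0 : ∀ {x} (nz : x ≢ 0#) → x ⁻¹[ nz ] ≢ 0#
  ⁻¹-≢0 {x} nz e = 1≢0 (trans (sym (*-inverseʳ nz)) (trans (cong (x *_) e) (zeroʳ x)))

  +-≡0 : ∀ {x y} → x ≡ 0# → y ≡ 0# → x + y ≡ 0#
  +-≡0 refl refl = +-identityˡ 0#

  +0 : ∀ x {y} → y ≡ 0# → x + y ≡ x
  +0 x refl = +-identityʳ x

  -‿≡0 : ∀ {x} → x ≡ 0# → - x ≡ 0#
  -‿≡0 refl = -0#≈0#

  *0 : ∀ x {y} → y ≡ 0# → x * y ≡ 0#
  *0 x refl = zeroʳ x

  0* : ∀ {x} y → x ≡ 0# → x * y ≡ 0#
  0* y refl = zeroˡ y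

  -- Polynomial functions of degree < n, in Horner form.
  Poly : ℕ → (Carrier → Carrier) → Set
  Poly zero    f = ∀ t → f t ≡ 0#
  Poly (suc n) f = Σ Carrier λ a → Σ (Carrier → Carrier) λ g →
    Poly n g × (∀ t → f t ≡ a + t * g t)

  poly-0 : ∀ n → Poly n (λ _ → 0#)
  poly-0 zero    t = refl
  poly-0 (suc n) = 0# , (λ _ → 0#) , poly-0 n ,
    λ t → solve 1 (λ t → 𝟘 := 𝟘 :+ t :* 𝟘) refl t

  poly-cong : ∀ n {f g} → (∀ t → g t ≡ f t) → Poly n f → Poly n g
  poly-cong zero    e p               = λ t → trans (e t) (p t)
  poly-cong (suc n) e (a , h , p , d) = a , h , p , λ t → trans (e t) (d t)

  poly-const : ∀ n a → Poly (suc n) (λ _ → a)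
  poly-const n a = a , (λ _ → 0#) , poly-0 n ,
    λ t → solve 2 (λ t a → a := a :+ t :* 𝟘) refl t a

  poly-shift : ∀ n {f} → Poly n f → Poly (suc n) (λ t → t * f t)
  poly-shift n {f} p = 0# , f , p , λ t → sym (+-identityˡ _)

  poly-weaken : ∀ {m n f} → m ≤ n → Poly m f → Poly n f
  poly-weaken {n = n} z≤n p = poly-cong n p (poly-0 n)
  poly-weaken (s≤s m≤n) (a , h , p , d) = a , h , poly-weaken m≤n p , d

  poly-+ : ∀ n {f g} → Poly n f → Poly n g → Poly n (λ t → f t + g t)
  poly-+ zero    p q = λ t → trans (cong₂ _+_ (p t) (q t)) (+-identityˡ 0#)
  poly-+ (suc n) (a , f , p , d) (b , g , q , e) =
    a + b , (λ t → f t + g t) , poly-+ n p q , λ t → trans (cong₂ _+_ (d t) (e t))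
      (solve 5 (λ a b t f g → a :+ t :* f :+ (b :+ t :* g) := a :+ b :+ t :* (f :+ g))
        refl a b t (f t) (g t))

  poly-scale : ∀ n c {f} → Poly n f → Poly n (λ t → c * f t)
  poly-scale zero    c p = λ t → *0 c (p t)
  poly-scale (suc n) c (a , f , p , d) =
    c * a , (λ t → c * f t) , poly-scale n c p , λ t → trans (cong (c *_) (d t))
      (solve 4 (λ a c t f → c :* (a :+ t :* f) := c :* a :+ t :* (c :* f)) refl a c t (f t))

  -- The bound of a product is the sum of the two bounds minus one; writing the second as `suc m`
  -- avoids the subtraction.
  poly-* : ∀ n m {f g} → Poly n f → Poly (suc m) g → Poly (n ℕ.+ m) (λ t → f t * g t)
  poly-* zero    m {g = g} p q =
    poly-cong m (λ t → 0* (g t) (p t)) (poly-0 m)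
  poly-* (suc n) m {g = g} (a , f , p , d) q =
    poly-cong (suc n ℕ.+ m)
      (λ t → trans (cong (_* g t) (d t))
        (solve 4 (λ a t f g → (a :+ t :* f) :* g := a :* g :+ t :* (f :* g)) refl a t (f t) (g t)))
      (poly-+ (suc n ℕ.+ m)
        (poly-weaken (s≤s (ℕₚ.m≤n+m m n)) (poly-scale (suc m) a q))
        (poly-shift (n ℕ.+ m) (poly-* n m p q)))

  -- Synthetic division in Horner form: if f = a + t h and h = h(x) + (t - x) g, the quotient of f
  -- is h(x) + t g.
  poly-factor : ∀ n {f} → Poly (suc n) f → ∀ x →
    Σ (Carrier → Carrier) λ g → Poly n g × (∀ t → f t ≡ f x + (t + - x) * g t)
  poly-factor zero {f} (a , h , p , d) x = (λ _ → 0#) , (λ _ → refl) , λ t → begin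
    f t                        ≡⟨ d t ⟩
    a + t * h t                ≡⟨ cong (λ z → a + t * z) (trans (p t) (sym (p x))) ⟩
    a + t * h x                ≡⟨ cong (λ z → a + t * z) (p x) ⟩
    a + t * 0#                 ≡⟨ solve 3 (λ a t x → a :+ t :* 𝟘 := a :+ x :* 𝟘 :+ (t :+ :- x) :* 𝟘) refl a t x ⟩
    a + x * 0# + (t + - x) * 0# ≡⟨ cong (λ z → a + x * z + (t + - x) * 0#) (sym (p x)) ⟩
    a + x * h x + (t + - x) * 0# ≡⟨ cong (_+ (t + - x) * 0#) (sym (d x)) ⟩
    f x + (t + - x) * 0#       ∎
  poly-factor (suc n) {f} (a , h , p , d) x with poly-factor n p x
  ... | g , pg , e = (λ t → h x + t * g t) , (h x , g , pg , λ _ → refl) , λ t → begin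
    f t                                             ≡⟨ d t ⟩
    a + t * h t                                     ≡⟨ cong (λ z → a + t * z) (e t) ⟩
    a + t * (h x + (t + - x) * g t)                 ≡⟨ solve 5 (λ a t x h g → a :+ t :* (h :+ (t :+ :- x) :* g)
                                                         := a :+ x :* h :+ (t :+ :- x) :* (h :+ t :* g)) refl a t x (h x) (g t) ⟩
    a + x * h x + (t + - x) * (h x + t * g t)       ≡⟨ cong (_+ (t + - x) * (h x + t * g t)) (sym (d x)) ⟩
    f x + (t + - x) * (h x + t * g t)               ∎

  -- Divide out the first root; as the roots are distinct, the others remain roots of the quotient.
  poly-vanish : ∀ n {f} → Poly n f → (xs : Fin n → Carrier) →
    (∀ i j → xs i ≡ xs j → i ≡ j) → (∀ i → f (xs i) ≡ 0#) → ∀ t → f t ≡ 0#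
  poly-vanish zero    p xs inj r t = p t
  poly-vanish (suc n) {f} p xs inj r t with poly-factor n p (xs zero)
  ... | g , pg , e = begin
    f t                     ≡⟨ e' t ⟩
    (t + - x) * g t         ≡⟨ *0 _ (poly-vanish n pg (λ i → xs (suc i)) inj' rg t) ⟩
    0#                      ∎
    where
    x = xs zero
    e' : ∀ t → f t ≡ (t + - x) * g t
    e' t = trans (e t) (trans (cong (_+ (t + - x) * g t) (r zero)) (+-identityˡ _))
    inj' : ∀ i j → xs (suc i) ≡ xs (suc j) → i ≡ j
    inj' i j eq with inj (suc i) (suc j) eq
    ... | refl = refl
    rg : ∀ i → g (xs (suc i)) ≡ 0#
    rg i = *-cancelˡ-0 (λ z → contradiction (inj (suc i) zero (x-y≡0⇒x≡y z)) λ ())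
             (trans (sym (e' _)) (r (suc i)))

-- Binomial coefficients at a prime and additivity of p-power maps

prime∤k! : ∀ {p} → Prime p → ∀ k → k < p → ¬ (p ∣ k !)
prime∤k! pr zero    k<p p∣1 = ¬prime[1] (subst Prime (∣1⇒≡1 p∣1) pr)
prime∤k! pr (suc k) k<p p∣k! with euclidsLemma (suc k) (k !) pr p∣k!
... | inj₁ d = contradiction (ℕₚ.<-≤-trans k<p (∣⇒≤ d)) (ℕₚ.<-irrefl refl)
... | inj₂ d = prime∤k! pr k (ℕₚ.<-trans (ℕₚ.n<1+n k) k<p) d

-- p divides p! = C(p,k) · k! · (p - k)!, but neither of the two factorials, because both arguments
-- are below p.
prime∣C : ∀ {p} → Prime p → ∀ k → 0 < k → k < p → p ∣ p C k
prime∣C {zero}  pr k 0<k ()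
prime∣C {p@(suc m)} pr k@(suc k-1) 0<k k<p = go (euclidsLemma (p C k) (k ! ℕ.* (p ℕ.∸ k) !) pr p∣)
  where
  instance _ = k ℕₚ.!* (p ℕ.∸ k) !≢0
  p! : (p C k) ℕ.* (k ! ℕ.* (p ℕ.∸ k) !) ≡ p !
  p! = trans (cong (ℕ._* (k ! ℕ.* (p ℕ.∸ k) !)) (nCk≡n!/k![n-k]! (ℕₚ.<⇒≤ k<p)))
             (m/n*n≡m (k![n∸k]!∣n! (ℕₚ.<⇒≤ k<p)))
  p∣ : p ∣ (p C k) ℕ.* (k ! ℕ.* (p ℕ.∸ k) !)
  p∣ = subst (p ∣_) (sym p!) (m∣m*n (m !))
  go : p ∣ p C k ⊎ p ∣ k ! ℕ.* (p ℕ.∸ k) ! → p ∣ p C k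
  go (inj₁ d) = d
  go (inj₂ d) with euclidsLemma (k !) ((p ℕ.∸ k) !) pr d
  ... | inj₁ d′ = contradiction d′ (prime∤k! pr k k<p)
  ... | inj₂ d′ = contradiction d′ (prime∤k! pr (p ℕ.∸ k) (s≤s (ℕₚ.m∸n≤m m k-1)))

module PowerTheory (L : Field) where
  open FieldTheory L
  open Algebra.Properties.Semiring.Mult semiring public
    using (×1-homo-*; ×-assocˡ; ×-assoc-*) renaming (_×_ to _·_)
  open Algebra.Properties.Semiring.Exp semiring public
    using (_^_; ^-assocʳ)
  open Algebra.Properties.CommutativeSemiring.Exp commutativeSemiring public
    using (^-distrib-*)
  open Algebra.Properties.CommutativeSemiring.Binomial commutativeSemiring
    renaming (theorem to binomial-theorem)
  open Algebra.Properties.CommutativeMonoid.Sum (CommutativeRing.+-commutativeMonoid ring)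
    using (sum; sum-init-last; sum-cong-≗; sum-replicate-zero)
  open ≡-Reasoning

  ^-≡0 : ∀ n {x} → x ^ n ≡ 0# → x ≡ 0#
  ^-≡0 zero    e = contradiction e 1≢0
  ^-≡0 (suc n) e with *-≡0 e
  ... | inj₁ p = p
  ... | inj₂ p = ^-≡0 n p

  char-* : ∀ {p} → p · 1# ≡ 0# → ∀ x → p · x ≡ 0#
  char-* {p} ch x = begin
    p · x           ≡⟨ cong (p ·_) (sym (*-identityˡ x)) ⟩
    p · (1# * x)    ≡⟨ sym (×-assoc-* p 1# x) ⟩
    p · 1# * x      ≡⟨ 0* x ch ⟩
    0#              ∎

  -- In the binomial theorem all coefficients strictly between the ends are multiples of p.
  frobenius : ∀ {p} → Prime p → p · 1# ≡ 0# → ∀ x y → (x + y) ^ p ≡ x ^ p + y ^ p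
  frobenius {zero}  pr ch x y = contradiction pr ¬prime[0]
  frobenius {p@(suc m)} pr ch x y = begin
    (x + y) ^ p                                     ≡⟨ binomial-theorem p x y ⟩
    t zero + sum (λ i → t (suc i))                  ≡⟨ cong₂ _+_ first (sum-init-last (λ i → t (suc i))) ⟩
    y ^ p + (sum (λ i → t (suc (inject₁ i))) + t (suc (fromℕ m)))
      ≡⟨ cong₂ (λ u v → y ^ p + (u + v)) (trans (sum-cong-≗ middle) (sum-replicate-zero m)) end ⟩
    y ^ p + (0# + x ^ p)                            ≡⟨ cong (y ^ p +_) (+-identityˡ _) ⟩
    y ^ p + x ^ p                                   ≡⟨ +-comm _ _ ⟩
    x ^ p + y ^ p                                   ∎
    where
    t = binomialTerm x y p
    first : t zero ≡ y ^ p
    first = trans (+-identityʳ _) (*-identityˡ _)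
    end : t (suc (fromℕ m)) ≡ x ^ p
    end = begin
      (p C toℕ (fromℕ p)) · (x ^ toℕ (fromℕ p) * y ^ (p ℕ.∸ toℕ (fromℕ p)))
        ≡⟨ cong (λ k → (p C k) · (x ^ k * y ^ (p ℕ.∸ k))) (Finₚ.toℕ-fromℕ p) ⟩
      (p C p) · (x ^ p * y ^ (p ℕ.∸ p))
        ≡⟨ cong₂ (λ k l → k · (x ^ p * y ^ l)) (nCn≡1 p) (ℕₚ.n∸n≡0 p) ⟩
      x ^ p * 1# + 0#        ≡⟨ trans (+-identityʳ _) (*-identityʳ _) ⟩
      x ^ p                  ∎
    middle : ∀ i → t (suc (inject₁ i)) ≡ 0#
    middle i with prime∣C pr (suc (toℕ (inject₁ i))) (s≤s z≤n)
                    (s≤s (subst (_< m) (sym (Finₚ.toℕ-inject₁ i)) (Finₚ.toℕ<n i)))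
    ... | divides c e = begin
      (p C suc (toℕ (inject₁ i))) · z   ≡⟨ cong (_· z) (trans e (ℕₚ.*-comm c p)) ⟩
      (p ℕ.* c) · z                     ≡⟨ sym (×-assocˡ z p c) ⟩
      p · (c · z)                       ≡⟨ char-* {p} ch _ ⟩
      0#                                ∎
      where z = binomial x y p (suc (inject₁ i))

  frobenius-^ : ∀ {p} → Prime p → p · 1# ≡ 0# → ∀ k x y →
    (x + y) ^ (p ℕ.^ k) ≡ x ^ (p ℕ.^ k) + y ^ (p ℕ.^ k)
  frobenius-^ {p} pr ch zero    x y = trans (*-identityʳ _) (sym (cong₂ _+_ (*-identityʳ x) (*-identityʳ y)))
  frobenius-^ {p} pr ch (suc k) x y = begin
    (x + y) ^ (p ℕ.* m)             ≡⟨ sym (^-assocʳ (x + y) p m) ⟩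
    ((x + y) ^ p) ^ m               ≡⟨ cong (_^ m) (frobenius pr ch x y) ⟩
    (x ^ p + y ^ p) ^ m             ≡⟨ frobenius-^ pr ch k (x ^ p) (y ^ p) ⟩
    (x ^ p) ^ m + (y ^ p) ^ m       ≡⟨ cong₂ _+_ (^-assocʳ x p m) (^-assocʳ y p m) ⟩
    x ^ (p ℕ.* m) + y ^ (p ℕ.* m)   ∎
    where m = p ℕ.^ k

-- Characteristic of a finite field and the identity x^q = x

module FiniteField (F : Field) (q : ℕ) (enum : Field.Carrier F ↔ Fin q) where
  open FieldTheory F
  open PowerTheory F
  open ≡-Reasoning
  open Inverse enum using (to; from; strictlyInverseˡ; strictlyInverseʳ)

  elem : Fin q → Carrier
  elem = from

  elem-injective : ∀ i j → elem i ≡ elem j → i ≡ j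
  elem-injective i j e = trans (sym (strictlyInverseˡ i)) (trans (cong to e) (strictlyInverseˡ j))

  module Reindex (M : CommutativeMonoid 0ℓ 0ℓ) where
    open CommutativeMonoid M using (_≈_) renaming (Carrier to A)
    open Algebra.Properties.CommutativeMonoid.Sum M using (sum; sum-permute)
    -- Kept general in the monoid because it serves twice: additively for translation by 1,
    -- multiplicatively for multiplication by x.
    sum-reindex : (f : Carrier → A) (σ σ⁻ : Carrier → Carrier) →
      (∀ a → σ (σ⁻ a) ≡ a) → (∀ a → σ⁻ (σ a) ≡ a) →
      sum (λ i → f (elem i)) ≈ sum (λ i → f (σ (elem i)))
    sum-reindex f σ σ⁻ inv inv′ =
      subst (λ z → sum (λ i → f (elem i)) ≈ z)
        (sum-cong-≗ {q} (λ i → cong f (strictlyInverseʳ (σ (elem i)))))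
        (sum-permute (λ i → f (elem i)) π)
      where
      open Algebra.Properties.CommutativeMonoid.Sum M using (sum-cong-≗)
      π : Permutation′ q
      π = permutation (λ i → to (σ (from i))) (λ i → to (σ⁻ (from i)))
        (λ i → trans (cong (λ z → to (σ z)) (strictlyInverseʳ _)) (trans (cong to (inv _)) (strictlyInverseˡ i)))
        (λ i → trans (cong (λ z → to (σ⁻ z)) (strictlyInverseʳ _)) (trans (cong to (inv′ _)) (strictlyInverseˡ i)))

  private
    module Add = Algebra.Properties.CommutativeMonoid.Sum (CommutativeRing.+-commutativeMonoid ring)
    module Mul = Algebra.Properties.CommutativeMonoid.Sum (CommutativeRing.*-commutativeMonoid ring)

  -- Translation by 1 permutes the field, so the sum s of all elements equals s + q · 1.
  q·1≡0 : q · 1# ≡ 0#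
  q·1≡0 = begin
    q · 1#                            ≡⟨ sym (Add.sum-replicate q) ⟩
    n                                 ≡⟨ solve 2 (λ s n → n := s :+ n :+ :- s) refl s n ⟩
    s + n + - s                       ≡⟨ cong (_+ - s) (sym (Add.∑-distrib-+ elem (λ _ → 1#))) ⟩
    Add.sum (λ i → elem i + 1#) + - s ≡⟨ cong (_+ - s) (sym (Reindex.sum-reindex
                                            (CommutativeRing.+-commutativeMonoid ring) (λ a → a) (_+ 1#) (_+ - 1#)
                                            (λ a → solve 1 (λ a → a :+ :- 𝟙 :+ 𝟙 := a) refl a)
                                            (λ a → solve 1 (λ a → a :+ 𝟙 :+ :- 𝟙 := a) refl a))) ⟩
    s + - s                           ≡⟨ -‿inverseʳ s ⟩
    0#                                ∎
    where
    s = Add.sum elem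
    n = Add.sum {q} (λ _ → 1#)

  -- A field has no nilpotents, and q · 1 = (p · 1)^k.
  characteristic : ∀ {p k} → q ≡ p ℕ.^ k → p · 1# ≡ 0#
  characteristic {p} {k} e = ^-≡0 k (trans (sym (pow k)) (trans (cong (_· 1#) (sym e)) q·1≡0))
    where
    pow : ∀ k → (p ℕ.^ k) · 1# ≡ (p · 1#) ^ k
    pow zero    = +-identityʳ 1#
    pow (suc k) = trans (×1-homo-* p (p ℕ.^ k)) (cong (p · 1# *_) (pow k))

  -- Multiplication by x ≠ 0 permutes the field, so the product of the nonzero elements
  -- equals itself times x^(q-1).  The factors are made total by unit, which replaces 0
  -- by 1; atZero x restores the missing factor x.
  private
    unit : Carrier → Carrier
    unit a with a ≟ 0#
    ... | yes _ = 1#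
    ... | no _  = a

    atZero : Carrier → Carrier → Carrier
    atZero x a with a ≟ 0#
    ... | yes _ = x
    ... | no _  = 1#

    unit≢0 : ∀ a → unit a ≢ 0#
    unit≢0 a with a ≟ 0#
    ... | yes _ = 1≢0
    ... | no nz = nz

    unit-* : ∀ {x} → x ≢ 0# → ∀ a → unit (x * a) * atZero x a ≡ x * unit a
    unit-* {x} x≢0 a with a ≟ 0# | (x * a) ≟ 0#
    ... | yes _   | yes _ = trans (*-identityˡ x) (sym (*-identityʳ x))
    ... | yes a≡0 | no nz = contradiction (*0 x a≡0) nz
    ... | no nz   | yes z = contradiction z (*-≢0 x≢0 nz)
    ... | no _    | no _  = *-identityʳ _

    atZero-0 : ∀ x {a} → a ≡ 0# → atZero x a ≡ x
    atZero-0 x {a} e with a ≟ 0#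
    ... | yes _ = refl
    ... | no nz = contradiction e nz

    atZero-≢0 : ∀ x {a} → a ≢ 0# → atZero x a ≡ 1#
    atZero-≢0 x {a} nz with a ≟ 0#
    ... | yes e = contradiction e nz
    ... | no _  = refl

    prod≢0 : ∀ {n} (f : Fin n → Carrier) → (∀ i → f i ≢ 0#) → Mul.sum f ≢ 0#
    prod≢0 {zero}  f nz = 1≢0
    prod≢0 {suc n} f nz = *-≢0 (nz zero) (prod≢0 (λ i → f (suc i)) (λ i → nz (suc i)))

    prod-point : ∀ x {n} (g : Fin n → Carrier) (i : Fin n) →
      g i ≡ 0# → (∀ j → j ≢ i → g j ≢ 0#) → Mul.sum (λ j → atZero x (g j)) ≡ x
    prod-point x {suc n} g i gi≡0 others = begin
      Mul.sum t                        ≡⟨ Mul.sum-remove {i = i} t ⟩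
      t i * Mul.sum (removeAt t i)     ≡⟨ cong₂ _*_ (atZero-0 x gi≡0)
                                           (trans (Mul.sum-cong-≗ (λ j → atZero-≢0 x (others _ (Finₚ.punchInᵢ≢i i j))))
                                                  (Mul.sum-replicate-zero n)) ⟩
      x * 1#                           ≡⟨ *-identityʳ x ⟩
      x                                ∎
      where
      t : Fin (suc n) → Carrier
      t j = atZero x (g j)

  fermat : ∀ x → x ^ q ≡ x
  fermat x with x ≟ 0#
  ... | no x≢0 = sym (*-cancelˡ (prod≢0 (λ i → unit (elem i)) (λ i → unit≢0 _)) (begin
    u * x                                            ≡⟨ cong (_* x) (Reindex.sum-reindex
                                                          (CommutativeRing.*-commutativeMonoid ring) unit (x *_) (x ⁻¹[ x≢0 ] *_)
                                                          (λ a → trans (sym (*-assoc _ _ _)) (trans (cong (_* a) (*-inverseʳ x≢0)) (*-identityˡ a)))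
                                                          (λ a → trans (solve 3 (λ i x a → i :* (x :* a) := x :* i :* a) refl _ x a)
                                                                   (trans (cong (_* a) (*-inverseʳ x≢0)) (*-identityˡ a)))) ⟩
    Mul.sum (λ i → unit (x * elem i)) * x            ≡⟨ cong (Mul.sum (λ i → unit (x * elem i)) *_)
                                                          (sym (prod-point x elem (to 0#) (strictlyInverseʳ 0#)
                                                            (λ j ne e → ne (trans (sym (strictlyInverseˡ j)) (cong to e))))) ⟩
    Mul.sum (λ i → unit (x * elem i)) * Mul.sum (λ i → atZero x (elem i))
                                                     ≡⟨ sym (Mul.∑-distrib-+ (λ i → unit (x * elem i)) (λ i → atZero x (elem i))) ⟩
    Mul.sum (λ i → unit (x * elem i) * atZero x (elem i))
                                                     ≡⟨ Mul.sum-cong-≗ (λ i → unit-* x≢0 (elem i)) ⟩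
    Mul.sum (λ i → x * unit (elem i))                ≡⟨ Mul.∑-distrib-+ (λ _ → x) (λ i → unit (elem i)) ⟩
    Mul.sum {q} (λ _ → x) * u                        ≡⟨ cong (_* u) (Mul.sum-replicate q) ⟩
    x ^ q * u                                        ≡⟨ *-comm _ _ ⟩
    u * x ^ q                                        ∎))
    where u = Mul.sum (λ i → unit (elem i))
  -- The index of 0 only witnesses that the exponent q is positive.
  ... | yes refl = 0^ q (to 0#)
    where
    0^ : ∀ n → Fin n → 0# ^ n ≡ 0#
    0^ (suc n) _ = zeroˡ _

-- Linear functionals and dual bases

module LinearAlgebra (L : Field) where
  open FieldTheory L
  open ≡-Reasoning

  Vect : ℕ → Set
  Vect m = Fin m → Carrier

  record Functional (m : ℕ) : Set where
    field
      fn    : Vect m → Carrier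
      fn-≗  : ∀ {x y} → (∀ i → x i ≡ y i) → fn x ≡ fn y
      fn-+  : ∀ x y → fn (λ i → x i + y i) ≡ fn x + fn y
      fn-*  : ∀ c x → fn (λ i → c * x i) ≡ c * fn x
  open Functional public

  coordinate : ∀ {m} → Fin m → Functional m
  coordinate i = record { fn = λ x → x i ; fn-≗ = λ e → e i ; fn-+ = λ _ _ → refl ; fn-* = λ _ _ → refl }

  scaled : ∀ {m} → Carrier → Functional m → Functional m
  scaled a φ = record
    { fn = λ x → a * fn φ x
    ; fn-≗ = λ e → cong (a *_) (fn-≗ φ e)
    ; fn-+ = λ x y → trans (cong (a *_) (fn-+ φ x y))
        (solve 3 (λ a x y → a :* (x :+ y) := a :* x :+ a :* y) refl a (fn φ x) (fn φ y))
    ; fn-* = λ c x → trans (cong (a *_) (fn-* φ c x))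
        (solve 3 (λ a c x → a :* (c :* x) := c :* (a :* x)) refl a c (fn φ x))
    }

  _⊕_ : ∀ {m} → Functional m → Functional m → Functional m
  φ ⊕ ψ = record
    { fn = λ x → fn φ x + fn ψ x
    ; fn-≗ = λ e → cong₂ _+_ (fn-≗ φ e) (fn-≗ ψ e)
    ; fn-+ = λ x y → trans (cong₂ _+_ (fn-+ φ x y) (fn-+ ψ x y))
        (solve 4 (λ a b c d → a :+ b :+ (c :+ d) := a :+ c :+ (b :+ d)) refl (fn φ x) (fn φ y) (fn ψ x) (fn ψ y))
    ; fn-* = λ c x → trans (cong₂ _+_ (fn-* φ c x) (fn-* ψ c x))
        (solve 3 (λ c x y → c :* x :+ c :* y := c :* (x :+ y)) refl c (fn φ x) (fn ψ x))
    }

  zeroFunctional : ∀ {m} → Functional m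
  zeroFunctional = record
    { fn = λ _ → 0# ; fn-≗ = λ _ → refl ; fn-+ = λ _ _ → sym (+-identityˡ 0#)
    ; fn-* = λ c _ → sym (zeroʳ c) }

  Σ* : ∀ {n} → Vect n → Vect n → Carrier
  Σ* {zero}  a b = 0#
  Σ* {suc n} a b = a zero * b zero + Σ* (λ j → a (suc j)) (λ j → b (suc j))

  Σ*-functional : ∀ {n m} → Vect n → (Fin n → Functional m) → Functional m
  Σ*-functional {zero}  a ψ = zeroFunctional
  Σ*-functional {suc n} a ψ = scaled (a zero) (ψ zero) ⊕ Σ*-functional (λ j → a (suc j)) (λ j → ψ (suc j))

  Σ*-functional-0 : ∀ {n m} (a : Vect n) (ψ : Fin n → Functional m) x →
    (∀ j → fn (ψ j) x ≡ 0#) → fn (Σ*-functional a ψ) x ≡ 0#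
  Σ*-functional-0 {zero}  a ψ x e = refl
  Σ*-functional-0 {suc n} a ψ x e = +-≡0 (*0 _ (e zero)) (Σ*-functional-0 _ _ x (λ j → e (suc j)))

  Σ*-functional-δ : ∀ {n m} (a : Vect n) (ψ : Fin n → Functional m) x l →
    fn (ψ l) x ≡ 1# → (∀ j → j ≢ l → fn (ψ j) x ≡ 0#) → fn (Σ*-functional a ψ) x ≡ a l
  Σ*-functional-δ {suc n} a ψ x zero e₁ e₀ = trans
    (cong₂ _+_ (trans (cong (a zero *_) e₁) (*-identityʳ _)) (Σ*-functional-0 _ _ x (λ j → e₀ (suc j) λ ())))
    (+-identityʳ _)
  Σ*-functional-δ {suc n} a ψ x (suc l) e₁ e₀ = trans
    (cong₂ _+_ (*0 _ (e₀ zero λ ()))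
      (Σ*-functional-δ _ (λ j → ψ (suc j)) x l e₁ (λ j ne → e₀ (suc j) λ { refl → ne refl })))
    (+-identityˡ _)

  Independent : ∀ {n m} → (Fin n → Vect m) → Set
  Independent {n} c = ∀ (v : Vect n) → (∀ i → Σ* v (λ j → c j i) ≡ 0#) → ∀ j → v j ≡ 0#

  -- The elimination step: a combination of the reduced vectors is one of the original vectors, in
  -- which the eliminated vector has coefficient `- Σ* v a`.
  Σ*-reduce : ∀ {n} (v d a : Vect n) k →
    Σ* v (λ j → d j + - a j * k) ≡ - Σ* v a * k + Σ* v d
  Σ*-reduce {zero}  v d a k = solve 1 (λ k → 𝟘 := :- 𝟘 :* k :+ 𝟘) refl k
  Σ*-reduce {suc n} v d a k = trans
    (cong (v zero * (d zero + - a zero * k) +_) (Σ*-reduce (λ j → v (suc j)) (λ j → d (suc j)) (λ j → a (suc j)) k))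
    (solve 6 (λ v d a k s t → v :* (d :+ :- a :* k) :+ (:- s :* k :+ t) := :- (v :* a :+ s) :* k :+ (v :* d :+ t))
      refl (v zero) (d zero) (a zero) k (Σ* (λ j → v (suc j)) (λ j → a (suc j))) (Σ* (λ j → v (suc j)) (λ j → d (suc j))))

  Σ*-zeroˡ : ∀ {n} (b : Vect n) → Σ* (λ _ → 0#) b ≡ 0#
  Σ*-zeroˡ {zero}  b = refl
  Σ*-zeroˡ {suc n} b = +-≡0 (zeroˡ _) (Σ*-zeroˡ (λ j → b (suc j)))

  record DualBasis {n m} (c : Fin n → Vect m) : Set where
    field
      dual   : Fin n → Functional m
      dual-1 : ∀ j → fn (dual j) (c j) ≡ 1#
      dual-0 : ∀ j k → j ≢ k → fn (dual j) (c k) ≡ 0#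

  -- Gaussian elimination on functionals. φ takes the value 1 at the first vector; subtracting
  -- multiples of that vector moves the others into the kernel of φ, and induction gives functionals
  -- dual to the results. These are corrected by multiples of φ so as to vanish at the first vector,
  -- and then φ is corrected by them so as to vanish at the others.
  independent⇒dual : ∀ {n m} (c : Fin n → Vect m) → Independent c → DualBasis c
  independent⇒dual {zero}  c ind = record { dual = λ () ; dual-1 = λ () ; dual-0 = λ () }
  independent⇒dual {suc n} {m} c ind = record { dual = J ; dual-1 = J-1 ; dual-0 = J-0 }
    where
    k : Vect m
    k = c zero
    pivot : Σ (Fin m) λ i → k i ≢ 0#
    pivot with Finₚ.any? (λ i → ¬? (k i ≟ 0#))
    ... | yes p = p
    -- If the first vector were zero, the coefficients (1, 0, ..., 0) would contradict independence.
    ... | no ¬p = contradiction (ind e₀ (λ i → +-≡0 (*0 1# (k≡0 i)) (Σ*-zeroˡ (λ j → c (suc j) i))) zero) 1≢0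
      where
      e₀ : Vect (suc n)
      e₀ zero    = 1#
      e₀ (suc _) = 0#
      k≡0 : ∀ i → k i ≡ 0#
      k≡0 i = decidable-stable (k i ≟ 0#) (λ nz → ¬p (i , nz))
    φ : Functional m
    φ = scaled (k (proj₁ pivot) ⁻¹[ proj₂ pivot ]) (coordinate (proj₁ pivot))
    φk≡1 : fn φ k ≡ 1#
    φk≡1 = trans (*-comm _ _) (*-inverseʳ (proj₂ pivot))
    a : Vect n
    a j = fn φ (c (suc j))
    c′ : Fin n → Vect m
    c′ j i = c (suc j) i + - a j * k i
    ind′ : Independent c′
    ind′ v e j = ind v⁺ (λ i → trans (sym (Σ*-reduce v (λ j → c (suc j) i) a (k i))) (e i)) (suc j)
      where
      v⁺ : Vect (suc n)
      v⁺ zero    = - Σ* v a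
      v⁺ (suc j) = v j
    open DualBasis (independent⇒dual c′ ind′) renaming (dual to ψ; dual-1 to ψ-1; dual-0 to ψ-0)
    χ : Fin n → Functional m
    χ j = ψ j ⊕ scaled (- fn (ψ j) k) φ
    χk≡0 : ∀ j → fn (χ j) k ≡ 0#
    χk≡0 j = trans (cong (λ z → fn (ψ j) k + - fn (ψ j) k * z) φk≡1)
      (solve 1 (λ x → x :+ :- x :* 𝟙 := 𝟘) refl (fn (ψ j) k))
    χc : ∀ j l → fn (χ j) (c (suc l)) ≡ fn (ψ j) (c′ l)
    χc j l = begin
      fn (ψ j) (c (suc l)) + - fn (ψ j) k * a l       ≡⟨ cong (fn (ψ j) (c (suc l)) +_)
                                                         (solve 2 (λ x y → :- x :* y := :- y :* x) refl (fn (ψ j) k) (a l)) ⟩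
      fn (ψ j) (c (suc l)) + - a l * fn (ψ j) k       ≡⟨ cong (fn (ψ j) (c (suc l)) +_) (sym (fn-* (ψ j) (- a l) k)) ⟩
      fn (ψ j) (c (suc l)) + fn (ψ j) (λ i → - a l * k i) ≡⟨ sym (fn-+ (ψ j) _ _) ⟩
      fn (ψ j) (c′ l)                                 ∎
    J : Fin (suc n) → Functional m
    J zero    = φ ⊕ scaled (- 1#) (Σ*-functional a χ)
    J (suc j) = χ j
    J-1 : ∀ j → fn (J j) (c j) ≡ 1#
    J-1 zero    = trans (cong₂ (λ u v → u + - 1# * v) φk≡1 (Σ*-functional-0 a χ k χk≡0))
      (solve 0 (𝟙 :+ :- 𝟙 :* 𝟘 := 𝟙) refl)
    J-1 (suc j) = trans (χc j j) (ψ-1 j)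
    J-0 : ∀ j l → j ≢ l → fn (J j) (c l) ≡ 0#
    J-0 zero    zero    ne = contradiction refl ne
    J-0 zero    (suc l) ne = trans
      (cong (λ v → a l + - 1# * v) (Σ*-functional-δ a χ (c (suc l)) l (trans (χc l l) (ψ-1 l))
        (λ j ne′ → trans (χc j l) (ψ-0 j l ne′))))
      (solve 1 (λ x → x :+ :- 𝟙 :* x := 𝟘) refl (a l))
    J-0 (suc j) zero    ne = χk≡0 j
    J-0 (suc j) (suc l) ne = trans (χc j l) (ψ-0 j l (λ e → ne (cong suc e)))

  fn-Σ* : ∀ {n m} (φ : Functional m) (v : Vect n) (c : Fin n → Vect m) →
    fn φ (λ i → Σ* v (λ j → c j i)) ≡ Σ* v (λ j → fn φ (c j))
  fn-Σ* {zero}  φ v c = trans (fn-≗ φ (λ i → sym (zeroˡ 0#))) (trans (fn-* φ 0# (λ _ → 0#)) (zeroˡ _))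
  fn-Σ* {suc n} φ v c = trans (fn-+ φ _ _) (cong₂ _+_ (fn-* φ (v zero) (c zero)) (fn-Σ* φ (λ j → v (suc j)) (λ j → c (suc j))))

  Σ*-δ : ∀ {n} (v a : Vect n) l → a l ≡ 1# → (∀ j → l ≢ j → a j ≡ 0#) → Σ* v a ≡ v l
  Σ*-δ v a zero    e₁ e₀ = trans (cong₂ _+_ (trans (cong (v zero *_) e₁) (*-identityʳ _))
    (tail-0 (λ j → v (suc j)) (λ j → a (suc j)) (λ j → e₀ (suc j) λ ()))) (+-identityʳ _)
    where
    tail-0 : ∀ {n} (v a : Vect n) → (∀ j → a j ≡ 0#) → Σ* v a ≡ 0#
    tail-0 {zero}  v a e = refl
    tail-0 {suc n} v a e = +-≡0 (*0 _ (e zero)) (tail-0 _ _ (λ j → e (suc j)))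
  Σ*-δ v a (suc l) e₁ e₀ = trans (cong₂ _+_ (*0 _ (e₀ zero λ ()))
    (Σ*-δ (λ j → v (suc j)) (λ j → a (suc j)) l e₁ (λ j ne → e₀ (suc j) λ { refl → ne refl }))) (+-identityˡ _)

-- The quadratic extension, its conjugation and the q-th power

-- F(τ) as a field; inverses come from the norm (a + bτ)(a + bτ̄), with τ̄ = t₁ - τ.
module QuadraticExtension (F : Field) (q : ℕ) (t₀ t₁ : Field.Carrier F)
  (irr : Geometry.Irreducible F q t₀ t₁) where
  open FieldTheory F
  open Geometry F q t₀ t₁
  open ≡-Reasoning

  private
    pair : ∀ {a b c d : Carrier} → a ≡ c → b ≡ d → (a , b) ≡ (c , d)
    pair = cong₂ _,_

  *E-comm : ∀ x y → x *E y ≡ y *E x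
  *E-comm (a , b) (c , d) = pair
    (solve 5 (λ a b c d t → a :* c :+ b :* d :* t := c :* a :+ d :* b :* t) refl a b c d t₀)
    (solve 5 (λ a b c d t → a :* d :+ b :* c :+ b :* d :* t := c :* b :+ d :* a :+ d :* b :* t) refl a b c d t₁)

  *E-identityˡ : ∀ x → 1E *E x ≡ x
  *E-identityˡ (a , b) = pair
    (solve 3 (λ a b t → 𝟙 :* a :+ 𝟘 :* b :* t := a) refl a b t₀)
    (solve 3 (λ a b t → 𝟙 :* b :+ 𝟘 :* a :+ 𝟘 :* b :* t := b) refl a b t₁)

  *E-distribˡ : ∀ x y z → x *E (y +E z) ≡ x *E y +E x *E z
  *E-distribˡ (a , b) (c , d) (e , f) = pair
    (solve 7 (λ a b c d e f t → a :* (c :+ e) :+ b :* (d :+ f) :* t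
       := a :* c :+ b :* d :* t :+ (a :* e :+ b :* f :* t)) refl a b c d e f t₀)
    (solve 7 (λ a b c d e f t → a :* (d :+ f) :+ b :* (c :+ e) :+ b :* (d :+ f) :* t
       := a :* d :+ b :* c :+ b :* d :* t :+ (a :* f :+ b :* e :+ b :* f :* t)) refl a b c d e f t₁)

  *E-assoc : ∀ x y z → (x *E y) *E z ≡ x *E (y *E z)
  *E-assoc (a , b) (c , d) (e , f) = pair
    (solve 8 (λ a b c d e f s t → (a :* c :+ b :* d :* s) :* e :+ (a :* d :+ b :* c :+ b :* d :* t) :* f :* s
       := a :* (c :* e :+ d :* f :* s) :+ b :* (c :* f :+ d :* e :+ d :* f :* t) :* s) refl a b c d e f t₀ t₁)
    (solve 8 (λ a b c d e f s t →
          (a :* c :+ b :* d :* s) :* f :+ (a :* d :+ b :* c :+ b :* d :* t) :* e :+ (a :* d :+ b :* c :+ b :* d :* t) :* f :* t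
       := a :* (c :* f :+ d :* e :+ d :* f :* t) :+ b :* (c :* e :+ d :* f :* s) :+ b :* (c :* f :+ d :* e :+ d :* f :* t) :* t)
       refl a b c d e f t₀ t₁)

  σ : E → E
  σ (a , b) = a + b * t₁ , - b

  norm : E → Carrier
  norm (a , b) = a * a + a * b * t₁ + - (b * b * t₀)

  -- For b ≠ 0 and r = -a/b, the value r² - t₁r - t₀ is the norm divided by b², so a vanishing norm
  -- contradicts irreducibility.
  norm-≢0 : ∀ {x} → x ≢ 0E → norm x ≢ 0#
  norm-≢0 {a , b} nz e with b ≟ 0#
  ... | yes refl = nz (pair (x²≡0⇒x≡0 (trans
          (solve 3 (λ a s t → a :* a := a :* a :+ a :* 𝟘 :* t :+ :- (𝟘 :* 𝟘 :* s)) refl a t₀ t₁) e)) refl)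
  ... | no b≢0 = irr r (x-y≡0⇒x≡y (begin
    -- As a ring identity this holds for any i in place of the inverse of b; the deviation is
    -- collected in a multiple of 1 - bi.
    r * r + - (t₁ * r + t₀)
      ≡⟨ solve 5 (λ a b i s t → let r = :- (a :* i) in
            r :* r :+ :- (t :* r :+ s)
            := i :* i :* (a :* a :+ a :* b :* t :+ :- (b :* b :* s))
               :+ (𝟙 :+ :- (b :* i)) :* (a :* i :* t :+ :- (s :* (𝟙 :+ b :* i)))) refl a b i t₀ t₁ ⟩
    i * i * norm (a , b) + (1# + - (b * i)) * z
      ≡⟨ +-≡0 (*0 _ e) (0* z (x≡y⇒x-y≡0 (sym (*-inverseʳ b≢0)))) ⟩
    0# ∎))
    where
    i = b ⁻¹[ b≢0 ]
    r = - (a * i)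
    z = a * i * t₁ + - (t₀ * (1# + b * i))

  x*σx : ∀ x → x *E σ x ≡ ι (norm x)
  x*σx (a , b) = pair
    (solve 4 (λ a b s t → a :* (a :+ b :* t) :+ b :* (:- b) :* s := a :* a :+ a :* b :* t :+ :- (b :* b :* s)) refl a b t₀ t₁)
    (solve 3 (λ a b t → a :* (:- b) :+ b :* (a :+ b :* t) :+ b :* (:- b) :* t := 𝟘) refl a b t₁)

  ι-+ : ∀ a b → ι (a + b) ≡ ι a +E ι b
  ι-+ a b = pair refl (sym (+-identityˡ 0#))

  ι-* : ∀ a b → ι (a * b) ≡ ι a *E ι b
  ι-* a b = pair
    (solve 3 (λ a b t → a :* b := a :* b :+ 𝟘 :* 𝟘 :* t) refl a b t₀)
    (solve 3 (λ a b t → 𝟘 := a :* 𝟘 :+ 𝟘 :* b :+ 𝟘 :* 𝟘 :* t) refl a b t₁)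

  ι*E : ∀ a x → ι a *E x ≡ (a * proj₁ x , a * proj₂ x)
  ι*E a (b , c) = pair
    (solve 4 (λ a b c s → a :* b :+ 𝟘 :* c :* s := a :* b) refl a b c t₀)
    (solve 4 (λ a b c t → a :* c :+ 𝟘 :* b :+ 𝟘 :* c :* t := a :* c) refl a b c t₁)

  ι-injective : ∀ {a b} → ι a ≡ ι b → a ≡ b
  ι-injective = cong proj₁

  ι-≢0 : ∀ {a} → a ≢ 0# → ι a ≢ 0E
  ι-≢0 nz e = nz (ι-injective e)

  E-inverse : ∀ x → x ≢ 0E → Σ E λ y → x *E y ≡ 1E
  E-inverse x nz = σ x *E ι n⁻¹ , (begin
    x *E (σ x *E ι n⁻¹)     ≡⟨ sym (*E-assoc x (σ x) (ι n⁻¹)) ⟩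
    x *E σ x *E ι n⁻¹       ≡⟨ cong (_*E ι n⁻¹) (x*σx x) ⟩
    ι (norm x) *E ι n⁻¹     ≡⟨ sym (ι-* _ _) ⟩
    ι (norm x * n⁻¹)        ≡⟨ cong ι (*-inverseʳ (norm-≢0 nz)) ⟩
    1E                      ∎)
    where n⁻¹ = norm x ⁻¹[ norm-≢0 nz ]

  𝔼 : Field
  𝔼 = record
    { Carrier = E ; _+_ = _+E_ ; _*_ = _*E_ ; -_ = -E_ ; 0# = 0E ; 1# = 1E
    ; isCommutativeRing = record
      { isRing = record
        { +-isAbelianGroup = record
          { isGroup = record
            { isMonoid = record
              { isSemigroup = record
                { isMagma = record { isEquivalence = isEquivalence ; ∙-cong = cong₂ _+E_ }
                ; assoc = λ { (a , b) (c , d) (e , f) → pair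
                    (solve 3 (λ a c e → a :+ c :+ e := a :+ (c :+ e)) refl a c e)
                    (solve 3 (λ a c e → a :+ c :+ e := a :+ (c :+ e)) refl b d f) } }
              ; identity = (λ { (a , b) → pair (+-identityˡ a) (+-identityˡ b) })
                         , (λ { (a , b) → pair (+-identityʳ a) (+-identityʳ b) }) }
            ; inverse = (λ { (a , b) → pair (trans (+-comm _ _) (-‿inverseʳ a)) (trans (+-comm _ _) (-‿inverseʳ b)) })
                      , (λ { (a , b) → pair (-‿inverseʳ a) (-‿inverseʳ b) })
            ; ⁻¹-cong = cong -E_ }
          ; comm = λ { (a , b) (c , d) → pair (+-comm a c) (+-comm b d) } }
        ; *-cong = cong₂ _*E_
        ; *-assoc = *E-assoc
        ; *-identity = *E-identityˡ , λ x → trans (*E-comm x 1E) (*E-identityˡ x)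
        ; distrib = *E-distribˡ , λ x y z → trans (*E-comm (y +E z) x)
            (trans (*E-distribˡ x y z) (cong₂ _+E_ (*E-comm x y) (*E-comm x z))) }
      ; *-comm = *E-comm }
    ; 0≢1 = λ e → 0≢1 (cong proj₁ e)
    ; inverse = E-inverse
    ; _≟_ = ≡-dec _≟_ _≟_
    }

  σ-+ : ∀ x y → σ (x +E y) ≡ σ x +E σ y
  σ-+ (a , b) (c , d) = pair
    (solve 5 (λ a b c d t → a :+ c :+ (b :+ d) :* t := a :+ b :* t :+ (c :+ d :* t)) refl a b c d t₁)
    (solve 2 (λ b d → :- (b :+ d) := :- b :+ :- d) refl b d)

  σ-* : ∀ x y → σ (x *E y) ≡ σ x *E σ y
  σ-* (a , b) (c , d) = pair
    (solve 6 (λ a b c d s t → a :* c :+ b :* d :* s :+ (a :* d :+ b :* c :+ b :* d :* t) :* t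
       := (a :+ b :* t) :* (c :+ d :* t) :+ (:- b) :* (:- d) :* s) refl a b c d t₀ t₁)
    (solve 5 (λ a b c d t → :- (a :* d :+ b :* c :+ b :* d :* t)
       := (a :+ b :* t) :* (:- d) :+ (:- b) :* (c :+ d :* t) :+ (:- b) :* (:- d) :* t) refl a b c d t₁)

  σ-ι : ∀ a → σ (ι a) ≡ ι a
  σ-ι a = pair (solve 2 (λ a t → a :+ 𝟘 :* t := a) refl a t₁) -0#≈0#

  σ-σ : ∀ x → σ (σ x) ≡ x
  σ-σ (a , b) = pair
    (solve 3 (λ a b t → a :+ b :* t :+ (:- b) :* t := a) refl a b t₁)
    (solve 1 (λ b → :- (:- b) := b) refl b)

  σ-0 : σ 0E ≡ 0E
  σ-0 = σ-ι 0#

  σ-≢0 : ∀ {x} → x ≢ 0E → σ x ≢ 0E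
  σ-≢0 {x} nz e = nz (trans (sym (σ-σ x)) (trans (cong σ e) σ-0))

  τ-root : τ *E τ ≡ ι t₁ *E τ +E ι t₀
  τ-root = pair
    (solve 2 (λ s t → 𝟘 :* 𝟘 :+ 𝟙 :* 𝟙 :* s := t :* 𝟘 :+ 𝟘 :* 𝟙 :* s :+ s) refl t₀ t₁)
    (solve 2 (λ s t → 𝟘 :* 𝟙 :+ 𝟙 :* 𝟘 :+ 𝟙 :* 𝟙 :* t := t :* 𝟙 :+ 𝟘 :* 𝟘 :+ 𝟘 :* 𝟙 :* t :+ 𝟘) refl t₀ t₁)

  module _ (pp : IsPrimePower q) (1<q : 1 < q) (enum : Carrier ↔ Fin q) (prim : Primitive) where
    private
      module 𝔽 = FieldTheory 𝔼
      module Pow = PowerTheory 𝔼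
      module PowF = PowerTheory F
    open FiniteField F q enum using (characteristic; fermat)

    ^E≡^ : ∀ x n → x ^E n ≡ x Pow.^ n
    ^E≡^ x zero    = refl
    ^E≡^ x (suc n) = cong (x *E_) (^E≡^ x n)

    frob-+ : ∀ x y → (x +E y) ^E q ≡ x ^E q +E y ^E q
    frob-+ x y = go pp
      where
      ·-ι : ∀ n → n Pow.· 1E ≡ ι (n PowF.· 1#)
      ·-ι zero    = refl
      ·-ι (suc n) = trans (cong (1E +E_) (·-ι n)) (sym (ι-+ 1# _))
      go : IsPrimePower q → (x +E y) ^E q ≡ x ^E q +E y ^E q
      go (p , k , p-prime , _ , q≡p^k) = begin
        (x +E y) ^E q                ≡⟨ ^E≡^ _ q ⟩
        (x +E y) Pow.^ q             ≡⟨ subst (λ n → (x +E y) Pow.^ n ≡ x Pow.^ n +E y Pow.^ n) (sym q≡p^k)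
                                          (Pow.frobenius-^ p-prime (trans (·-ι p) (cong ι (characteristic {p} {k} q≡p^k))) k x y) ⟩
        x Pow.^ q +E y Pow.^ q       ≡⟨ sym (cong₂ _+E_ (^E≡^ x q) (^E≡^ y q)) ⟩
        x ^E q +E y ^E q             ∎

    frob-* : ∀ x y → (x *E y) ^E q ≡ x ^E q *E y ^E q
    frob-* x y = trans (^E≡^ _ q) (trans (Pow.^-distrib-* x y q) (sym (cong₂ _*E_ (^E≡^ x q) (^E≡^ y q))))

    frob-ι : ∀ a → ι a ^E q ≡ ι a
    frob-ι a = trans (pow q) (cong ι (fermat a))
      where
      pow : ∀ n → ι a ^E n ≡ ι (a PowF.^ n)
      pow zero    = refl
      pow (suc n) = trans (cong (ι a *E_) (pow n)) (sym (ι-* a _))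

    frob-0 : 0E ^E q ≡ 0E
    frob-0 = frob-ι 0#

    τq-root : τq *E τq ≡ ι t₁ *E τq +E ι t₀
    τq-root = begin
      τq *E τq                               ≡⟨ sym (frob-* τ τ) ⟩
      (τ *E τ) ^E q                          ≡⟨ cong (_^E q) τ-root ⟩
      (ι t₁ *E τ +E ι t₀) ^E q               ≡⟨ frob-+ _ _ ⟩
      (ι t₁ *E τ) ^E q +E ι t₀ ^E q          ≡⟨ cong₂ _+E_ (trans (frob-* _ _) (cong (_*E τq) (frob-ι t₁))) (frob-ι t₀) ⟩
      ι t₁ *E τq +E ι t₀                     ∎

    -- Otherwise τ^(q-1) = 1, although 0 < q - 1 < q² - 1. Inside, q is generalised to n so that it
    -- can be split into cases.
    τq≢τ : τq ≢ τ
    τq≢τ e = go q 1<q e prim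
      where
      τ≢0 : τ ≢ 0E
      τ≢0 e = 1≢0 (cong proj₂ e)
      go : ∀ n → 1 < n → τ ^E n ≡ τ → ¬ (∀ k → 1 ≤ k → k < n ℕ.* n ℕ.∸ 1 → τ ^E k ≢ 1E)
      go (suc zero)          (s≤s ()) _ _
      go (suc n@(suc m)) _ e prim = prim n (s≤s z≤n) (ℕₚ.≤-trans (ℕₚ.m≤m+n (suc n) (m ℕ.* suc n)) (ℕₚ.m≤n+m _ n))
        (𝔽.*-cancelˡ τ≢0 (trans e (sym (𝔽.*-identityʳ τ))))

    τ̄-sum : τ +E σ τ ≡ ι t₁
    τ̄-sum = pair (solve 1 (λ t → 𝟘 :+ (𝟘 :+ 𝟙 :* t) := t) refl t₁) (-‿inverseʳ 1#)

    τ̄-prod : τ *E σ τ ≡ -E ι t₀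
    τ̄-prod = trans (x*σx τ) (pair (solve 2 (λ s t → 𝟘 :* 𝟘 :+ 𝟘 :* 𝟙 :* t :+ :- (𝟙 :* 𝟙 :* s) := :- s) refl t₀ t₁) (sym -0#≈0#))

    -- x² - t₁x - t₀ has only the roots τ and τ̄, and τ^q = τ would contradict primitivity.
    τq≡στ : τq ≡ σ τ
    τq≡στ = 𝔽.x-y≡0⇒x≡y (𝔽.*-cancelˡ-0 (λ e → τq≢τ (𝔽.x-y≡0⇒x≡y e)) (begin
      (τq +E -E τ) *E (τq +E -E σ τ)
        ≡⟨ 𝔽.solve 3 (λ x a b → (x 𝔽.:+ 𝔽.:- a) 𝔽.:* (x 𝔽.:+ 𝔽.:- b)
              𝔽.:= x 𝔽.:* x 𝔽.:+ 𝔽.:- ((a 𝔽.:+ b) 𝔽.:* x 𝔽.:+ 𝔽.:- (a 𝔽.:* b))) refl τq τ (σ τ) ⟩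
      τq *E τq +E -E ((τ +E σ τ) *E τq +E -E (τ *E σ τ))
        ≡⟨ cong₂ (λ s p → τq *E τq +E -E (s *E τq +E -E p)) τ̄-sum τ̄-prod ⟩
      τq *E τq +E -E (ι t₁ *E τq +E -E (-E ι t₀))
        ≡⟨ 𝔽.x≡y⇒x-y≡0 (trans τq-root (cong (ι t₁ *E τq +E_)
              (𝔽.solve 1 (λ x → x 𝔽.:= 𝔽.:- (𝔽.:- x)) refl (ι t₀)))) ⟩
      0E ∎))

    -- Take the q-th power of τ^q = t₁ - τ. The minus sign is written as multiplication by the
    -- element -1 of F, which the q-th power fixes whatever the parity of q.
    τqq≡τ : τq ^E q ≡ τ
    τqq≡τ = begin
      τq ^E q                        ≡⟨ cong (_^E q) (trans τq≡στ (𝔽.solve 2 (λ a b → b 𝔽.:= a 𝔽.:+ b 𝔽.:+ 𝔽.:- a) refl τ (σ τ))) ⟩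
      (τ +E σ τ +E -E τ) ^E q        ≡⟨ cong (_^E q) (cong₂ _+E_ τ̄-sum (-E≡ τ)) ⟩
      (ι t₁ +E ι (- 1#) *E τ) ^E q   ≡⟨ frob-+ _ _ ⟩
      ι t₁ ^E q +E (ι (- 1#) *E τ) ^E q ≡⟨ cong₂ _+E_ (frob-ι t₁) (trans (frob-* _ _) (cong₂ _*E_ (frob-ι (- 1#)) τq≡στ)) ⟩
      ι t₁ +E ι (- 1#) *E σ τ        ≡⟨ cong₂ _+E_ (sym τ̄-sum) (sym (-E≡ (σ τ))) ⟩
      τ +E σ τ +E -E σ τ             ≡⟨ 𝔽.solve 2 (λ a b → a 𝔽.:+ b 𝔽.:+ 𝔽.:- b 𝔽.:= a) refl τ (σ τ) ⟩
      τ                              ∎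
      where
      -E≡ : ∀ x → -E x ≡ ι (- 1#) *E x
      -E≡ (a , b) = pair
        (solve 3 (λ a b t → :- a := :- 𝟙 :* a :+ 𝟘 :* b :* t) refl a b t₀)
        (solve 3 (λ a b t → :- b := :- 𝟙 :* b :+ 𝟘 :* a :+ 𝟘 :* b :* t) refl a b t₁)

    frob-1 : (-E 1E) ^E q ≡ -E 1E
    frob-1 = trans (cong (_^E q) e) (trans (frob-ι (- 1#)) (sym e))
      where
      e : -E 1E ≡ ι (- 1#)
      e = pair refl -0#≈0#

-- Parametrisation of a non-degenerate conic from one of its points

all₃ : ∀ {P : Fin 3 → Set} → P 0F → P 1F → P 2F → ∀ i → P i
all₃ a b c 0F = a
all₃ a b c 1F = b
all₃ a b c 2F = c

module Conics (F : Field) (q : ℕ) (t₀ t₁ : Field.Carrier F) where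
  open FieldTheory F
  open Geometry F q t₀ t₁
  open ≡-Reasoning

  -- Column j holds the coefficients of tʲ, so column 2 is the point with parameter ∞.
  record ConicParam (Q : QuadForm) (v₀ : V Carrier 3) : Set where
    field
      C : Fin 3 → Fin 3 → Carrier
      independent : ∀ (v : V Carrier 3) → (∀ i → C i 0F * v 0F + (C i 1F * v 1F + C i 2F * v 2F) ≡ 0#) → ∀ j → v j ≡ 0#
      on-conic : ∀ t → evalQ Q (λ i → C i 0F + (C i 1F * t + C i 2F * (t * t))) ≡ 0#
      at-∞ : Σ Carrier λ k → k ≢ 0# × (∀ i → C i 2F ≡ k * v₀ i)
      cover : ∀ v → ¬ (∀ i → v i ≡ 0#) → evalQ Q v ≡ 0# →
        (Σ Carrier λ t → Σ Carrier λ λ' → λ' ≢ 0# × (∀ i → v i ≡ λ' * (C i 0F + (C i 1F * t + C i 2F * (t * t)))))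
        ⊎ (Σ Carrier λ λ' → λ' ≢ 0# × (∀ i → v i ≡ λ' * C i 2F))

  -- Cyclic relabelling of the coordinates: at most two rotations bring a nonzero coordinate of the
  -- base point to the front, where the explicit computation takes place.
  rotate : QuadForm → QuadForm
  rotate (quad a b c f g h) = quad b c a g h f

  next prev : Fin 3 → Fin 3
  next 0F = 1F
  next 1F = 2F
  next 2F = 0F
  prev 0F = 2F
  prev 1F = 0F
  prev 2F = 1F

  rotate-eval : ∀ Q v → evalQ (rotate Q) (λ i → v (next i)) ≡ evalQ Q v
  rotate-eval (quad a b c f g h) v = solve 9
    (λ a b c f g h x y z →
      b :* y :* y :+ c :* z :* z :+ a :* x :* x :+ g :* z :* x :+ h :* y :* x :+ f :* y :* z
      := a :* x :* x :+ b :* y :* y :+ c :* z :* z :+ f :* y :* z :+ g :* x :* z :+ h :* x :* y)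
    refl a b c f g h (v 0F) (v 1F) (v 2F)

  rotate-nondegenerate : ∀ {Q} → NonDegenerate Q → NonDegenerate (rotate Q)
  rotate-nondegenerate {quad a b c f g h} nd e = nd (trans (solve 6
    (λ a b c f g h →
      (𝟙 :+ 𝟙 :+ 𝟙 :+ 𝟙) :* a :* b :* c :+ f :* g :* h :+ :- (a :* f :* f) :+ :- (b :* g :* g) :+ :- (c :* h :* h)
      := (𝟙 :+ 𝟙 :+ 𝟙 :+ 𝟙) :* b :* c :* a :+ g :* h :* f :+ :- (b :* g :* g) :+ :- (c :* h :* h) :+ :- (a :* f :* f))
    refl a b c f g h) e)

  unrotate-param : ∀ {Q v₀} → ConicParam (rotate Q) (λ i → v₀ (next i)) → ConicParam Q v₀
  unrotate-param {Q} {v₀} R = record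
    { C = λ i → C (prev i)
    ; independent = λ v e → independent v (all₃ {λ i → C i 0F * v 0F + (C i 1F * v 1F + C i 2F * v 2F) ≡ 0#} (e 1F) (e 2F) (e 0F))
    ; on-conic = λ t → trans (sym (rotate-eval Q (λ i → C (prev i) 0F + (C (prev i) 1F * t + C (prev i) 2F * (t * t))))) (on-conic t)
    ; at-∞ = proj₁ at-∞ , proj₁ (proj₂ at-∞) , unrot {λ i j → C j 2F ≡ proj₁ at-∞ * v₀ i} (proj₂ (proj₂ at-∞))
    ; cover = λ v nz e → unrot-cover v (cover (λ i → v (next i)) (λ z → nz (unrot {λ i _ → v i ≡ 0#} z)) (trans (rotate-eval Q v) e))
    }
    where
    open ConicParam R
    unrot : ∀ {P : Fin 3 → Fin 3 → Set} → (∀ i → P (next i) i) → ∀ i → P i (prev i)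
    unrot e = all₃ (e 2F) (e 0F) (e 1F)
    unrot-cover : ∀ v → _ ⊎ _ → _ ⊎ _
    unrot-cover v (inj₁ (t , l , nz , e)) = inj₁ (t , l , nz , unrot {λ i j → v i ≡ l * (C j 0F + (C j 1F * t + C j 2F * (t * t)))} e)
    unrot-cover v (inj₂ (l , nz , e))     = inj₂ (l , nz , unrot {λ i j → v i ≡ l * C j 2F} e)

  -- With B the polar form, v₀ = (x,y,z) and B(v₀,-) = (p,r,s), the vector (0,s,-r) spans
  -- with v₀ the tangent line at v₀, and Q(0,s,-r) = γ = -Dx², D being the discriminant.
  -- As B(v₀,(0,α,β)) = 1, Q(A(0,α,β) + B(0,s,-r) + Kv₀) is linear in K with coefficient A,
  -- so K is determined by t = B/A.
  module _ (a b c f g h : Carrier) (v₀ : V Carrier 3) (nd : NonDegenerate (quad a b c f g h))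
    (Qv₀≡0 : evalQ (quad a b c f g h) v₀ ≡ 0#) (x≢0 : v₀ 0F ≢ 0#) where
    private
      x = v₀ 0F
      y = v₀ 1F
      z = v₀ 2F
      r = h * x + b * y + b * y + f * z
      s = g * x + f * y + c * z + c * z
      γ = b * s * s + c * r * r + - (f * r * s)

      γ≢0 : γ ≢ 0#
      -- Dx² + γ equals (4bc - f²) Q(v₀) identically; this is where non-degeneracy enters.
      γ≢0 e = *-≢0 (*-≢0 nd x≢0) x≢0 (begin
        D * x * x
          ≡⟨ solve 9 (λ a b c f g h x y z →
                let r = h :* x :+ b :* y :+ b :* y :+ f :* z
                    s = g :* x :+ f :* y :+ c :* z :+ c :* z
                in
                ((𝟙 :+ 𝟙 :+ 𝟙 :+ 𝟙) :* a :* b :* c :+ f :* g :* h :+ :- (a :* f :* f) :+ :- (b :* g :* g) :+ :- (c :* h :* h)) :* x :* x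
                := ((𝟙 :+ 𝟙 :+ 𝟙 :+ 𝟙) :* b :* c :+ :- (f :* f))
                   :* (a :* x :* x :+ b :* y :* y :+ c :* z :* z :+ f :* y :* z :+ g :* x :* z :+ h :* x :* y)
                   :+ :- 𝟙 :* (b :* s :* s :+ c :* r :* r :+ :- (f :* r :* s)))
                refl a b c f g h x y z ⟩
        ((1# + 1# + 1# + 1#) * b * c + - (f * f)) * evalQ (quad a b c f g h) v₀ + - 1# * γ
          ≡⟨ +-≡0 (*0 _ Qv₀≡0) (*0 _ e) ⟩
        0# ∎)
        where
        D = (1# + 1# + 1# + 1#) * a * b * c + f * g * h + - (a * f * f) + - (b * g * g) + - (c * h * h)

      unimodular : Σ Carrier λ α → Σ Carrier λ β → r * α + s * β ≡ 1#
      unimodular with r ≟ 0# | s ≟ 0#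
      ... | no r≢0 | _ = r ⁻¹[ r≢0 ] , 0# , trans (cong₂ _+_ (*-inverseʳ r≢0) (zeroʳ s)) (+-identityʳ 1#)
      ... | yes _ | no s≢0 = 0# , s ⁻¹[ s≢0 ] , trans (cong₂ _+_ (zeroʳ r) (*-inverseʳ s≢0)) (+-identityˡ 1#)
      -- γ is a quadratic form in r and s, so these cannot both vanish.
      ... | yes r≡0 | yes s≡0 = contradiction (+-≡0 (+-≡0 (*0 _ s≡0) (*0 _ r≡0)) (trans (cong -_ (*0 _ s≡0)) -0#≈0#)) γ≢0

    module WithChord (α β : Carrier) (rα+sβ≡1 : r * α + s * β ≡ 1#) where
      -- The value of the form at (0,α,β); then φ is the polar form at (0,α,β) and (0,s,-r).
      -- Together with γ they describe the form on the span of these two vectors.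
      ε = b * α * α + c * β * β + f * α * β
      φ = b * α * s + b * α * s + - (c * β * r) + - (c * β * r) + f * (β * s + - (α * r))

      point : Carrier → Carrier → Carrier → V Carrier 3
      point A B K 0F = K * x
      point A B K 1F = A * α + B * s + K * y
      point A B K 2F = A * β + - (B * r) + K * z

      eval-point : ∀ A B K → evalQ (quad a b c f g h) (point A B K) ≡ ε * A * A + φ * A * B + γ * B * B + A * K
      eval-point A B K = begin
        evalQ (quad a b c f g h) (point A B K)
          -- The point is read as (0,m,n) + Kv₀: the coefficient of K is the polar form at v₀ and
          -- (0,m,n), that of K² is Q(v₀).
          ≡⟨ solve 12 (λ a b c f g h x y z m n K →
               let X = K :* x ; Y = m :+ K :* y ; Z = n :+ K :* z in
               a :* X :* X :+ b :* Y :* Y :+ c :* Z :* Z :+ f :* Y :* Z :+ g :* X :* Z :+ h :* X :* Y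
               := b :* m :* m :+ c :* n :* n :+ f :* m :* n
                 :+ K :* ((h :* x :+ b :* y :+ b :* y :+ f :* z) :* m :+ (g :* x :+ f :* y :+ c :* z :+ c :* z) :* n)
                 :+ K :* K :* (a :* x :* x :+ b :* y :* y :+ c :* z :* z :+ f :* y :* z :+ g :* x :* z :+ h :* x :* y))
               refl a b c f g h x y z m n K ⟩
        b * m * m + c * n * n + f * m * n + K * (r * m + s * n) + K * K * evalQ (quad a b c f g h) v₀
          ≡⟨ +0 _ (*0 (K * K) Qv₀≡0) ⟩
        b * m * m + c * n * n + f * m * n + K * (r * m + s * n)
          ≡⟨ solve 10 (λ b c f r s α β A B K →
               let m = A :* α :+ B :* s ; n = A :* β :+ :- (B :* r) in
               b :* m :* m :+ c :* n :* n :+ f :* m :* n :+ K :* (r :* m :+ s :* n)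
               := (b :* α :* α :+ c :* β :* β :+ f :* α :* β) :* A :* A
                 :+ (b :* α :* s :+ b :* α :* s :+ :- (c :* β :* r) :+ :- (c :* β :* r) :+ f :* (β :* s :+ :- (α :* r))) :* A :* B
                 :+ (b :* s :* s :+ c :* r :* r :+ :- (f :* r :* s)) :* B :* B
                 :+ A :* K :* (r :* α :+ s :* β))
               refl b c f r s α β A B K ⟩
        ε * A * A + φ * A * B + γ * B * B + A * K * (r * α + s * β)
          ≡⟨ cong (ε * A * A + φ * A * B + γ * B * B +_) (trans (cong (A * K *_) rα+sβ≡1) (*-identityʳ _)) ⟩
        ε * A * A + φ * A * B + γ * B * B + A * K ∎
        where
        m = A * α + B * s
        n = A * β + - (B * r)

      -- The matrix with columns (α,β) and (s,-r) has determinant -(rα + sβ) = -1, so the entries of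
      -- its inverse need no denominators.
      recover : ∀ m n → (r * m + s * n) * α + (β * m + - (α * n)) * s ≡ m
                      × (r * m + s * n) * β + - ((β * m + - (α * n)) * r) ≡ n
      recover m n =
        trans (solve 6 (λ r s α β m n → (r :* m :+ s :* n) :* α :+ (β :* m :+ :- (α :* n)) :* s := (r :* α :+ s :* β) :* m)
                refl r s α β m n)
              (trans (cong (_* m) rα+sβ≡1) (*-identityˡ m)) ,
        trans (solve 6 (λ r s α β m n → (r :* m :+ s :* n) :* β :+ :- ((β :* m :+ :- (α :* n)) :* r) := (r :* α :+ s :* β) :* n)
                refl r s α β m n)
              (trans (cong (_* n) rα+sβ≡1) (*-identityˡ n))

      coords : ∀ (v : V Carrier 3) → Σ Carrier λ A → Σ Carrier λ B → Σ Carrier λ K → ∀ i → v i ≡ point A B K i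
      coords v = r * m + s * n , β * m + - (α * n) , K , all₃ {λ i → v i ≡ point (r * m + s * n) (β * m + - (α * n)) K i}
        (sym (trans (solve 3 (λ v i x → v :* i :* x := v :* (x :* i)) refl (v 0F) (x ⁻¹[ x≢0 ]) x)
                    (trans (cong (v 0F *_) (*-inverseʳ x≢0)) (*-identityʳ _))))
        (sym (trans (cong (_+ K * y) (proj₁ (recover m n))) (solve 2 (λ a b → a :+ :- b :+ b := a) refl (v 1F) (K * y))))
        (sym (trans (cong (_+ K * z) (proj₂ (recover m n))) (solve 2 (λ a b → a :+ :- b :+ b := a) refl (v 2F) (K * z))))
        where
        K = v 0F * x ⁻¹[ x≢0 ]
        m = v 1F + - (K * y)
        n = v 2F + - (K * z)

      -- For A = 1 and B = t the point lies on the conic exactly when K = -(ε + φt + γt²); the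
      -- columns sort this point by powers of t.
      C : Fin 3 → Fin 3 → Carrier
      C i 0F = point 1# 0# (- ε) i
      C i 1F = point 0# 1# (- φ) i
      C i 2F = - γ * v₀ i

      C-point : ∀ V₀ V₁ V₂ i → C i 0F * V₀ + (C i 1F * V₁ + C i 2F * V₂) ≡ point V₀ V₁ (- (ε * V₀ + φ * V₁ + γ * V₂)) i
      C-point V₀ V₁ V₂ = all₃ {λ i → C i 0F * V₀ + (C i 1F * V₁ + C i 2F * V₂) ≡ point V₀ V₁ (- (ε * V₀ + φ * V₁ + γ * V₂)) i}
        (solve 7 (λ x ε φ γ a b c → (:- ε :* x) :* a :+ ((:- φ :* x) :* b :+ (:- γ :* x) :* c)
            := :- (ε :* a :+ φ :* b :+ γ :* c) :* x) refl x ε φ γ V₀ V₁ V₂)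
        (solve 9 (λ y ε φ γ a b c α s → (𝟙 :* α :+ 𝟘 :* s :+ :- ε :* y) :* a :+ ((𝟘 :* α :+ 𝟙 :* s :+ :- φ :* y) :* b :+ (:- γ :* y) :* c)
            := a :* α :+ b :* s :+ :- (ε :* a :+ φ :* b :+ γ :* c) :* y) refl y ε φ γ V₀ V₁ V₂ α s)
        (solve 9 (λ z ε φ γ a b c β r → (𝟙 :* β :+ :- (𝟘 :* r) :+ :- ε :* z) :* a :+ ((𝟘 :* β :+ :- (𝟙 :* r) :+ :- φ :* z) :* b :+ (:- γ :* z) :* c)
            := a :* β :+ :- (b :* r) :+ :- (ε :* a :+ φ :* b :+ γ :* c) :* z) refl z ε φ γ V₀ V₁ V₂ β r)

      C-curve : ∀ t i → C i 0F + (C i 1F * t + C i 2F * (t * t)) ≡ point 1# t (- (ε * 1# + φ * t + γ * (t * t))) i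
      C-curve t i = trans (cong (_+ (C i 1F * t + C i 2F * (t * t))) (sym (*-identityʳ _))) (C-point 1# t (t * t) i)

      evalQ-cong : ∀ {u v} → (∀ i → u i ≡ v i) → evalQ (quad a b c f g h) u ≡ evalQ (quad a b c f g h) v
      evalQ-cong e rewrite e 0F | e 1F | e 2F = refl

      point≡0 : ∀ {A B K} → (∀ i → point A B K i ≡ 0#) → A ≡ 0# × B ≡ 0# × K ≡ 0#
      point≡0 {A} {B} {K} e = A≡0 , B≡0 , K≡0
        where
        K≡0 : K ≡ 0#
        K≡0 = *-cancelˡ-0 x≢0 (trans (*-comm x K) (e 0F))
        m≡0 : A * α + B * s ≡ 0#
        m≡0 = trans (sym (trans (cong (A * α + B * s +_) (0* y K≡0)) (+-identityʳ _))) (e 1F)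
        n≡0 : A * β + - (B * r) ≡ 0#
        n≡0 = trans (sym (trans (cong (A * β + - (B * r) +_) (0* z K≡0)) (+-identityʳ _))) (e 2F)
        A≡0 : A ≡ 0#
        A≡0 = begin
          A                        ≡⟨ sym (trans (cong (A *_) rα+sβ≡1) (*-identityʳ A)) ⟩
          A * (r * α + s * β)      ≡⟨ solve 6 (λ A B r s α β → A :* (r :* α :+ s :* β)
                                        := r :* (A :* α :+ B :* s) :+ s :* (A :* β :+ :- (B :* r))) refl A B r s α β ⟩
          r * (A * α + B * s) + s * (A * β + - (B * r)) ≡⟨ +-≡0 (*0 r m≡0) (*0 s n≡0) ⟩
          0# ∎
        B≡0 : B ≡ 0#
        B≡0 = begin
          B                        ≡⟨ sym (trans (cong (B *_) rα+sβ≡1) (*-identityʳ B)) ⟩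
          B * (r * α + s * β)      ≡⟨ solve 6 (λ A B r s α β → B :* (r :* α :+ s :* β)
                                        := β :* (A :* α :+ B :* s) :+ (:- α) :* (A :* β :+ :- (B :* r))) refl A B r s α β ⟩
          β * (A * α + B * s) + (- α) * (A * β + - (B * r)) ≡⟨ +-≡0 (*0 β m≡0) (*0 (- α) n≡0) ⟩
          0# ∎

      param : ConicParam (quad a b c f g h) v₀
      param = record { C = C ; independent = ind ; on-conic = on ; at-∞ = - γ , -γ≢0 , (λ i → refl) ; cover = λ v v≢0 Qv≡0 →
        let A , B , K , v≡ = coords v in cov-point A B K v v≡ v≢0 Qv≡0 (A ≟ 0#) }
        where
        -γ≢0 : - γ ≢ 0#
        -γ≢0 e = γ≢0 (trans (solve 1 (λ g → g := :- (:- g)) refl γ) (trans (cong -_ e) -0#≈0#))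
        ind : ∀ (v : V Carrier 3) → (∀ i → C i 0F * v 0F + (C i 1F * v 1F + C i 2F * v 2F) ≡ 0#) → ∀ j → v j ≡ 0#
        ind v e = all₃ {λ j → v j ≡ 0#} z₀ z₁ (*-cancelˡ-0 γ≢0 (begin
          γ * v 2F     ≡⟨ solve 5 (λ ε φ γv a b → γv := :- (:- (ε :* a :+ φ :* b :+ γv)) :+ :- (ε :* a) :+ :- (φ :* b)) refl ε φ (γ * v 2F) (v 0F) (v 1F) ⟩
          - k + - (ε * v 0F) + - (φ * v 1F)
                       ≡⟨ +-≡0 (+-≡0 (-‿≡0 zk) (-‿≡0 (*0 ε z₀))) (-‿≡0 (*0 φ z₁)) ⟩
          0#           ∎))
          where
          k = - (ε * v 0F + φ * v 1F + γ * v 2F)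
          zs : v 0F ≡ 0# × v 1F ≡ 0# × k ≡ 0#
          zs = point≡0 {v 0F} {v 1F} {k} (λ i → trans (sym (C-point (v 0F) (v 1F) (v 2F) i)) (e i))
          z₀ = proj₁ zs
          z₁ = proj₁ (proj₂ zs)
          zk = proj₂ (proj₂ zs)
        on : ∀ t → evalQ (quad a b c f g h) (λ i → C i 0F + (C i 1F * t + C i 2F * (t * t))) ≡ 0#
        on t = trans (evalQ-cong (C-curve t)) (trans (eval-point 1# t (- (ε * 1# + φ * t + γ * (t * t))))
          (solve 4 (λ ε φ γ t → ε :* 𝟙 :* 𝟙 :+ φ :* 𝟙 :* t :+ γ :* t :* t :+ 𝟙 :* (:- (ε :* 𝟙 :+ φ :* t :+ γ :* (t :* t))) := 𝟘)
            refl ε φ γ t))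
        cov-point : ∀ A B K (v : V Carrier 3) → (∀ i → v i ≡ point A B K i) →
          ¬ (∀ i → v i ≡ 0#) → evalQ (quad a b c f g h) v ≡ 0# → Dec (A ≡ 0#) →
          (Σ Carrier λ t → Σ Carrier λ λ' → λ' ≢ 0# × (∀ i → v i ≡ λ' * (C i 0F + (C i 1F * t + C i 2F * (t * t)))))
          ⊎ (Σ Carrier λ λ' → λ' ≢ 0# × (∀ i → v i ≡ λ' * C i 2F))
        -- A = 0 is the tangent line at v₀. There the form is γB², so that only v₀ remains.
        cov-point A B K v v≡ v≢0 Qv≡0 (yes refl) = inj₂ (K * - γ⁻¹ , *-≢0 K≢0 -γ⁻¹≢0 , λ i → trans (v≡Kv₀ i) (sym (begin
            K * - γ⁻¹ * (- γ * v₀ i)   ≡⟨ solve 4 (λ K i γ v → K :* (:- i) :* (:- γ :* v) := K :* v :* (γ :* i)) refl K γ⁻¹ γ (v₀ i) ⟩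
            K * v₀ i * (γ * γ⁻¹)       ≡⟨ trans (cong (K * v₀ i *_) (*-inverseʳ γ≢0)) (*-identityʳ _) ⟩
            K * v₀ i                   ∎)))
          where
          γ⁻¹ = γ ⁻¹[ γ≢0 ]
          -γ⁻¹≢0 : - γ⁻¹ ≢ 0#
          -γ⁻¹≢0 e = ⁻¹-≢0 γ≢0 (trans (solve 1 (λ g → g := :- (:- g)) refl γ⁻¹) (trans (cong -_ e) -0#≈0#))
          B≡0 : B ≡ 0#
          B≡0 = x²≡0⇒x≡0 (*-cancelˡ-0 γ≢0 (begin
            γ * (B * B)   ≡⟨ solve 5 (λ ε φ γ B K → γ :* (B :* B) := ε :* 𝟘 :* 𝟘 :+ φ :* 𝟘 :* B :+ γ :* B :* B :+ 𝟘 :* K) refl ε φ γ B K ⟩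
            ε * 0# * 0# + φ * 0# * B + γ * B * B + 0# * K ≡⟨ sym (eval-point 0# B K) ⟩
            evalQ (quad a b c f g h) (point 0# B K)       ≡⟨ sym (evalQ-cong v≡) ⟩
            evalQ (quad a b c f g h) v                    ≡⟨ Qv≡0 ⟩
            0#            ∎))
          v≡Kv₀ : ∀ i → v i ≡ K * v₀ i
          v≡Kv₀ i = trans (v≡ i) (trans (cong (λ B → point 0# B K i) B≡0) (all₃ {λ i → point 0# 0# K i ≡ K * v₀ i} refl
            (solve 4 (λ α s K y → 𝟘 :* α :+ 𝟘 :* s :+ K :* y := K :* y) refl α s K y)
            (solve 4 (λ β r K z → 𝟘 :* β :+ :- (𝟘 :* r) :+ K :* z := K :* z) refl β r K z) i))
          K≢0 : K ≢ 0#
          K≢0 e = v≢0 (λ i → trans (v≡Kv₀ i) (0* _ e))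
        cov-point A B K v v≡ v≢0 Qv≡0 (no A≢0) = inj₁ (t , A , A≢0 , λ i → trans (v≡ i) (sym (trans (cong (A *_) (C-curve t i)) (A*point i))))
          where
          t = B * A ⁻¹[ A≢0 ]
          At≡B : A * t ≡ B
          At≡B = trans (solve 3 (λ A B i → A :* (B :* i) := B :* (A :* i)) refl A B _)
                       (trans (cong (B *_) (*-inverseʳ A≢0)) (*-identityʳ B))
          k = - (ε * 1# + φ * t + γ * (t * t))
          Ak≡K : A * k ≡ K
          Ak≡K = *-cancelˡ A≢0 (x-y≡0⇒x≡y (begin
            A * (A * k) + - (A * K)
              ≡⟨ solve 6 (λ A K t ε φ γ → A :* (A :* (:- (ε :* 𝟙 :+ φ :* t :+ γ :* (t :* t)))) :+ :- (A :* K)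
                   := :- (ε :* A :* A :+ φ :* A :* (A :* t) :+ γ :* (A :* t) :* (A :* t) :+ A :* K)) refl A K t ε φ γ ⟩
            - (ε * A * A + φ * A * (A * t) + γ * (A * t) * (A * t) + A * K)
              ≡⟨ cong (λ B → - (ε * A * A + φ * A * B + γ * B * B + A * K)) At≡B ⟩
            - (ε * A * A + φ * A * B + γ * B * B + A * K)
              ≡⟨ cong -_ (trans (sym (eval-point A B K)) (trans (sym (evalQ-cong v≡)) Qv≡0)) ⟩
            - 0# ≡⟨ -0#≈0# ⟩
            0# ∎))
          A*point : ∀ i → A * point 1# t k i ≡ point A B K i
          A*point i = trans (all₃ {λ i → A * point 1# t k i ≡ point A (A * t) (A * k) i}
            (solve 3 (λ A k x → A :* (k :* x) := A :* k :* x) refl A k x)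
            (solve 6 (λ A t k α s y → A :* (𝟙 :* α :+ t :* s :+ k :* y) := A :* α :+ A :* t :* s :+ A :* k :* y) refl A t k α s y)
            (solve 6 (λ A t k β r z → A :* (𝟙 :* β :+ :- (t :* r) :+ k :* z) := A :* β :+ :- (A :* t :* r) :+ A :* k :* z) refl A t k β r z) i)
            (cong₂ (λ B K → point A B K i) At≡B Ak≡K)

    param-x≢0 : ConicParam (quad a b c f g h) v₀
    param-x≢0 = WithChord.param (proj₁ unimodular) (proj₁ (proj₂ unimodular)) (proj₂ (proj₂ unimodular))

  conic-param : ∀ Q v₀ → NonDegenerate Q → ¬ (∀ i → v₀ i ≡ 0#) → evalQ Q v₀ ≡ 0# → ConicParam Q v₀
  conic-param Q@(quad a b c f g h) v₀ nd nz e with v₀ 0F ≟ 0# | v₀ 1F ≟ 0# | v₀ 2F ≟ 0#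
  ... | no x≢0  | _ | _ = param-x≢0 a b c f g h v₀ nd e x≢0
  ... | yes x≡0 | no y≢0  | _ = unrotate-param (param-x≢0 b c a g h f (λ i → v₀ (next i))
          (rotate-nondegenerate {Q} nd) (trans (rotate-eval Q v₀) e) y≢0)
  ... | yes x≡0 | yes y≡0 | no z≢0 = unrotate-param (unrotate-param (param-x≢0 c a b h f g (λ i → v₀ (next (next i)))
          (rotate-nondegenerate {rotate Q} (rotate-nondegenerate {Q} nd))
          (trans (rotate-eval (rotate Q) (λ i → v₀ (next i))) (trans (rotate-eval Q v₀) e)) z≢0))
  ... | yes x≡0 | yes y≡0 | yes z≡0 = contradiction (all₃ x≡0 y≡0 z≡0) nz

-- Twisted cubics over the extension and change of parametrisation

all₄ : ∀ {P : Fin 4 → Set} → P 0F → P 1F → P 2F → P 3F → ∀ i → P i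
all₄ a b c d 0F = a
all₄ a b c d 1F = b
all₄ a b c d 2F = c
all₄ a b c d 3F = d

module TwistedCubics (F : Field) (q : ℕ) (t₀ t₁ : Field.Carrier F)
  (irr : Geometry.Irreducible F q t₀ t₁) where
  open Geometry F q t₀ t₁
  open QuadraticExtension F q t₀ t₁ irr
  open FieldTheory 𝔼
  private module F = FieldTheory F
  open LinearAlgebra 𝔼
  open ≡-Reasoning

  curve : E → V E 4
  curve t = vec4 1E t (t *E t) (t *E t *E t)

  curve∞ : V E 4
  curve∞ = vec4 0E 0E 0E 1E

  curveF : F.Carrier → V F.Carrier 4
  curveF t = vec4 F.1# t (t F.* t) (t F.* t F.* t)

  sum4E-cong : ∀ {f g : Fin 4 → E} → (∀ j → f j ≡ g j) → sum4E f ≡ sum4E g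
  sum4E-cong e = cong₂ _+E_ (e 0F) (cong₂ _+E_ (e 1F) (cong₂ _+E_ (e 2F) (e 3F)))

  ·4E-cong : ∀ K {v w : V E 4} → (∀ j → v j ≡ w j) → ∀ i → (K ·4E v) i ≡ (K ·4E w) i
  ·4E-cong K e i = sum4E-cong (λ j → cong (ι (K i j) *E_) (e j))

  ·4E-scale : ∀ K c v i → (K ·4E (λ j → c *E v j)) i ≡ c *E (K ·4E v) i
  ·4E-scale K c v i = solve 9 (λ c k₀ k₁ k₂ k₃ v₀ v₁ v₂ v₃ →
      k₀ :* (c :* v₀) :+ (k₁ :* (c :* v₁) :+ (k₂ :* (c :* v₂) :+ k₃ :* (c :* v₃)))
      := c :* (k₀ :* v₀ :+ (k₁ :* v₁ :+ (k₂ :* v₂ :+ k₃ :* v₃)))) refl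
    c (ι (K i 0F)) (ι (K i 1F)) (ι (K i 2F)) (ι (K i 3F)) (v 0F) (v 1F) (v 2F) (v 3F)

  ·4E-ι : ∀ K (v : V F.Carrier 4) i → (K ·4E (λ j → ι (v j))) i ≡ ι ((K ·4 v) i)
  ·4E-ι K v i = trans (sum4E-cong (λ j → sym (ι-* (K i j) (v j))))
    (sym (trans (ι-+ _ _) (cong (ι (K i 0F F.* v 0F) +E_) (trans (ι-+ _ _) (cong (ι (K i 1F F.* v 1F) +E_) (ι-+ _ _))))))

  ·4E-components : ∀ K v i → (K ·4E v) i ≡ ((K ·4 (λ j → proj₁ (v j))) i , (K ·4 (λ j → proj₂ (v j))) i)
  ·4E-components K v i = sum4E-cong (λ j → ι*E (K i j) (v j))

  -- The entries of the matrix lie in F, so it acts separately on the two F-components of a vector.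
  rank4E : ∀ K → Rank4 K → ∀ v → (∀ i → (K ·4E v) i ≡ 0E) → ∀ j → v j ≡ 0E
  rank4E K r v e j = cong₂ _,_
    (r (λ j → proj₁ (v j)) (λ i → cong proj₁ (trans (sym (·4E-components K v i)) (e i))) j)
    (r (λ j → proj₂ (v j)) (λ i → cong proj₂ (trans (sym (·4E-components K v i)) (e i))) j)

  curve-ι : ∀ t j → curve (ι t) j ≡ ι (curveF t j)
  curve-ι t = all₄ {λ j → curve (ι t) j ≡ ι (curveF t j)} refl refl (sym (ι-* t t))
    (sym (trans (ι-* (t F.* t) t) (cong (_*E ι t) (ι-* t t))))

  curve∞-ι : ∀ j → curve∞ j ≡ ι (vec4 F.0# F.0# F.0# F.1# j)
  curve∞-ι = all₄ {λ j → curve∞ j ≡ ι (vec4 F.0# F.0# F.0# F.1# j)} refl refl refl refl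

  -- The 2 by 2 minors of the matrix with rows (w₀,w₁,w₂) and (w₁,w₂,w₃). Unlike the existence of a
  -- parameter, these are polynomial equations, which can be extended from F to F(τ).
  InCone : V E 4 → Set
  InCone w = w 0F *E w 2F ≡ w 1F *E w 1F × w 1F *E w 3F ≡ w 2F *E w 2F × w 0F *E w 3F ≡ w 1F *E w 2F

  inCone-cong : ∀ {v w : V E 4} → (∀ j → v j ≡ w j) → InCone w → InCone v
  inCone-cong {v} {w} e (c₁ , c₂ , c₃) =
    quadric 0F 2F 1F 1F c₁ , quadric 1F 3F 2F 2F c₂ , quadric 0F 3F 1F 2F c₃
    where
    quadric : ∀ i j k l → w i *E w j ≡ w k *E w l → v i *E v j ≡ v k *E v l
    quadric i j k l c = trans (cong₂ _*E_ (e i) (e j)) (trans c (sym (cong₂ _*E_ (e k) (e l))))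

  inCone-curve : ∀ c t → InCone (λ j → c *E curve t j)
  inCone-curve c t =
    solve 2 (λ c t → (c :* 𝟙) :* (c :* (t :* t)) := (c :* t) :* (c :* t)) refl c t ,
    solve 2 (λ c t → (c :* t) :* (c :* (t :* t :* t)) := (c :* (t :* t)) :* (c :* (t :* t))) refl c t ,
    solve 2 (λ c t → (c :* 𝟙) :* (c :* (t :* t :* t)) := (c :* t) :* (c :* (t :* t))) refl c t

  inCone-curve∞ : ∀ c → InCone (λ j → c *E curve∞ j)
  inCone-curve∞ c =
    solve 1 (λ c → (c :* 𝟘) :* (c :* 𝟘) := (c :* 𝟘) :* (c :* 𝟘)) refl c ,
    solve 1 (λ c → (c :* 𝟘) :* (c :* 𝟙) := (c :* 𝟘) :* (c :* 𝟘)) refl c ,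
    solve 1 (λ c → (c :* 𝟘) :* (c :* 𝟙) := (c :* 𝟘) :* (c :* 𝟘)) refl c

  inCone⇒curve : ∀ w → InCone w →
    (Σ E λ t → Σ E λ c → ∀ j → w j ≡ c *E curve t j) ⊎ (Σ E λ c → ∀ j → w j ≡ c *E curve∞ j)
  inCone⇒curve w (w₀w₂ , w₁w₃ , w₀w₃) = by (w 0F ≟ 0E)
    where
    by : Dec (w 0F ≡ 0E) → _
    by (no nz) = inj₁ (t , w 0F , all₄ {λ j → w j ≡ w 0F *E curve t j}
        (sym (*-identityʳ _)) (sym w₀t) w₂ w₃)
      where
      t = w 1F *E w 0F ⁻¹[ nz ]
      w₀t : w 0F *E t ≡ w 1F
      w₀t = trans (solve 3 (λ a b i → a :* (b :* i) := b :* (a :* i)) refl (w 0F) (w 1F) (w 0F ⁻¹[ nz ]))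
                  (trans (cong (w 1F *E_) (*-inverseʳ nz)) (*-identityʳ _))
      w₂ : w 2F ≡ w 0F *E (t *E t)
      w₂ = *-cancelˡ nz (trans w₀w₂ (trans (sym (cong₂ _*E_ w₀t w₀t))
        (solve 2 (λ a t → a :* t :* (a :* t) := a :* (a :* (t :* t))) refl (w 0F) t)))
      w₃ : w 3F ≡ w 0F *E (t *E t *E t)
      w₃ = *-cancelˡ nz (trans w₀w₃ (trans (cong₂ _*E_ (sym w₀t) w₂)
        (solve 2 (λ a t → a :* t :* (a :* (t :* t)) := a :* (a :* (t :* t :* t))) refl (w 0F) t)))
    by (yes w₀≡0) = inj₂ (w 3F , all₄ {λ j → w j ≡ w 3F *E curve∞ j}
        (trans w₀≡0 (sym (zeroʳ _))) (trans w₁≡0 (sym (zeroʳ _))) (trans w₂≡0 (sym (zeroʳ _))) (sym (*-identityʳ _)))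
      where
      w₁≡0 : w 1F ≡ 0E
      w₁≡0 = x²≡0⇒x≡0 (trans (sym w₀w₂) (0* _ w₀≡0))
      w₂≡0 : w 2F ≡ 0E
      w₂≡0 = x²≡0⇒x≡0 (trans (sym w₁w₃) (0* _ w₁≡0))

  inCone⇒Star : ∀ K w → InCone w → ∀ Y c → NonZeroE Y → (∀ i → Y i ≡ c *E (K ·4E w) i) → Star K Y
  inCone⇒Star K w cone Y c Y≢0 Y≡ = Y≢0 , by (inCone⇒curve w cone)
    where
    to∝ : ∀ d v → (∀ j → w j ≡ d *E v j) → Y ∝E (K ·4E v)
    -- The cone contains the zero vector, so that the factor is nonzero has to come from Y.
    to∝ d v e = c *E d , (λ z → Y≢0 (λ i → trans (Y≡cd i) (0* _ z))) , Y≡cd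
      where
      Y≡cd : ∀ i → Y i ≡ c *E d *E (K ·4E v) i
      Y≡cd i = trans (Y≡ i) (trans (cong (c *E_) (trans (·4E-cong K e i) (·4E-scale K d v i))) (sym (*-assoc c d _)))
    by : _ ⊎ _ → _ ⊎ _
    by (inj₁ (t , d , e)) = inj₁ (t , to∝ d (curve t) e)
    by (inj₂ (d , e))     = inj₂ (to∝ d curve∞ e)

  cubic : E → E → E → E → E → E
  cubic a b c d t = a +E t *E (b +E t *E (c +E t *E d))

  poly-cubic : ∀ a b c d → Poly 4 (cubic a b c d)
  poly-cubic a b c d = a , _ , (b , _ , (c , _ , poly-const 0 d , λ _ → refl) , λ _ → refl) , λ _ → refl

  ·4E-curve : ∀ K i t → (K ·4E curve t) i ≡ cubic (ι (K i 0F)) (ι (K i 1F)) (ι (K i 2F)) (ι (K i 3F)) t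
  ·4E-curve K i t = solve 5 (λ a b c d t → a :* 𝟙 :+ (b :* t :+ (c :* (t :* t) :+ d :* (t :* t :* t)))
      := a :+ t :* (b :+ t :* (c :+ t :* d))) refl (ι (K i 0F)) (ι (K i 1F)) (ι (K i 2F)) (ι (K i 3F)) t

  fn-cubic : ∀ {m} (φ : Functional m) (a b c d : V E m) t →
    fn φ (λ i → cubic (a i) (b i) (c i) (d i) t) ≡ cubic (fn φ a) (fn φ b) (fn φ c) (fn φ d) t
  fn-cubic φ a b c d t = step a (step b (step c refl))
    where
    step : ∀ a {v x} → fn φ v ≡ x → fn φ (λ i → a i +E t *E v i) ≡ fn φ a +E t *E x
    step a {v} e = trans (fn-+ φ a _) (cong (fn φ a +E_) (trans (fn-* φ t v) (cong (t *E_) e)))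

  module _ (enum : F.Carrier ↔ Fin q) (7≤q : 7 ≤ q) where
    open FiniteField F q enum using (elem; elem-injective)

    vanish-on-F : ∀ {f} → Poly 7 f → (∀ t → f (ι t) ≡ 0E) → ∀ t → f t ≡ 0E
    vanish-on-F p e = poly-vanish 7 p (λ i → ι (elem (inject≤ i 7≤q)))
      (λ i j eq → Finₚ.inject≤-injective 7≤q 7≤q i j (elem-injective _ _ (ι-injective eq)))
      (λ i → e _)

    module _ {K K′ : Mat54} {N : V F.Carrier 5 → Set} (rK : Rank4 K) (rK′ : Rank4 K′)
      (pK : Parametrizes K N) (pK′ : Parametrizes K′ N) where
      private
        columns : Fin 4 → Vect 5
        columns j i = ι (K i j)

        Σ*≡·4E : ∀ v i → Σ* v (λ j → columns j i) ≡ (K ·4E v) i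
        Σ*≡·4E v i = solve 8 (λ k₀ k₁ k₂ k₃ v₀ v₁ v₂ v₃ →
            v₀ :* k₀ :+ (v₁ :* k₁ :+ (v₂ :* k₂ :+ (v₃ :* k₃ :+ 𝟘)))
            := k₀ :* v₀ :+ (k₁ :* v₁ :+ (k₂ :* v₂ :+ k₃ :* v₃))) refl
          (ι (K i 0F)) (ι (K i 1F)) (ι (K i 2F)) (ι (K i 3F)) (v 0F) (v 1F) (v 2F) (v 3F)

      module _ (D : DualBasis columns) where
        private
          open DualBasis D

          dual-·4E : ∀ w j → fn (dual j) (K ·4E w) ≡ w j
          dual-·4E w j = trans (fn-≗ (dual j) (λ i → sym (Σ*≡·4E w i)))
            (trans (fn-Σ* (dual j) w columns) (Σ*-δ w (λ k → fn (dual j) (columns k)) j (dual-1 j) (dual-0 j)))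

          -- A point of the `K′`-curve over F lies in N, hence on the `K`-curve, and its parameter
          -- there gives the coordinates w. A general v covers finite parameters and ∞ together.
          rational-point : ∀ (v : V F.Carrier 4) → ¬ (∀ j → v j ≡ F.0#) →
            (∀ x → NonZero x → (∀ i → x i ≡ (K′ ·4 v) i) → N x) →
            Σ (V E 4) λ w → InCone w × (∀ i → (K′ ·4E (λ j → ι (v j))) i ≡ (K ·4E w) i)
          rational-point v v≢0 inN = by (Equivalence.to (pK x x≢0) (inN x x≢0 (λ _ → refl)))
            where
            x : V F.Carrier 5
            x = K′ ·4 v
            x≢0 : NonZero x
            x≢0 z = v≢0 (rK′ v z)
            lift : ∀ c (u : V F.Carrier 4) (u′ : V E 4) → (∀ j → u′ j ≡ ι (u j)) → (∀ i → x i ≡ c F.* (K ·4 u) i) →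
              ∀ i → (K′ ·4E (λ j → ι (v j))) i ≡ (K ·4E (λ j → ι c *E u′ j)) i
            lift c u u′ e x≡ i = begin
              (K′ ·4E (λ j → ι (v j))) i           ≡⟨ ·4E-ι K′ v i ⟩
              ι (x i)                              ≡⟨ cong ι (x≡ i) ⟩
              ι (c F.* (K ·4 u) i)                 ≡⟨ ι-* c _ ⟩
              ι c *E ι ((K ·4 u) i)                ≡⟨ cong (ι c *E_) (trans (sym (·4E-ι K u i)) (·4E-cong K (λ j → sym (e j)) i)) ⟩
              ι c *E (K ·4E u′) i                  ≡⟨ sym (·4E-scale K (ι c) u′ i) ⟩
              (K ·4E (λ j → ι c *E u′ j)) i        ∎
            Lies : Set
            Lies = Σ (V E 4) λ w → InCone w × (∀ i → (K′ ·4E (λ j → ι (v j))) i ≡ (K ·4E w) i)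
            on-curve : ∀ s c → (∀ i → x i ≡ c F.* (K ·4 curveF s) i) → Lies
            on-curve s c e = (λ j → ι c *E curve (ι s) j) , inCone-curve (ι c) (ι s) , lift c (curveF s) (curve (ι s)) (curve-ι s) e
            at-∞ : ∀ c → (∀ i → x i ≡ c F.* (K ·4 vec4 F.0# F.0# F.0# F.1#) i) → Lies
            at-∞ c e = (λ j → ι c *E curve∞ j) , inCone-curve∞ (ι c) , lift c (vec4 F.0# F.0# F.0# F.1#) curve∞ curve∞-ι e
            by : ((Σ F.Carrier λ s → x ∝ (K ·4 curveF s)) ⊎ x ∝ (K ·4 vec4 F.0# F.0# F.0# F.1#)) → Lies
            by (inj₁ (s , c , _ , e)) = on-curve s c e
            by (inj₂ (c , _ , e))     = at-∞ c e

          -- Coordinates of the point t of the `K′`-curve with respect to the columns of `K`. They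
          -- determine this point only once it is known to lie in the span of these columns, which
          -- `Ku≡K′` supplies.
          u : Fin 4 → E → E
          u j t = fn (dual j) (K′ ·4E curve t)

          poly-u : ∀ j → Poly 4 (u j)
          poly-u j = poly-cong 4 (λ t → trans (fn-≗ (dual j) (λ i → ·4E-curve K′ i t))
              (fn-cubic (dual j) (col 0F) (col 1F) (col 2F) (col 3F) t))
            (poly-cubic (fn (dual j) (col 0F)) (fn (dual j) (col 1F)) (fn (dual j) (col 2F)) (fn (dual j) (col 3F)))
            where
            col : Fin 4 → Vect 5
            col k i = ι (K′ i k)

          inN : ∀ t x → NonZero x → (∀ i → x i ≡ (K′ ·4 curveF t) i) → N x
          inN t x x≢0 e = Equivalence.from (pK′ x x≢0) (inj₁ (t , F.1# , F.1≢0 , λ i → trans (e i) (sym (F.*-identityˡ _))))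

          inN∞ : ∀ x → NonZero x → (∀ i → x i ≡ (K′ ·4 vec4 F.0# F.0# F.0# F.1#) i) → N x
          inN∞ x x≢0 e = Equivalence.from (pK′ x x≢0) (inj₂ (F.1# , F.1≢0 , λ i → trans (e i) (sym (F.*-identityˡ _))))

          u-rational : ∀ t → InCone (λ j → u j (ι t)) × (∀ i → (K ·4E (λ j → u j (ι t))) i ≡ (K′ ·4E curve (ι t)) i)
          u-rational t = inCone-cong u≡w (proj₁ (proj₂ pt)) , λ i → trans (·4E-cong K u≡w i) (sym (K′≡Kw i))
            where
            pt = rational-point (curveF t) (λ z → F.1≢0 (z 0F)) (inN t)
            w = proj₁ pt
            K′≡Kw : ∀ i → (K′ ·4E curve (ι t)) i ≡ (K ·4E w) i
            K′≡Kw i = trans (·4E-cong K′ (curve-ι t) i) (proj₂ (proj₂ pt) i)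
            u≡w : ∀ j → u j (ι t) ≡ w j
            u≡w j = trans (fn-≗ (dual j) K′≡Kw) (dual-·4E w j)

          x+-1*y≡0⇒x≡y : ∀ {x y} → x +E (-E 1E) *E y ≡ 0E → x ≡ y
          x+-1*y≡0⇒x≡y {x} {y} e = x-y≡0⇒x≡y (trans (solve 2 (λ x y → x :+ :- y := x :+ :- 𝟙 :* y) refl x y) e)

          x≡y⇒x+-1*y≡0 : ∀ {x y} → x ≡ y → x +E (-E 1E) *E y ≡ 0E
          x≡y⇒x+-1*y≡0 {x} refl = solve 1 (λ x → x :+ :- 𝟙 :* x := 𝟘) refl x

          extend : ∀ {f g} → Poly 7 f → Poly 7 g → (∀ t → f (ι t) ≡ g (ι t)) → ∀ t → f t ≡ g t
          extend {f} {g} pf pg e t = x+-1*y≡0⇒x≡y {f t} (vanish-on-F (poly-+ 7 pf (poly-scale 7 (-E 1E) pg)) (λ t → x≡y⇒x+-1*y≡0 (e t)) t)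

          product : ∀ i j → Poly 7 (λ t → u i t *E u j t)
          product i j = poly-* 4 3 (poly-u i) (poly-u j)

          u-cone : ∀ t → InCone (λ j → u j t)
          u-cone t =
            extend (product 0F 2F) (product 1F 1F) (λ t → proj₁ (proj₁ (u-rational t))) t ,
            extend (product 1F 3F) (product 2F 2F) (λ t → proj₁ (proj₂ (proj₁ (u-rational t)))) t ,
            extend (product 0F 3F) (product 1F 2F) (λ t → proj₂ (proj₂ (proj₁ (u-rational t)))) t

          4≤7 : 4 ≤ 7
          4≤7 = s≤s (s≤s (s≤s (s≤s z≤n)))

          Ku≡K′ : ∀ t i → (K ·4E (λ j → u j t)) i ≡ (K′ ·4E curve t) i
          Ku≡K′ t i = extend
            (poly-weaken 4≤7 (poly-+ 4 (term 0F) (poly-+ 4 (term 1F) (poly-+ 4 (term 2F) (term 3F)))))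
            (poly-weaken 4≤7 (poly-cong 4 (·4E-curve K′ i) (poly-cubic _ _ _ _)))
            (λ t → proj₂ (u-rational t) i) t
            where
            term : ∀ j → Poly 4 (λ t → ι (K i j) *E u j t)
            term j = poly-scale 4 (ι (K i j)) (poly-u j)

        star-⊆-dual : ∀ Y → Star K′ Y → Star K Y
        star-⊆-dual Y (Y≢0 , inj₁ (t , c , _ , e)) = inCone⇒Star K (λ j → u j t) (u-cone t) Y c Y≢0
          (λ i → trans (e i) (cong (c *E_) (sym (Ku≡K′ t i))))
        -- The point with parameter ∞ is already defined over F, so `rational-point` applies to it
        -- directly.
        star-⊆-dual Y (Y≢0 , inj₂ (c , _ , e)) = inCone⇒Star K (proj₁ pt) (proj₁ (proj₂ pt)) Y c Y≢0
          (λ i → trans (e i) (cong (c *E_) (trans (·4E-cong K′ curve∞-ι i) (proj₂ (proj₂ pt) i))))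
          where
          pt = rational-point (vec4 F.0# F.0# F.0# F.1#) (λ z → F.1≢0 (z 3F)) inN∞

      star-⊆ : ∀ Y → Star K′ Y → Star K Y
      star-⊆ = star-⊆-dual (independent⇒dual columns
        (λ v e → rank4E K rK v (λ i → trans (sym (Σ*≡·4E v i)) (e i))))

-- The lines g and g^q and their intersection with a cubic

all₅ : ∀ {P : Fin 5 → Set} → P 0F → P 1F → P 2F → P 3F → P 4F → ∀ i → P i
all₅ a b c d e 0F = a
all₅ a b c d e 1F = b
all₅ a b c d e 2F = c
all₅ a b c d e 3F = d
all₅ a b c d e 4F = e

module Special (F : Field) (q : ℕ) (t₀ t₁ : Field.Carrier F)
  (irr : Geometry.Irreducible F q t₀ t₁) where
  open Geometry F q t₀ t₁
  open QuadraticExtension F q t₀ t₁ irr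
  open FieldTheory 𝔼
  private module F = FieldTheory F
  open TwistedCubics F q t₀ t₁ irr
  open ≡-Reasoning

  exactlyOne-cong : ∀ {S S′ L : V E 5 → Set} → (∀ Y → S Y → S′ Y) → (∀ Y → S′ Y → S Y) →
    ExactlyOnePoint S L → ExactlyOnePoint S′ L
  exactlyOne-cong S⊆S′ S′⊆S (X , SX , LX , unique) = X , S⊆S′ X SX , LX , λ Y S′Y → unique Y (S′⊆S Y S′Y)

  pw : E → V E 3
  pw t = vec3 1E t (t *E t)

  -- Coefficients of the product of a quadratic polynomial and a linear one.
  conv : V E 3 → E → E → V E 4
  conv g w₀ w₁ = vec4 (g 0F *E w₀) (g 0F *E w₁ +E g 1F *E w₀) (g 1F *E w₁ +E g 2F *E w₀) (g 2F *E w₁)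

  _∙_ : V E 4 → V E 4 → E
  r ∙ v = sum4E (λ j → r j *E v j)

  ∙-congˡ : ∀ {r s : V E 4} v → (∀ j → r j ≡ s j) → r ∙ v ≡ s ∙ v
  ∙-congˡ v e = sum4E-cong (λ j → cong (_*E v j) (e j))

  -- Regrouped by the coefficients of the quadratic factor: a vector annihilated by the products of
  -- all rows of a matrix with the same linear factor yields a kernel vector of that matrix. The
  -- rank of the cubic is computed this way.
  conv-∙ : ∀ g w₀ w₁ v → conv g w₀ w₁ ∙ v ≡
    sum3E (λ k → g k *E vec3 (w₀ *E v 0F +E w₁ *E v 1F) (w₀ *E v 1F +E w₁ *E v 2F) (w₀ *E v 2F +E w₁ *E v 3F) k)
  conv-∙ g w₀ w₁ v = solve 9 (λ g₀ g₁ g₂ w₀ w₁ v₀ v₁ v₂ v₃ →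
      g₀ :* w₀ :* v₀ :+ ((g₀ :* w₁ :+ g₁ :* w₀) :* v₁ :+ ((g₁ :* w₁ :+ g₂ :* w₀) :* v₂ :+ g₂ :* w₁ :* v₃))
      := g₀ :* (w₀ :* v₀ :+ w₁ :* v₁) :+ (g₁ :* (w₀ :* v₁ :+ w₁ :* v₂) :+ g₂ :* (w₀ :* v₂ :+ w₁ :* v₃))) refl
    (g 0F) (g 1F) (g 2F) w₀ w₁ (v 0F) (v 1F) (v 2F) (v 3F)

  conv-curve : ∀ g w₀ w₁ t → conv g w₀ w₁ ∙ curve t ≡ sum3E (λ k → g k *E pw t k) *E (w₀ +E w₁ *E t)
  conv-curve g w₀ w₁ t = solve 6 (λ g₀ g₁ g₂ w₀ w₁ t →
      g₀ :* w₀ :* 𝟙 :+ ((g₀ :* w₁ :+ g₁ :* w₀) :* t :+ ((g₁ :* w₁ :+ g₂ :* w₀) :* (t :* t) :+ g₂ :* w₁ :* (t :* t :* t)))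
      := (g₀ :* 𝟙 :+ (g₁ :* t :+ g₂ :* (t :* t))) :* (w₀ :+ w₁ :* t)) refl
    (g 0F) (g 1F) (g 2F) w₀ w₁ t

  conv-curve∞ : ∀ g w₀ w₁ → conv g w₀ w₁ ∙ curve∞ ≡ g 2F *E w₁
  conv-curve∞ g w₀ w₁ = solve 5 (λ g₀ g₁ g₂ w₀ w₁ →
      g₀ :* w₀ :* 𝟘 :+ ((g₀ :* w₁ :+ g₁ :* w₀) :* 𝟘 :+ ((g₁ :* w₁ :+ g₂ :* w₀) :* 𝟘 :+ g₂ :* w₁ :* 𝟙))
      := g₂ :* w₁) refl
    (g 0F) (g 1F) (g 2F) w₀ w₁

  conv-σ : ∀ g w₀ w₁ j → σ (conv g w₀ w₁ j) ≡ conv (λ k → σ (g k)) (σ w₀) (σ w₁) j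
  conv-σ g w₀ w₁ = all₄ {λ j → σ (conv g w₀ w₁ j) ≡ conv (λ k → σ (g k)) (σ w₀) (σ w₁) j}
    (σ-* (g 0F) w₀)
    (trans (σ-+ (g 0F *E w₁) (g 1F *E w₀)) (cong₂ _+E_ (σ-* (g 0F) w₁) (σ-* (g 1F) w₀)))
    (trans (σ-+ (g 1F *E w₁) (g 2F *E w₀)) (cong₂ _+E_ (σ-* (g 1F) w₁) (σ-* (g 2F) w₀)))
    (σ-* (g 2F) w₁)

  ι-proj₁ : ∀ {x} → proj₂ x ≡ F.0# → ι (proj₁ x) ≡ x
  ι-proj₁ {x} e = cong (proj₁ x ,_) (sym e)

  components : ∀ x → ι (proj₁ x) +E ι (proj₂ x) *E τ ≡ x
  components (a , b) = cong₂ _,_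
    (F.solve 3 (λ a b s → a F.:+ (b F.:* F.𝟘 F.:+ F.𝟘 F.:* F.𝟙 F.:* s) F.:= a) refl a b t₀)
    (F.solve 2 (λ b t → F.𝟘 F.:+ (b F.:* F.𝟙 F.:+ F.𝟘 F.:* F.𝟘 F.:+ F.𝟘 F.:* F.𝟙 F.:* t) F.:= b) refl b t₁)

  -- Putting τ̄ for τ in front of the same F-components conjugates the element; thus the equations
  -- of g turn the real rows of the cubic into conjugated products.
  components-σ : ∀ x → ι (proj₁ x) +E ι (proj₂ x) *E σ τ ≡ σ x
  components-σ x = begin
    ι (proj₁ x) +E ι (proj₂ x) *E σ τ             ≡⟨ sym (cong₂ _+E_ (σ-ι (proj₁ x)) (cong (_*E σ τ) (σ-ι (proj₂ x)))) ⟩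
    σ (ι (proj₁ x)) +E σ (ι (proj₂ x)) *E σ τ     ≡⟨ cong (σ (ι (proj₁ x)) +E_) (sym (σ-* (ι (proj₂ x)) τ)) ⟩
    σ (ι (proj₁ x)) +E σ (ι (proj₂ x) *E τ)       ≡⟨ sym (σ-+ (ι (proj₁ x)) (ι (proj₂ x) *E τ)) ⟩
    σ (ι (proj₁ x) +E ι (proj₂ x) *E τ)           ≡⟨ cong σ (components x) ⟩
    σ x                                           ∎

  norm-rational : ∀ x → proj₂ (x *E σ x) ≡ F.0#
  norm-rational x = cong proj₂ (x*σx x)

  trace-rational : ∀ x y → proj₂ (x *E σ y +E y *E σ x) ≡ F.0#
  trace-rational (a , b) (c , d) = F.solve 5 (λ a b c d t →
      (a F.:* (F.:- d) F.:+ b F.:* (c F.:+ d F.:* t) F.:+ b F.:* (F.:- d) F.:* t)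
      F.:+ (c F.:* (F.:- b) F.:+ d F.:* (a F.:+ b F.:* t) F.:+ d F.:* (F.:- b) F.:* t) F.:= F.𝟘) refl a b c d t₁

  -- ρ is τ^q for g and τ for g^q, so both lines are treated at once.
  module OnLine {U W : V E 5} {ρ : E} (U≡ : ∀ i → U i ≡ vec5 ρ (-E 1E) 0E 0E 0E i)
    (W≡ : ∀ i → W i ≡ vec5 0E 0E ρ (-E 1E) 0E i) where

    OnLineE⇒ : ∀ Y → OnLineE U W Y → Y 0F +E Y 1F *E ρ ≡ 0E × Y 2F +E Y 3F *E ρ ≡ 0E × Y 4F ≡ 0E
    OnLineE⇒ Y (_ , α , β , e) =
      trans (cong₂ (λ a b → a +E b *E ρ) (Y≡ 0F) (Y≡ 1F))
        (solve 3 (λ α β ρ → α :* ρ :+ β :* 𝟘 :+ (α :* (:- 𝟙) :+ β :* 𝟘) :* ρ := 𝟘) refl α β ρ) ,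
      trans (cong₂ (λ a b → a +E b *E ρ) (Y≡ 2F) (Y≡ 3F))
        (solve 3 (λ α β ρ → α :* 𝟘 :+ β :* ρ :+ (α :* 𝟘 :+ β :* (:- 𝟙)) :* ρ := 𝟘) refl α β ρ) ,
      trans (Y≡ 4F) (solve 2 (λ α β → α :* 𝟘 :+ β :* 𝟘 := 𝟘) refl α β)
      where
      Y≡ : ∀ i → Y i ≡ α *E vec5 ρ (-E 1E) 0E 0E 0E i +E β *E vec5 0E 0E ρ (-E 1E) 0E i
      Y≡ i = trans (e i) (cong₂ (λ u w → α *E u +E β *E w) (U≡ i) (W≡ i))

    ⇒OnLineE : ∀ Y → NonZeroE Y → Y 0F +E Y 1F *E ρ ≡ 0E → Y 2F +E Y 3F *E ρ ≡ 0E → Y 4F ≡ 0E → OnLineE U W Y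
    ⇒OnLineE Y Y≢0 e₀ e₂ e₄ = Y≢0 , -E Y 1F , -E Y 3F , λ i → trans (eq i)
        (sym (cong₂ (λ u w → (-E Y 1F) *E u +E (-E Y 3F) *E w) (U≡ i) (W≡ i)))
      where
      solve-for : ∀ a b → a +E b *E ρ ≡ 0E → a ≡ (-E b) *E ρ
      solve-for a b e = x-y≡0⇒x≡y (trans (solve 3 (λ a b ρ → a :+ :- ((:- b) :* ρ) := a :+ b :* ρ) refl a b ρ) e)
      eq : ∀ i → Y i ≡ (-E Y 1F) *E vec5 ρ (-E 1E) 0E 0E 0E i +E (-E Y 3F) *E vec5 0E 0E ρ (-E 1E) 0E i
      eq = all₅ {λ i → Y i ≡ (-E Y 1F) *E vec5 ρ (-E 1E) 0E 0E 0E i +E (-E Y 3F) *E vec5 0E 0E ρ (-E 1E) 0E i}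
        (trans (solve-for (Y 0F) (Y 1F) e₀) (solve 3 (λ a b ρ → (:- a) :* ρ := (:- a) :* ρ :+ (:- b) :* 𝟘) refl (Y 1F) (Y 3F) ρ))
        (solve 2 (λ a b → a := (:- a) :* (:- 𝟙) :+ (:- b) :* 𝟘) refl (Y 1F) (Y 3F))
        (trans (solve-for (Y 2F) (Y 3F) e₂) (solve 3 (λ a b ρ → (:- b) :* ρ := (:- a) :* 𝟘 :+ (:- b) :* ρ) refl (Y 1F) (Y 3F) ρ))
        (solve 2 (λ a b → b := (:- a) :* 𝟘 :+ (:- b) :* (:- 𝟙)) refl (Y 1F) (Y 3F))
        (trans e₄ (solve 2 (λ a b → 𝟘 := (:- a) :* 𝟘 :+ (:- b) :* 𝟘) refl (Y 1F) (Y 3F)))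

  -- In the situation below a point of the line with parameter t satisfies
  -- (G′(1,t,t²))ᵢ (w₀ + w₁ t) = 0 for all i, and G′(1,t,t²) ≠ 0.
  module OnePoint (K : Mat54) (rK : Rank4 K) {U W : V E 5} {ρ : E}
    (U≡ : ∀ i → U i ≡ vec5 ρ (-E 1E) 0E 0E 0E i) (W≡ : ∀ i → W i ≡ vec5 0E 0E ρ (-E 1E) 0E i)
    (G′ : Mat3) (nsG′ : Nonsingular G′) (w₀ w₁ : E) (w₁≢0 : w₁ ≢ 0E)
    (row₀ : ∀ v → (K ·4E v) 0F +E (K ·4E v) 1F *E ρ ≡ conv (G′ 0F) w₀ w₁ ∙ v)
    (row₁ : ∀ v → (K ·4E v) 2F +E (K ·4E v) 3F *E ρ ≡ conv (G′ 1F) w₀ w₁ ∙ v)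
    (row₂ : ∀ v → (K ·4E v) 4F ≡ conv (G′ 2F) w₀ w₁ ∙ v) where
    open OnLine U≡ W≡
    private
      s : E
      s = -E (w₀ *E w₁ ⁻¹[ w₁≢0 ])

      w₁*s : w₁ *E s ≡ -E w₀
      w₁*s = trans (solve 3 (λ a b i → b :* (:- (a :* i)) := :- (a :* (b :* i))) refl w₀ w₁ (w₁ ⁻¹[ w₁≢0 ]))
        (cong -E_ (trans (cong (w₀ *E_) (*-inverseʳ w₁≢0)) (*-identityʳ w₀)))

      ws≡0 : w₀ +E w₁ *E s ≡ 0E
      ws≡0 = trans (cong (w₀ +E_) w₁*s) (-‿inverseʳ w₀)

      root : ∀ t → w₀ +E w₁ *E t ≡ 0E → t ≡ s
      root t e = *-cancelˡ w₁≢0 (trans (x-y≡0⇒x≡y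
        (trans (solve 3 (λ a b t → b :* t :+ :- (:- a) := a :+ b :* t) refl w₀ w₁ t) e)) (sym w₁*s))

      X : V E 5
      X = K ·4E curve s

      X≢0 : NonZeroE X
      X≢0 z = 1≢0 (rank4E K rK (curve s) z 0F)

      X-row : ∀ i → conv (G′ i) w₀ w₁ ∙ curve s ≡ 0E
      X-row i = trans (conv-curve (G′ i) w₀ w₁ s) (*0 (sum3E (λ k → G′ i k *E pw s k)) ws≡0)

      scaled-rows : ∀ (Y : V E 5) c v → (∀ i → Y i ≡ c *E (K ·4E v) i) → c ≢ 0E →
        Y 0F +E Y 1F *E ρ ≡ 0E × Y 2F +E Y 3F *E ρ ≡ 0E × Y 4F ≡ 0E →
        ∀ i → conv (G′ i) w₀ w₁ ∙ v ≡ 0E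
      scaled-rows Y c v Y≡ c≢0 (e₀ , e₂ , e₄) = all₃ {λ i → conv (G′ i) w₀ w₁ ∙ v ≡ 0E}
        (trans (sym (row₀ v)) (unscale 0F 1F e₀))
        (trans (sym (row₁ v)) (unscale 2F 3F e₂))
        (trans (sym (row₂ v)) (*-cancelˡ-0 c≢0 (trans (sym (Y≡ 4F)) e₄)))
        where
        unscale : ∀ i j → Y i +E Y j *E ρ ≡ 0E → (K ·4E v) i +E (K ·4E v) j *E ρ ≡ 0E
        unscale i j e = *-cancelˡ-0 c≢0 (begin
          c *E ((K ·4E v) i +E (K ·4E v) j *E ρ)
            ≡⟨ solve 4 (λ c a b ρ → c :* (a :+ b :* ρ) := c :* a :+ c :* b :* ρ) refl c ((K ·4E v) i) ((K ·4E v) j) ρ ⟩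
          c *E (K ·4E v) i +E c *E (K ·4E v) j *E ρ
            ≡⟨ sym (cong₂ (λ a b → a +E b *E ρ) (Y≡ i) (Y≡ j)) ⟩
          Y i +E Y j *E ρ ≡⟨ e ⟩
          0E ∎)

      unique : ∀ Y → Star K Y → OnLineE U W Y → Y ∝E X
      unique Y (Y≢0 , inj₁ (t , c , c≢0 , Y≡)) on = c , c≢0 , λ i → trans (Y≡ i) (cong (λ t → c *E (K ·4E curve t) i) t≡s)
        where
        rows : ∀ i → sum3E (λ k → G′ i k *E pw t k) *E (w₀ +E w₁ *E t) ≡ 0E
        rows i = trans (sym (conv-curve (G′ i) w₀ w₁ t)) (scaled-rows Y c (curve t) Y≡ c≢0 (OnLineE⇒ Y on) i)
        t≡s : t ≡ s
        t≡s = by ((w₀ +E w₁ *E t) ≟ 0E)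
          where
          by : Dec (w₀ +E w₁ *E t ≡ 0E) → t ≡ s
          by (yes e) = root t e
          by (no nz) = contradiction (nsG′ (pw t)
            (λ i → *-cancelˡ-0 nz (trans (*-comm (w₀ +E w₁ *E t) (sum3E (λ k → G′ i k *E pw t k))) (rows i))) 0F) 1≢0
      -- At ∞ only the leading coefficients G′ᵢ₂ w₁ survive, so the last column of `G′` would
      -- vanish.
      unique Y (Y≢0 , inj₂ (c , c≢0 , Y≡)) on = contradiction (nsG′ (vec3 0E 0E 1E) G′e₂≡0 2F) 1≢0
        where
        G′e₂≡0 : ∀ i → sum3E (λ k → G′ i k *E vec3 0E 0E 1E k) ≡ 0E
        G′e₂≡0 i = trans (solve 3 (λ a b c → a :* 𝟘 :+ (b :* 𝟘 :+ c :* 𝟙) := c) refl (G′ i 0F) (G′ i 1F) (G′ i 2F))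
          (*-cancelˡ-0 w₁≢0 (trans (*-comm w₁ (G′ i 2F)) (trans (sym (conv-curve∞ (G′ i) w₀ w₁))
            (scaled-rows Y c curve∞ Y≡ c≢0 (OnLineE⇒ Y on) i))))

    exactly-one : ExactlyOnePoint (Star K) (OnLineE U W)
    exactly-one = X
      , (X≢0 , inj₁ (s , 1E , 1≢0 , λ i → sym (*-identityˡ (X i))))
      , ⇒OnLineE X X≢0 (trans (row₀ (curve s)) (X-row 0F)) (trans (row₁ (curve s)) (X-row 1F)) (trans (row₂ (curve s)) (X-row 2F))
      , unique

-- The cubic of PG(4,q) obtained from a parametrised conic

module ConicImage (F : Field) (q : ℕ) (t₀ t₁ : Field.Carrier F)
  (irr : Geometry.Irreducible F q t₀ t₁) where
  open Geometry F q t₀ t₁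
  open QuadraticExtension F q t₀ t₁ irr
  open FieldTheory 𝔼
  private module F = FieldTheory F
  open TwistedCubics F q t₀ t₁ irr
  open Special F q t₀ t₁ irr
  open ≡-Reasoning

  -- G maps PG(2,q) to the Baer subplane so that (1,t,t²) and (0,0,1) are sent to
  -- the points of the conic, the latter to the point at infinity.
  module _ (G : Mat3) (nsG : Nonsingular G) (G₂₂≡0 : G 2F 2F ≡ 0E)
    (w-independent : ∀ a b → ι a *E G 2F 0F +E ι b *E G 2F 1F ≡ 0E → a ≡ F.0# × b ≡ F.0#)
    where
    w₀ w₁ w̄₀ w̄₁ : E
    w₀ = G 2F 0F
    w₁ = G 2F 1F
    w̄₀ = σ w₀
    w̄₁ = σ w₁

    w₁≢0 : w₁ ≢ 0E
    w₁≢0 e = F.1≢0 (proj₂ (w-independent F.0# F.1# (trans (cong₂ _+E_ (zeroˡ w₀) (trans (*-identityˡ w₁) e)) (+-identityˡ 0E))))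

    R : Fin 3 → V E 4
    R i = conv (G i) w̄₀ w̄₁

    -- The coefficients of ww̄ are two norms and a trace; `G₂₂≡0` removes the cubic one.
    R₂-rational : ∀ j → proj₂ (R 2F j) ≡ F.0#
    R₂-rational = all₄ {λ j → proj₂ (R 2F j) ≡ F.0#}
      (norm-rational w₀)
      (trace-rational w₀ w₁)
      (trans (cong proj₂ (+0 (w₁ *E w̄₁) (0* w̄₀ G₂₂≡0))) (norm-rational w₁))
      (cong proj₂ (0* w̄₁ G₂₂≡0))

    K : Mat54
    K 0F j = proj₁ (R 0F j)
    K 1F j = proj₂ (R 0F j)
    K 2F j = proj₁ (R 1F j)
    K 3F j = proj₂ (R 1F j)
    K 4F j = proj₁ (R 2F j)

    private
      combine : ∀ i j ρ (v : V E 4) →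
        (K ·4E v) i +E (K ·4E v) j *E ρ ≡ (λ k → ι (K i k) +E ι (K j k) *E ρ) ∙ v
      combine i j ρ v = solve 13 (λ ρ a₀ a₁ a₂ a₃ b₀ b₁ b₂ b₃ v₀ v₁ v₂ v₃ →
          a₀ :* v₀ :+ (a₁ :* v₁ :+ (a₂ :* v₂ :+ a₃ :* v₃)) :+ (b₀ :* v₀ :+ (b₁ :* v₁ :+ (b₂ :* v₂ :+ b₃ :* v₃))) :* ρ
          := (a₀ :+ b₀ :* ρ) :* v₀ :+ ((a₁ :+ b₁ :* ρ) :* v₁ :+ ((a₂ :+ b₂ :* ρ) :* v₂ :+ (a₃ :+ b₃ :* ρ) :* v₃))) refl
        ρ (ι (K i 0F)) (ι (K i 1F)) (ι (K i 2F)) (ι (K i 3F)) (ι (K j 0F)) (ι (K j 1F)) (ι (K j 2F)) (ι (K j 3F))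
        (v 0F) (v 1F) (v 2F) (v 3F)

      R̄ : Fin 3 → V E 4
      R̄ i = conv (λ k → σ (G i k)) w₀ w₁

      σR : ∀ i j → σ (R i j) ≡ R̄ i j
      σR i j = trans (conv-σ (G i) w̄₀ w̄₁ j) (cong₂ (λ a b → conv (λ k → σ (G i k)) a b j) (σ-σ w₀) (σ-σ w₁))

    row₀ : ∀ v → (K ·4E v) 0F +E (K ·4E v) 1F *E τ ≡ R 0F ∙ v
    row₀ v = trans (combine 0F 1F τ v) (∙-congˡ v (λ j → components (R 0F j)))

    row₁ : ∀ v → (K ·4E v) 2F +E (K ·4E v) 3F *E τ ≡ R 1F ∙ v
    row₁ v = trans (combine 2F 3F τ v) (∙-congˡ v (λ j → components (R 1F j)))

    row₂ : ∀ v → (K ·4E v) 4F ≡ R 2F ∙ v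
    row₂ v = ∙-congˡ {λ j → ι (K 4F j)} {R 2F} v (λ j → ι-proj₁ (R₂-rational j))

    row̄₀ : ∀ v → (K ·4E v) 0F +E (K ·4E v) 1F *E σ τ ≡ R̄ 0F ∙ v
    row̄₀ v = trans (combine 0F 1F (σ τ) v) (∙-congˡ v (λ j → trans (components-σ (R 0F j)) (σR 0F j)))

    row̄₁ : ∀ v → (K ·4E v) 2F +E (K ·4E v) 3F *E σ τ ≡ R̄ 1F ∙ v
    row̄₁ v = trans (combine 2F 3F (σ τ) v) (∙-congˡ v (λ j → trans (components-σ (R 1F j)) (σR 1F j)))

    row̄₂ : ∀ v → (K ·4E v) 4F ≡ R̄ 2F ∙ v
    row̄₂ v = ∙-congˡ {λ j → ι (K 4F j)} {R̄ 2F} v (λ j → trans (sym (σ-ι (K 4F j))) (trans (cong σ (ι-proj₁ (R₂-rational j))) (σR 2F j)))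

    -- A kernel vector v of `K` puts the vector with entries w̄₀vⱼ + w̄₁vⱼ₊₁ into the kernel of `G`.
    -- So these entries vanish, and their conjugates are relations over F between w₀ and w₁.
    rank4 : Rank4 K
    rank4 v Kv≡0 = all₄ {λ j → v j ≡ F.0#}
      (proj₁ (pair 0F 1F (z 0F))) (proj₁ (pair 1F 2F (z 1F))) (proj₁ (pair 2F 3F (z 2F))) (proj₂ (pair 2F 3F (z 2F)))
      where
      ιv : V E 4
      ιv j = ι (v j)
      KE≡0 : ∀ i → (K ·4E ιv) i ≡ 0E
      KE≡0 i = trans (·4E-ι K v i) (cong ι (Kv≡0 i))
      R≡0 : ∀ i → R i ∙ ιv ≡ 0E
      R≡0 = all₃ {λ i → R i ∙ ιv ≡ 0E}
        (trans (sym (row₀ ιv)) (+-≡0 (KE≡0 0F) (0* τ (KE≡0 1F))))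
        (trans (sym (row₁ ιv)) (+-≡0 (KE≡0 2F) (0* τ (KE≡0 3F))))
        (trans (sym (row₂ ιv)) (KE≡0 4F))
      z : ∀ k → vec3 (w̄₀ *E ιv 0F +E w̄₁ *E ιv 1F) (w̄₀ *E ιv 1F +E w̄₁ *E ιv 2F) (w̄₀ *E ιv 2F +E w̄₁ *E ιv 3F) k ≡ 0E
      z = nsG (vec3 (w̄₀ *E ιv 0F +E w̄₁ *E ιv 1F) (w̄₀ *E ιv 1F +E w̄₁ *E ιv 2F) (w̄₀ *E ιv 2F +E w̄₁ *E ιv 3F))
        (λ i → trans (sym (conv-∙ (G i) w̄₀ w̄₁ ιv)) (R≡0 i))
      pair : ∀ i j → w̄₀ *E ιv i +E w̄₁ *E ιv j ≡ 0E → v i ≡ F.0# × v j ≡ F.0#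
      pair i j e = w-independent (v i) (v j) (begin
        ι (v i) *E w₀ +E ι (v j) *E w₁           ≡⟨ cong₂ _+E_ (conj (v i) w₀) (conj (v j) w₁) ⟩
        σ (w̄₀ *E ιv i) +E σ (w̄₁ *E ιv j)         ≡⟨ sym (σ-+ (w̄₀ *E ιv i) (w̄₁ *E ιv j)) ⟩
        σ (w̄₀ *E ιv i +E w̄₁ *E ιv j)             ≡⟨ trans (cong σ e) σ-0 ⟩
        0E                                       ∎)
        where
        conj : ∀ a w → ι a *E w ≡ σ (σ w *E ι a)
        conj a w = trans (*-comm (ι a) w) (sym (trans (σ-* (σ w) (ι a)) (cong₂ _*E_ (σ-σ w) (σ-ι a))))

    nsG̅ : Nonsingular (λ i j → σ (G i j))
    nsG̅ v e j = trans (sym (σ-σ (v j))) (trans (cong σ (nsG (λ j → σ (v j)) Gσv≡0 j)) σ-0)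
      where
      term : ∀ i j → G i j *E σ (v j) ≡ σ (σ (G i j) *E v j)
      term i j = sym (trans (σ-* (σ (G i j)) (v j)) (cong (_*E σ (v j)) (σ-σ (G i j))))
      Gσv≡0 : ∀ i → (G ·3 (λ j → σ (v j))) i ≡ 0E
      Gσv≡0 i = begin
        (G ·3 (λ j → σ (v j))) i   ≡⟨ cong₂ _+E_ (term i 0F) (cong₂ _+E_ (term i 1F) (term i 2F)) ⟩
        σ (s 0F) +E (σ (s 1F) +E σ (s 2F)) ≡⟨ cong (σ (s 0F) +E_) (sym (σ-+ (s 1F) (s 2F))) ⟩
        σ (s 0F) +E σ (s 1F +E s 2F) ≡⟨ sym (σ-+ (s 0F) (s 1F +E s 2F)) ⟩
        σ (s 0F +E (s 1F +E s 2F))   ≡⟨ trans (cong σ (e i)) σ-0 ⟩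
        0E ∎
        where
        s : V E 3
        s j = σ (G i j) *E v j

    module _ {U W : V E 5} where
      -- A₀ and A₁ contain τ^q = τ̄, so the equations of g select the conjugated rows, whose linear
      -- factor is w; those of g^q below select the rows themselves, with factor w̄.
      meets-g : (∀ i → U i ≡ vec5 (σ τ) (-E 1E) 0E 0E 0E i) → (∀ i → W i ≡ vec5 0E 0E (σ τ) (-E 1E) 0E i) →
        ExactlyOnePoint (Star K) (OnLineE U W)
      meets-g U≡ W≡ = OnePoint.exactly-one K rank4 U≡ W≡ (λ i j → σ (G i j)) nsG̅ w₀ w₁ w₁≢0 row̄₀ row̄₁ row̄₂

      meets-gq : (∀ i → U i ≡ vec5 τ (-E 1E) 0E 0E 0E i) → (∀ i → W i ≡ vec5 0E 0E τ (-E 1E) 0E i) →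
        ExactlyOnePoint (Star K) (OnLineE U W)
      meets-gq U≡ W≡ = OnePoint.exactly-one K rank4 U≡ W≡ G nsG w̄₀ w̄₁ (σ-≢0 w₁≢0) row₀ row₁ row₂

    P : V F.Carrier 5
    P = K ·4 vec4 F.0# F.0# F.0# F.1#

    P≡ : ∀ i → P i ≡ K i 3F
    P≡ i = F.solve 4 (λ a b c d → a F.:* F.𝟘 F.:+ (b F.:* F.𝟘 F.:+ (c F.:* F.𝟘 F.:+ d F.:* F.𝟙)) F.:= d) refl
      (K i 0F) (K i 1F) (K i 2F) (K i 3F)

    P≢0 : NonZero P
    P≢0 z = F.1≢0 (rank4 (vec4 F.0# F.0# F.0# F.1#) z 3F)

    -- P consists of the F-components of g₀w̄₁ and g₁w̄₁. For g₁ ≠ 0 and d = g₀/g₁ these elements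
    -- are d(α + βτ) and α + βτ, and the two generators of the spread line are the images of the
    -- multiples of (d,1) by 1 and by τ.
    on-spread-line : ∀ T → (Σ E λ c → c ≢ 0E × (∀ i → T i ≡ c *E G i 2F)) → OnSpreadLine T P
    on-spread-line T (c , c≢0 , T≡) = P≢0 , by (G 1F 2F ≟ 0E)
      where
      g₀ g₁ : E
      g₀ = G 0F 2F
      g₁ = G 1F 2F
      T₂≡0 : T 2F ≡ 0E
      T₂≡0 = trans (T≡ 2F) (*0 c G₂₂≡0)
      P₄≡0 : P 4F ≡ F.0#
      P₄≡0 = trans (P≡ 4F) (cong proj₁ (0* w̄₁ G₂₂≡0))
      α β : F.Carrier
      by : Dec (g₁ ≡ 0E) → _
      α = proj₁ (R 1F 3F)
      β = proj₂ (R 1F 3F)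
      by (no g₁≢0) = inj₁ (d₀ , d₁ , (c *E g₁ , *-≢0 c≢0 g₁≢0 , T∝) , α , β , P-on)
        where
        d : E
        d = g₀ *E g₁ ⁻¹[ g₁≢0 ]
        d₀ d₁ : F.Carrier
        d₀ = proj₁ d
        d₁ = proj₂ d
        g₁d : g₁ *E d ≡ g₀
        g₁d = trans (solve 3 (λ a b i → b :* (a :* i) := a :* (b :* i)) refl g₀ g₁ (g₁ ⁻¹[ g₁≢0 ]))
          (trans (cong (g₀ *E_) (*-inverseʳ g₁≢0)) (*-identityʳ g₀))
        T∝ : ∀ i → T i ≡ c *E g₁ *E vec3 d 1E 0E i
        T∝ = all₃ {λ i → T i ≡ c *E g₁ *E vec3 d 1E 0E i}
          (trans (T≡ 0F) (sym (trans (*-assoc c g₁ d) (cong (c *E_) g₁d))))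
          (trans (T≡ 1F) (sym (*-identityʳ (c *E g₁))))
          (trans T₂≡0 (sym (zeroʳ (c *E g₁))))
        R₀₃ : R 0F 3F ≡ d *E (α , β)
        R₀₃ = trans (cong (_*E w̄₁) (sym g₁d)) (solve 3 (λ a b c → a :* b :* c := b :* (a :* c)) refl g₁ d w̄₁)
        P-on : ∀ i → P i ≡ α F.* vec5 d₀ d₁ F.1# F.0# F.0# i F.+ β F.* vec5 (t₀ F.* d₁) (d₀ F.+ t₁ F.* d₁) F.0# F.1# F.0# i
        P-on = all₅ {λ i → P i ≡ α F.* vec5 d₀ d₁ F.1# F.0# F.0# i F.+ β F.* vec5 (t₀ F.* d₁) (d₀ F.+ t₁ F.* d₁) F.0# F.1# F.0# i}
          (trans (P≡ 0F) (trans (cong proj₁ R₀₃)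
            (F.solve 5 (λ a b d e s → d F.:* a F.:+ e F.:* b F.:* s F.:= a F.:* d F.:+ b F.:* (s F.:* e)) refl α β d₀ d₁ t₀)))
          (trans (P≡ 1F) (trans (cong proj₂ R₀₃)
            (F.solve 5 (λ a b d e t → d F.:* b F.:+ e F.:* a F.:+ e F.:* b F.:* t F.:= a F.:* e F.:+ b F.:* (d F.:+ t F.:* e)) refl α β d₀ d₁ t₁)))
          (trans (P≡ 2F) (F.solve 2 (λ a b → a F.:= a F.:* F.𝟙 F.:+ b F.:* F.𝟘) refl α β))
          (trans (P≡ 3F) (F.solve 2 (λ a b → b F.:= a F.:* F.𝟘 F.:+ b F.:* F.𝟙) refl α β))
          (trans P₄≡0 (F.solve 2 (λ a b → F.𝟘 F.:= a F.:* F.𝟘 F.:+ b F.:* F.𝟘) refl α β))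
      by (yes g₁≡0) = inj₂ ((c *E g₀ , *-≢0 c≢0 g₀≢0 , T∝) , γ , δ , P-on)
        where
        γ δ : F.Carrier
        γ = proj₁ (R 0F 3F)
        δ = proj₂ (R 0F 3F)
        g₀≢0 : g₀ ≢ 0E
        g₀≢0 e = 1≢0 (nsG (vec3 0E 0E 1E) (all₃ {λ i → (G ·3 vec3 0E 0E 1E) i ≡ 0E}
          (trans (last 0F) e) (trans (last 1F) g₁≡0) (trans (last 2F) G₂₂≡0)) 2F)
          where
          last : ∀ i → (G ·3 vec3 0E 0E 1E) i ≡ G i 2F
          last i = solve 3 (λ a b c → a :* 𝟘 :+ (b :* 𝟘 :+ c :* 𝟙) := c) refl (G i 0F) (G i 1F) (G i 2F)
        T∝ : ∀ i → T i ≡ c *E g₀ *E vec3 1E 0E 0E i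
        T∝ = all₃ {λ i → T i ≡ c *E g₀ *E vec3 1E 0E 0E i}
          (trans (T≡ 0F) (sym (*-identityʳ (c *E g₀))))
          (trans (T≡ 1F) (trans (*0 c g₁≡0) (sym (zeroʳ (c *E g₀)))))
          (trans T₂≡0 (sym (zeroʳ (c *E g₀))))
        R₁₃≡0 : R 1F 3F ≡ 0E
        R₁₃≡0 = 0* w̄₁ g₁≡0
        P-on : ∀ i → P i ≡ γ F.* vec5 F.1# F.0# F.0# F.0# F.0# i F.+ δ F.* vec5 F.0# F.1# F.0# F.0# F.0# i
        P-on = all₅ {λ i → P i ≡ γ F.* vec5 F.1# F.0# F.0# F.0# F.0# i F.+ δ F.* vec5 F.0# F.1# F.0# F.0# F.0# i}
          (trans (P≡ 0F) (F.solve 2 (λ a b → a F.:= a F.:* F.𝟙 F.:+ b F.:* F.𝟘) refl γ δ))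
          (trans (P≡ 1F) (F.solve 2 (λ a b → b F.:= a F.:* F.𝟘 F.:+ b F.:* F.𝟙) refl γ δ))
          (trans (trans (P≡ 2F) (cong proj₁ R₁₃≡0)) zz)
          (trans (trans (P≡ 3F) (cong proj₂ R₁₃≡0)) zz)
          (trans P₄≡0 zz)
          where
          zz : F.0# ≡ γ F.* F.0# F.+ δ F.* F.0#
          zz = F.solve 2 (λ a b → F.𝟘 F.:= a F.:* F.𝟘 F.:+ b F.:* F.𝟘) refl γ δ

    private
      w : F.Carrier → E
      w t = w₀ +E w₁ *E ι t

      -- A zero would be the relation 1·w₀ + t·w₁ = 0 over F. Hence every finite parameter in F
      -- gives an affine point.
      w≢0 : ∀ t → w t ≢ 0E
      w≢0 t e = F.1≢0 (proj₁ (w-independent F.1# t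
        (trans (cong₂ _+E_ (*-identityˡ w₀) (*-comm (ι t) w₁)) e)))

      n : F.Carrier → F.Carrier
      n t = norm (w t)

      Gpw : F.Carrier → V E 3
      Gpw t = G ·3 pw (ι t)

      Gpw₂ : ∀ t → Gpw t 2F ≡ w t
      Gpw₂ t = trans (cong (λ z → w₀ *E 1E +E (w₁ *E ι t +E z *E (ι t *E ι t))) G₂₂≡0)
        (solve 3 (λ a b t → a :* 𝟙 :+ (b :* t :+ 𝟘 :* (t :* t)) := a :+ b :* t) refl w₀ w₁ (ι t))

      w̄ : ∀ t → w̄₀ +E w̄₁ *E ι t ≡ σ (w t)
      w̄ t = sym (trans (σ-+ w₀ (w₁ *E ι t)) (cong (w̄₀ +E_) (trans (σ-* w₁ (ι t)) (cong (w̄₁ *E_) (σ-ι t)))))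

      R-curve : ∀ i t → R i ∙ curve (ι t) ≡ Gpw t i *E σ (w t)
      R-curve i t = trans (conv-curve (G i) w̄₀ w̄₁ (ι t)) (cong (Gpw t i *E_) (w̄ t))

      K-ι : ∀ t i → (K ·4E curve (ι t)) i ≡ ι ((K ·4 curveF t) i)
      K-ι t i = trans (·4E-cong K (curve-ι t) i) (·4E-ι K (curveF t) i)

      K-pair : ∀ t i j k → (K ·4E curve (ι t)) i +E (K ·4E curve (ι t)) j *E τ ≡ R k ∙ curve (ι t) →
        ((K ·4 curveF t) i , (K ·4 curveF t) j) ≡ Gpw t k *E σ (w t)
      K-pair t i j k e = begin
        ((K ·4 curveF t) i , (K ·4 curveF t) j)     ≡⟨ sym (components ((K ·4 curveF t) i , (K ·4 curveF t) j)) ⟩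
        ι ((K ·4 curveF t) i) +E ι ((K ·4 curveF t) j) *E τ
          ≡⟨ sym (cong₂ (λ a b → a +E b *E τ) (K-ι t i) (K-ι t j)) ⟩
        (K ·4E curve (ι t)) i +E (K ·4E curve (ι t)) j *E τ ≡⟨ e ⟩
        R k ∙ curve (ι t)                           ≡⟨ R-curve k t ⟩
        Gpw t k *E σ (w t)                          ∎

      -- Multiplying (X, Y, 1) by the norm ww̄ clears the denominator w of X and Y; as the norm lies
      -- in F, the point of PG(4,q) stays the same.
      K-curve : ∀ t X Y → X *E w t ≡ Gpw t 0F → Y *E w t ≡ Gpw t 1F →
        ∀ i → (K ·4 curveF t) i ≡ n t F.* vec5 (proj₁ X) (proj₂ X) (proj₁ Y) (proj₂ Y) F.1# i
      K-curve t X Y eX eY = all₅ {λ i → (K ·4 curveF t) i ≡ n t F.* vec5 (proj₁ X) (proj₂ X) (proj₁ Y) (proj₂ Y) F.1# i}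
        (cong proj₁ (XY X 0F 1F 0F eX (row₀ (curve (ι t))))) (cong proj₂ (XY X 0F 1F 0F eX (row₀ (curve (ι t)))))
        (cong proj₁ (XY Y 2F 3F 1F eY (row₁ (curve (ι t))))) (cong proj₂ (XY Y 2F 3F 1F eY (row₁ (curve (ι t)))))
        (trans (ι-injective last) (sym (F.*-identityʳ (n t))))
        where
        XY : ∀ X i j k → X *E w t ≡ Gpw t k →
          (K ·4E curve (ι t)) i +E (K ·4E curve (ι t)) j *E τ ≡ R k ∙ curve (ι t) →
          ((K ·4 curveF t) i , (K ·4 curveF t) j) ≡ (n t F.* proj₁ X , n t F.* proj₂ X)
        XY X i j k e r = begin
          ((K ·4 curveF t) i , (K ·4 curveF t) j)   ≡⟨ K-pair t i j k r ⟩
          Gpw t k *E σ (w t)                        ≡⟨ cong (_*E σ (w t)) (sym e) ⟩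
          X *E w t *E σ (w t)                       ≡⟨ *-assoc X (w t) (σ (w t)) ⟩
          X *E (w t *E σ (w t))                     ≡⟨ cong (X *E_) (x*σx (w t)) ⟩
          X *E ι (n t)                              ≡⟨ trans (*-comm X (ι (n t))) (ι*E (n t) X) ⟩
          (n t F.* proj₁ X , n t F.* proj₂ X)       ∎
        last : ι ((K ·4 curveF t) 4F) ≡ ι (n t)
        last = begin
          ι ((K ·4 curveF t) 4F)                    ≡⟨ sym (K-ι t 4F) ⟩
          (K ·4E curve (ι t)) 4F                    ≡⟨ row₂ (curve (ι t)) ⟩
          R 2F ∙ curve (ι t)                        ≡⟨ R-curve 2F t ⟩
          Gpw t 2F *E σ (w t)                       ≡⟨ cong (_*E σ (w t)) (Gpw₂ t) ⟩
          w t *E σ (w t)                            ≡⟨ x*σx (w t) ⟩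
          ι (n t)                                   ∎

      ∝-step : ∀ {x y z : V F.Carrier 5} → x ∝ y → (Σ F.Carrier λ c → c ≢ F.0# × (∀ i → z i ≡ c F.* y i)) → x ∝ z
      ∝-step {x} {y} {z} (a , a≢0 , x≡) (c , c≢0 , z≡) = a F.* c F.⁻¹[ c≢0 ] , F.*-≢0 a≢0 (F.⁻¹-≢0 c≢0) , λ i →
        trans (x≡ i) (sym (trans (cong (a F.* c F.⁻¹[ c≢0 ] F.*_) (z≡ i))
          (trans (F.solve 4 (λ a i c y → a F.:* i F.:* (c F.:* y) F.:= a F.:* y F.:* (c F.:* i)) refl a (c F.⁻¹[ c≢0 ]) c (y i))
            (trans (cong (a F.* y i F.*_) (F.*-inverseʳ c≢0)) (F.*-identityʳ _)))))

      ∝-step′ : ∀ {x y z : V F.Carrier 5} → x ∝ z → (Σ F.Carrier λ c → c ≢ F.0# × (∀ i → z i ≡ c F.* y i)) → x ∝ y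
      ∝-step′ (a , a≢0 , x≡) (c , c≢0 , z≡) = a F.* c , F.*-≢0 a≢0 c≢0 , λ i →
        trans (x≡ i) (trans (cong (a F.*_) (z≡ i)) (sym (F.*-assoc a c _)))

    module _ (M : Mat3) (Q : QuadForm)
      (conic⇒ : ∀ X → ConicPoint M Q X →
        (Σ F.Carrier λ t → X ∝E (G ·3 pw (ι t))) ⊎ X ∝E (λ i → G i 2F))
      (⇒conic : ∀ X → NonZeroE X → ∀ t → X ∝E (G ·3 pw (ι t)) → ConicPoint M Q X)
      where

      private
        K-point : ∀ t X Y → X *E w t ≡ Gpw t 0F → Y *E w t ≡ Gpw t 1F →
          Σ F.Carrier λ c → c ≢ F.0# × (∀ i → (K ·4 curveF t) i ≡ c F.* vec5 (proj₁ X) (proj₂ X) (proj₁ Y) (proj₂ Y) F.1# i)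
        K-point t X Y eX eY = n t , norm-≢0 (w≢0 t) , K-curve t X Y eX eY

        affine⇒curve : ∀ x → AffineImage M Q x → Σ F.Carrier λ t → x ∝ (K ·4 curveF t)
        affine⇒curve x (x₀ , x₁ , y₀ , y₁ , x∝ , conic) = by (conic⇒ (vec3 X Y 1E) conic)
          where
          X Y : E
          X = x₀ , x₁
          Y = y₀ , y₁
          by : (Σ F.Carrier λ t → vec3 X Y 1E ∝E (G ·3 pw (ι t))) ⊎ vec3 X Y 1E ∝E (λ i → G i 2F) → _
          by (inj₂ (c , _ , e)) = contradiction (trans (e 2F) (*0 c G₂₂≡0)) 1≢0
          by (inj₁ (t , c , _ , e)) = t , ∝-step x∝ (K-point t X Y (eq X 0F (e 0F)) (eq Y 1F (e 1F)))
            where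
            cw : 1E ≡ c *E w t
            cw = trans (e 2F) (cong (c *E_) (Gpw₂ t))
            eq : ∀ Z i → Z ≡ c *E Gpw t i → Z *E w t ≡ Gpw t i
            eq Z i e = trans (cong (_*E w t) e) (trans
              (solve 3 (λ c g w → c :* g :* w := c :* w :* g) refl c (Gpw t i) (w t))
              (trans (cong (_*E Gpw t i) (sym cw)) (*-identityˡ (Gpw t i))))

        curve⇒affine : ∀ x t → x ∝ (K ·4 curveF t) → AffineImage M Q x
        curve⇒affine x t x∝ = proj₁ X , proj₂ X , proj₁ Y , proj₂ Y , ∝-step′ x∝ (K-point t X Y (eq 0F) (eq 1F)) ,
          ⇒conic (vec3 X Y 1E) (λ z → 1≢0 (z 2F)) t (w⁻¹ , ⁻¹-≢0 (w≢0 t) ,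
            all₃ {λ i → vec3 X Y 1E i ≡ w⁻¹ *E Gpw t i} (*-comm (Gpw t 0F) w⁻¹) (*-comm (Gpw t 1F) w⁻¹)
              (trans (sym (*-inverseʳ (w≢0 t))) (trans (*-comm (w t) w⁻¹) (cong (w⁻¹ *E_) (sym (Gpw₂ t))))))
          where
          w⁻¹ X Y : E
          w⁻¹ = w t ⁻¹[ w≢0 t ]
          X = Gpw t 0F *E w⁻¹
          Y = Gpw t 1F *E w⁻¹
          eq : ∀ i → Gpw t i *E w⁻¹ *E w t ≡ Gpw t i
          eq i = trans (solve 3 (λ a i w → a :* i :* w := a :* (w :* i)) refl (Gpw t i) w⁻¹ (w t))
            (trans (cong (Gpw t i *E_) (*-inverseʳ (w≢0 t))) (*-identityʳ (Gpw t i)))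

      parametrizes : Parametrizes K (CurveWith M Q P)
      parametrizes x x≢0 = mk⇔ to from
        where
        to : CurveWith M Q P x → _
        to (_ , inj₁ a) = inj₁ (affine⇒curve x a)
        to (_ , inj₂ b) = inj₂ b
        from : (Σ F.Carrier λ t → x ∝ (K ·4 curveF t)) ⊎ x ∝ P → CurveWith M Q P x
        from (inj₁ (t , b)) = x≢0 , inj₁ (curve⇒affine x t b)
        from (inj₂ b)       = x≢0 , inj₂ b

-- Prime powers above 5

prime∣^ : ∀ {r} p k → Prime r → r ∣ p ℕ.^ k → r ∣ p
prime∣^ p zero    r-prime d = contradiction (subst Prime (∣1⇒≡1 d) r-prime) ¬prime[1]
prime∣^ p (suc k) r-prime d with euclidsLemma p (p ℕ.^ k) r-prime d
... | inj₁ e = e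
... | inj₂ e = prime∣^ p k r-prime e

prime∣prime : ∀ {r p} → Prime r → Prime p → r ∣ p → r ≡ p
prime∣prime r-prime p-prime d with prime⇒irreducible p-prime d
... | inj₁ refl = contradiction r-prime ¬prime[1]
... | inj₂ e    = e

-- Both 2 and 3 would have to equal the base p.
6-not-prime-power : ¬ IsPrimePower 6
6-not-prime-power (p , k , p-prime , _ , 6≡p^k) = contradiction (trans (≡p 2-prime (divides 3 refl)) (sym (≡p 3-prime (divides 2 refl)))) λ ()
  where
  2-prime : Prime 2
  2-prime = from-yes (prime? 2)
  3-prime : Prime 3
  3-prime = from-yes (prime? 3)
  ≡p : ∀ {r} → Prime r → r ∣ 6 → r ≡ p
  ≡p r-prime d = prime∣prime r-prime p-prime (prime∣^ p k r-prime (subst (_ ∣_) 6≡p^k d))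

prime-power>5⇒≥7 : ∀ {q} → IsPrimePower q → 5 < q → 7 ≤ q
prime-power>5⇒≥7 pp 5<q = ℕₚ.≤∧≢⇒< 5<q λ { refl → 6-not-prime-power pp }

-- Conics in a tangent Baer subplane and the main result

module _ (F : Field) (q : ℕ) (t₀ t₁ : Field.Carrier F)
  (irr : Geometry.Irreducible F q t₀ t₁) where
  open Geometry F q t₀ t₁
  open QuadraticExtension F q t₀ t₁ irr
  open FieldTheory 𝔼
  private module F = FieldTheory F
  open Conics F q t₀ t₁
  open TwistedCubics F q t₀ t₁ irr
  open Special F q t₀ t₁ irr
  open ConicImage F q t₀ t₁ irr
  open ≡-Reasoning

  module BaerConic (M : Mat3) (nsM : Nonsingular M) (T : V E 3) (T≢0 : NonZeroE T) (T-on : OnLinf T)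
    (T-only : ∀ X → BaerPoint M X → OnLinf X → X ∝E T) (Q : QuadForm)
    (v₀ : V F.Carrier 3) (T∝Mv₀ : T ∝E (M ·3 (λ i → ι (v₀ i)))) (param : ConicParam Q v₀) where
    open ConicParam param

    curveC : V F.Carrier 3 → V F.Carrier 3
    curveC u i = C i 0F F.* u 0F F.+ (C i 1F F.* u 1F F.+ C i 2F F.* u 2F)

    pwF : F.Carrier → V F.Carrier 3
    pwF t = vec3 F.1# t (t F.* t)

    CE : V E 3 → V E 3
    CE u i = sum3E (λ j → ι (C i j) *E u j)

    G : Mat3
    G i j = (M ·3 (λ k → ι (C k j))) i

    ·3-cong : ∀ (N : Mat3) {u v : V E 3} → (∀ j → u j ≡ v j) → ∀ i → (N ·3 u) i ≡ (N ·3 v) i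
    ·3-cong N e i = cong₂ _+E_ (cong (N i 0F *E_) (e 0F)) (cong₂ _+E_ (cong (N i 1F *E_) (e 1F)) (cong (N i 2F *E_) (e 2F)))

    ·3-scale : ∀ (N : Mat3) c (u : V E 3) i → (N ·3 (λ j → c *E u j)) i ≡ c *E (N ·3 u) i
    ·3-scale N c u i = solve 7 (λ c a₀ a₁ a₂ u₀ u₁ u₂ →
        a₀ :* (c :* u₀) :+ (a₁ :* (c :* u₁) :+ a₂ :* (c :* u₂)) := c :* (a₀ :* u₀ :+ (a₁ :* u₁ :+ a₂ :* u₂)))
      refl c (N i 0F) (N i 1F) (N i 2F) (u 0F) (u 1F) (u 2F)

    G·3 : ∀ u i → (G ·3 u) i ≡ (M ·3 CE u) i
    G·3 u i = solve 15 (λ m₀ m₁ m₂ a₀ a₁ a₂ b₀ b₁ b₂ c₀ c₁ c₂ u₀ u₁ u₂ →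
        (m₀ :* a₀ :+ (m₁ :* b₀ :+ m₂ :* c₀)) :* u₀ :+ ((m₀ :* a₁ :+ (m₁ :* b₁ :+ m₂ :* c₁)) :* u₁ :+ (m₀ :* a₂ :+ (m₁ :* b₂ :+ m₂ :* c₂)) :* u₂)
        := m₀ :* (a₀ :* u₀ :+ (a₁ :* u₁ :+ a₂ :* u₂)) :+ (m₁ :* (b₀ :* u₀ :+ (b₁ :* u₁ :+ b₂ :* u₂)) :+ m₂ :* (c₀ :* u₀ :+ (c₁ :* u₁ :+ c₂ :* u₂))))
      refl (M i 0F) (M i 1F) (M i 2F) (ι (C 0F 0F)) (ι (C 0F 1F)) (ι (C 0F 2F)) (ι (C 1F 0F)) (ι (C 1F 1F)) (ι (C 1F 2F))
        (ι (C 2F 0F)) (ι (C 2F 1F)) (ι (C 2F 2F)) (u 0F) (u 1F) (u 2F)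

    CE-components : ∀ u i → CE u i ≡ (curveC (λ j → proj₁ (u j)) i , curveC (λ j → proj₂ (u j)) i)
    CE-components u i = cong₂ _+E_ (ι*E (C i 0F) (u 0F)) (cong₂ _+E_ (ι*E (C i 1F) (u 1F)) (ι*E (C i 2F) (u 2F)))

    CE-ι : ∀ u i → CE (λ j → ι (u j)) i ≡ ι (curveC u i)
    CE-ι u i = trans (CE-components (λ j → ι (u j)) i) (cong (curveC u i ,_)
      (F.solve 3 (λ a b c → a F.:* F.𝟘 F.:+ (b F.:* F.𝟘 F.:+ c F.:* F.𝟘) F.:= F.𝟘) refl (C i 0F) (C i 1F) (C i 2F)))

    nsG : Nonsingular G
    nsG u e j = cong₂ _,_ (independent (λ j → proj₁ (u j)) (λ i → cong proj₁ (CE≡0 i)) j)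
                          (independent (λ j → proj₂ (u j)) (λ i → cong proj₂ (CE≡0 i)) j)
      where
      CE≡0 : ∀ i → (curveC (λ j → proj₁ (u j)) i , curveC (λ j → proj₂ (u j)) i) ≡ 0E
      CE≡0 i = trans (sym (CE-components u i)) (nsM (CE u) (λ i → trans (sym (G·3 u i)) (e i)) i)

    k : F.Carrier
    k = proj₁ at-∞
    k≢0 : k ≢ F.0#
    k≢0 = proj₁ (proj₂ at-∞)

    Mv₀ : V E 3
    Mv₀ = M ·3 (λ i → ι (v₀ i))

    G₂≡ : ∀ i → G i 2F ≡ ι k *E Mv₀ i
    G₂≡ i = trans (·3-cong M (λ j → trans (cong ι (proj₂ (proj₂ at-∞) j)) (ι-* k (v₀ j))) i) (·3-scale M (ι k) (λ i → ι (v₀ i)) i)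

    T∝G₂ : T ∝E (λ i → G i 2F)
    T∝G₂ = by T∝Mv₀
      where
      by : T ∝E Mv₀ → T ∝E (λ i → G i 2F)
      by (c , c≢0 , e) = c *E ι k⁻¹ , *-≢0 c≢0 (ι-≢0 (F.⁻¹-≢0 k≢0)) , λ i → trans (e i) (sym (begin
        c *E ι k⁻¹ *E G i 2F                ≡⟨ cong (c *E ι k⁻¹ *E_) (G₂≡ i) ⟩
        c *E ι k⁻¹ *E (ι k *E Mv₀ i)        ≡⟨ solve 4 (λ c i k m → c :* i :* (k :* m) := c :* m :* (k :* i)) refl c (ι k⁻¹) (ι k) (Mv₀ i) ⟩
        c *E Mv₀ i *E (ι k *E ι k⁻¹)        ≡⟨ cong (c *E Mv₀ i *E_) (trans (sym (ι-* k k⁻¹)) (cong ι (F.*-inverseʳ k≢0))) ⟩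
        c *E Mv₀ i *E 1E                    ≡⟨ *-identityʳ (c *E Mv₀ i) ⟩
        c *E Mv₀ i                          ∎))
        where k⁻¹ = k F.⁻¹[ k≢0 ]

    G₂₂≡0 : G 2F 2F ≡ 0E
    G₂₂≡0 = by T∝G₂
      where
      by : T ∝E (λ i → G i 2F) → G 2F 2F ≡ 0E
      by (c , c≢0 , e) = *-cancelˡ-0 c≢0 (trans (sym (e 2F)) T-on)

    M-curveC : ∀ u i → (M ·3 (λ j → ι (curveC u j))) i ≡ (G ·3 (λ j → ι (u j))) i
    M-curveC u i = trans (·3-cong M (λ j → sym (CE-ι u j)) i) (sym (G·3 (λ j → ι (u j)) i))

    -- A relation over F puts the image of (a, b, 0) under `G`, a point of the Baer subplane, on ℓ∞.
    -- By tangency it is T̄, which is the last column of `G`; nonsingularity then forces a = b = 0.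
    w-independent : ∀ a b → ι a *E G 2F 0F +E ι b *E G 2F 1F ≡ 0E → a ≡ F.0# × b ≡ F.0#
    w-independent a b e = by (Finₚ.all? (λ i → v i F.≟ F.0#))
      where
      u v : V F.Carrier 3
      u = vec3 a b F.0#
      v = curveC u
      X : V E 3
      X = M ·3 (λ j → ι (v j))
      X-on : OnLinf X
      X-on = trans (M-curveC u 2F) (trans (solve 5 (λ a b x y z → x :* a :+ (y :* b :+ z :* 𝟘) := a :* x :+ b :* y)
        refl (ι a) (ι b) (G 2F 0F) (G 2F 1F) (G 2F 2F)) e)
      proportional : X ∝E T → T ∝E (λ i → G i 2F) → a ≡ F.0# × b ≡ F.0#
      proportional (c , _ , X≡) (d , _ , T≡) = ι-injective (uE≡0 0F) , ι-injective (uE≡0 1F)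
        where
        uE : V E 3
        -- The image of (a, b, 0) equals cd times the last column, so the last entry -cd produces a
        -- kernel vector.
        uE = vec3 (ι a) (ι b) (-E (c *E d))
        uE≡0 : ∀ j → uE j ≡ 0E
        uE≡0 = nsG uE λ i → trans
          (solve 7 (λ a b c d x y z → x :* a :+ (y :* b :+ z :* (:- (c :* d))) := x :* a :+ (y :* b :+ z :* 𝟘) :+ :- (c :* (d :* z)))
            refl (ι a) (ι b) c d (G i 0F) (G i 1F) (G i 2F))
          (x≡y⇒x-y≡0 (trans (sym (M-curveC u i)) (trans (X≡ i) (cong (c *E_) (T≡ i)))))
      by : Dec (∀ i → v i ≡ F.0#) → a ≡ F.0# × b ≡ F.0#
      by (yes z) = independent u z 0F , independent u z 1F
      by (no nz) = proportional (T-only X (X≢0 , v , nz , 1E , 1≢0 , λ i → sym (*-identityˡ (X i))) X-on) T∝G₂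
        where
        X≢0 : NonZeroE X
        X≢0 z = nz (λ i → ι-injective (nsM (λ j → ι (v j)) z i))

    curve-point : F.Carrier → V F.Carrier 3
    curve-point t i = C i 0F F.+ (C i 1F F.* t F.+ C i 2F F.* (t F.* t))

    M-curve-point : ∀ t i → (M ·3 (λ j → ι (curve-point t j))) i ≡ (G ·3 pw (ι t)) i
    M-curve-point t i = trans (·3-cong M (λ j → cong (λ z → ι (z F.+ (C j 1F F.* t F.+ C j 2F F.* (t F.* t)))) (sym (F.*-identityʳ (C j 0F)))) i)
      (trans (M-curveC (pwF t) i) (·3-cong G (all₃ {λ j → ι (pwF t j) ≡ pw (ι t) j} refl refl (ι-* t t)) i))

    rescale : ∀ {X : V E 3} {u v : V F.Carrier 3} {Y : V E 3} l → l ≢ F.0# → X ∝E (M ·3 (λ i → ι (v i))) →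
      (∀ i → v i ≡ l F.* u i) → (∀ i → (M ·3 (λ j → ι (u j))) i ≡ Y i) → X ∝E Y
    rescale {X} {u} {v} {Y} l l≢0 (c , c≢0 , X≡) v≡ Mu≡ = c *E ι l , *-≢0 c≢0 (ι-≢0 l≢0) , λ i → begin
      X i                                     ≡⟨ X≡ i ⟩
      c *E (M ·3 (λ i → ι (v i))) i           ≡⟨ cong (c *E_) (·3-cong M (λ j → trans (cong ι (v≡ j)) (ι-* l (u j))) i) ⟩
      c *E (M ·3 (λ i → ι l *E ι (u i))) i    ≡⟨ cong (c *E_) (trans (·3-scale M (ι l) (λ i → ι (u i)) i) (cong (ι l *E_) (Mu≡ i))) ⟩
      c *E (ι l *E Y i)                       ≡⟨ sym (*-assoc c (ι l) (Y i)) ⟩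
      c *E ι l *E Y i                         ∎

    conic⇒ : ∀ X → ConicPoint M Q X → (Σ F.Carrier λ t → X ∝E (G ·3 pw (ι t))) ⊎ X ∝E (λ i → G i 2F)
    conic⇒ X (_ , v , v≢0 , Qv≡0 , X∝) = by (cover v v≢0 Qv≡0)
      where
      by : (Σ F.Carrier λ t → Σ F.Carrier λ l → l ≢ F.0# × (∀ i → v i ≡ l F.* curve-point t i))
         ⊎ (Σ F.Carrier λ l → l ≢ F.0# × (∀ i → v i ≡ l F.* C i 2F)) →
         (Σ F.Carrier λ t → X ∝E (G ·3 pw (ι t))) ⊎ X ∝E (λ i → G i 2F)
      by (inj₁ (t , l , l≢0 , e)) = inj₁ (t , rescale {X} {curve-point t} {v} {G ·3 pw (ι t)} l l≢0 X∝ e (M-curve-point t))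
      by (inj₂ (l , l≢0 , e))     = inj₂ (rescale {X} {λ i → C i 2F} {v} {λ i → G i 2F} l l≢0 X∝ e (λ i → refl))

    ⇒conic : ∀ X → NonZeroE X → ∀ t → X ∝E (G ·3 pw (ι t)) → ConicPoint M Q X
    ⇒conic X X≢0 t (c , c≢0 , X≡) = X≢0 , curve-point t , v≢0 , on-conic t , c , c≢0 , X≡′
      where
      X≡′ : ∀ i → X i ≡ c *E (M ·3 (λ j → ι (curve-point t j))) i
      X≡′ i = trans (X≡ i) (cong (c *E_) (sym (M-curve-point t i)))
      v≢0 : ¬ (∀ i → curve-point t i ≡ F.0#)
      v≢0 z = F.1≢0 (independent (pwF t) (λ i → trans (cong (F._+ (C i 1F F.* t F.+ C i 2F F.* (t F.* t))) (F.*-identityʳ (C i 0F))) (z i)) 0F)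

theorem5p5 : (q : ℕ) → IsPrimePower q → 5 < q →
    (F : Field) → Field.Carrier F ↔ Fin q →
    (t₀ t₁ : Field.Carrier F) →
    let open Geometry F q t₀ t₁ in
    Irreducible → Primitive →
    (M : Mat3) → Nonsingular M →
    (T : V E 3) → TangentAt M T →
    (Q : QuadForm) → NonDegenerate Q → ConicPoint M Q T →
    Σ (V (Field.Carrier F) 5) λ P → OnSpreadLine T P
    × TwistedCubic (CurveWith M Q P) × GSpecial (CurveWith M Q P)
theorem5p5 q pp 5<q F enum t₀ t₁ irr prim M nsM T (T≢0 , T-on , _ , T-only) Q nd (_ , v₀ , v₀≢0 , Qv₀≡0 , T∝Mv₀) =
  P₀ , on-spread-line G nsG G₂₂≡0 w-independent T T∝G₂ , (K₀ , r₀ , p₀) , special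
  where
  open Geometry F q t₀ t₁
  open QuadraticExtension F q t₀ t₁ irr
  open TwistedCubics F q t₀ t₁ irr
  open Special F q t₀ t₁ irr using (exactlyOne-cong)
  open ConicImage F q t₀ t₁ irr
  open BaerConic F q t₀ t₁ irr M nsM T T≢0 T-on T-only Q v₀ T∝Mv₀
    (Conics.conic-param F q t₀ t₁ Q v₀ nd v₀≢0 Qv₀≡0)
  7≤q = prime-power>5⇒≥7 pp 5<q
  1<q : 1 < q
  1<q = ℕₚ.≤-trans (s≤s (s≤s z≤n)) 5<q
  K₀ : Mat54
  K₀ = K G nsG G₂₂≡0 w-independent
  P₀ : V (Field.Carrier F) 5
  P₀ = P G nsG G₂₂≡0 w-independent
  r₀ : Rank4 K₀
  r₀ = rank4 G nsG G₂₂≡0 w-independent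
  p₀ : Parametrizes K₀ (CurveWith M Q P₀)
  p₀ = parametrizes G nsG G₂₂≡0 w-independent M Q conic⇒ ⇒conic
  τq≡ : τq ≡ σ τ
  τq≡ = τq≡στ pp 1<q enum prim
  0^q : 0E ^E q ≡ 0E
  0^q = frob-0 pp 1<q enum prim
  -1^q : (-E 1E) ^E q ≡ -E 1E
  -1^q = frob-1 pp 1<q enum prim
  on-g : ExactlyOnePoint (Star K₀) On-g
  on-g = meets-g G nsG G₂₂≡0 w-independent
    (all₅ {λ i → A₀ i ≡ vec5 (σ τ) (-E 1E) 0E 0E 0E i} τq≡ refl refl refl refl)
    (all₅ {λ i → A₁ i ≡ vec5 0E 0E (σ τ) (-E 1E) 0E i} refl refl τq≡ refl refl)
  on-gq : ExactlyOnePoint (Star K₀) On-gq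
  on-gq = meets-gq G nsG G₂₂≡0 w-independent
    (all₅ {λ i → frob A₀ i ≡ vec5 τ (-E 1E) 0E 0E 0E i} (τqq≡τ pp 1<q enum prim) -1^q 0^q 0^q 0^q)
    (all₅ {λ i → frob A₁ i ≡ vec5 0E 0E τ (-E 1E) 0E i} 0^q 0^q (τqq≡τ pp 1<q enum prim) -1^q 0^q)
  special : GSpecial (CurveWith M Q P₀)
  special K′ r′ p′ = exactlyOne-cong ⊆ ⊇ on-g , exactlyOne-cong ⊆ ⊇ on-gq
    where
    ⊆ : ∀ Y → Star K₀ Y → Star K′ Y
    ⊆ = star-⊆ enum 7≤q {K′} {K₀} {CurveWith M Q P₀} r′ r₀ p′ p₀
    ⊇ : ∀ Y → Star K′ Y → Star K₀ Y
    ⊇ = star-⊆ enum 7≤q {K₀} {K′} {CurveWith M Q P₀} r₀ r′ p₀ p′
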